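{- Let $S$ be a polynomial time computable permutation of $\{0\}^*$ such that for each polynomial $p$ there are infinitely many $n$ with $p(S(n)) \le n$. Then there is a polynomial time random set $Z$, computable in time $2^{O(n)}$, such that $Z \circ S$ is not polynomial time random.
   Context: Polynomials are non-constant with natural number coefficients. Subsets of $\mathbb{N}$ (infinite bit sequences) are identified with subsets of $\{0\}^*$ via $n\leftrightarrow 0^n$; complexity of a set $Z$ refers to deciding $Z(n)$ on input $0^n$, and a permutation $S$ of $\{0\}^*$ is polynomial time computable if $0^n\mapsto 0^{S(n)}$ is. For a permutation $S$ and set $Z$, $Z\circ S$ is the sequence $Y$ with $Y(n)=Z(S(n))$. A martingale is a function $M$ from $\{0,1\}^*$ to the positive rationals with $M(x)=(M(x0)+M(x1))/2$ for all $x$; it succeeds on $Z$ if $\limsup_n M(Z\upharpoonright n)=\infty$. A martingale is polynomial time computable if on input $x$ one can compute in polynomial time $M(x)$ given as numerator and denominator in lowest terms in binary. $Z$ is polynomial time random if no polynomial time computable martingale succeeds on $Z$. -}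

module Defs where

open import Data.Nat using (ℕ; zero; suc; _+_; _*_; _^_; _≤_; _<_)
open import Data.Nat.DivMod using (_/_; _%_)
open import Data.Bool using (Bool; true; false; if_then_else_)
open import Data.List using (List; []; _∷_; _++_; map; upTo; replicate; length; reverse)
open import Data.List.Relation.Unary.Any using (Any)
open import Data.Fin using (Fin)
open import Data.Maybe using (Maybe; just; nothing)
open import Data.Product using (Σ; ∃; _×_; _,_)
open import Data.Integer using (∣_∣)
open import Data.Rational as ℚ using (ℚ; 0ℚ; ½)
open import Relation.Binary.PropositionalEquality using (_≡_; _≢_)
open import Relation.Nullary using (¬_)
open import Function.Definitions using (Injective; Surjective)

evalPoly : List ℕ → ℕ → ℕ
evalPoly []       n = 0
evalPoly (a ∷ as) n = a + n * evalPoly as n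

NonConstant : List ℕ → Set
NonConstant []       = Any (λ a → a ≢ 0) []
NonConstant (a ∷ as) = Any (λ a → a ≢ 0) as

record Polynomial : Set where
  constructor poly
  field
    coeffs      : List ℕ
    nonConstant : NonConstant coeffs

_⟦_⟧ : Polynomial → ℕ → ℕ
p ⟦ n ⟧ = evalPoly (Polynomial.coeffs p) n

-- Machine model: deterministic single-tape Turing machines over the
-- tape alphabet {blank, 0, 1, #}, with a two-way infinite tape.

data Sym : Set where
  blank s0 s1 sep : Sym

data Move : Set where
  L R N : Move

-- States are Fin (suc states); the start state is Fin.zero.
-- δ q a ≡ nothing means the machine halts in state q reading a.
record TM : Set where
  field
    states : ℕ
    δ      : Fin (suc states) → Sym → Maybe (Fin (suc states) × Sym × Move)

record Config (M : TM) : Set where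
  constructor conf
  field
    state : Fin (suc (TM.states M))
    left  : List Sym     -- cells to the left of the head, nearest first
    head  : Sym
    right : List Sym     -- cells to the right of the head, nearest first

initConfig : (M : TM) → List Sym → Config M
initConfig M []       = conf Fin.zero [] blank []
initConfig M (a ∷ as) = conf Fin.zero [] a as

moveHead : {M : TM} → Fin (suc (TM.states M)) → List Sym → Sym → List Sym → Move → Config M
moveHead q ls        a rs        N = conf q ls a rs
moveHead q []        a rs        L = conf q [] blank (a ∷ rs)
moveHead q (l ∷ ls)  a rs        L = conf q ls l (a ∷ rs)
moveHead q ls        a []        R = conf q (a ∷ ls) blank []
moveHead q ls        a (r ∷ rs)  R = conf q (a ∷ ls) r rs

run : (M : TM) → ℕ → Config M → Maybe (Config M)
run M t c with TM.δ M (Config.state c) (Config.head c)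
... | nothing = just c
run M zero    c | just _ = nothing
run M (suc t) c | just (q , b , m) =
  run M t (moveHead q (Config.left c) b (Config.right c) m)

readOut : List Sym → List Sym
readOut []          = []
readOut (blank ∷ _) = []
readOut (a ∷ as)    = a ∷ readOut as

output : {M : TM} → Config M → List Sym
output c = readOut (Config.head c ∷ Config.right c)

HaltsWith : TM → List Sym → ℕ → List Sym → Set
HaltsWith M x t y = ∃ λ c → (run M t (initConfig M x) ≡ just c) × (output c ≡ y)

bitSym : Bool → Sym
bitSym false = s0
bitSym true  = s1

unary : ℕ → List Sym
unary n = replicate n s0

-- binary representation, most significant bit first, no leading zeros
-- (binary 0 = []; only used for positive numbers below)
binaryRev : ℕ → ℕ → List Bool   -- fuel, number; least significant first
binaryRev zero     n = []
binaryRev (suc f)  zero = []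
binaryRev (suc f)  n@(suc _) = (n % 2 Data.Nat.≡ᵇ 1) ∷ binaryRev f (n / 2)
  where import Data.Nat

binary : ℕ → List Bool
binary n = reverse (binaryRev n n)

-- a positive rational as numerator and denominator in lowest terms in binary
-- (ℚ from the standard library is always normalised)
encodeℚ : ℚ → List Sym
encodeℚ q = map bitSym (binary ∣ ℚ.numerator q ∣) ++ sep ∷ map bitSym (binary (ℚ.denominatorℕ q))

ComputesUnaryIn : TM → (ℕ → ℕ) → (ℕ → ℕ) → Set
ComputesUnaryIn M S t = ∀ n → HaltsWith M (unary n) (t n) (unary (S n))

PolyTimeFunction : (ℕ → ℕ) → Set
PolyTimeFunction S = Σ TM λ M → Σ Polynomial λ p → ComputesUnaryIn M S (p ⟦_⟧)

DecidesIn : TM → (ℕ → Bool) → (ℕ → ℕ) → Set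
DecidesIn M Z t = ∀ n → HaltsWith M (unary n) (t n) (bitSym (Z n) ∷ [])

ExpTimeSet : (ℕ → Bool) → Set
ExpTimeSet Z = Σ TM λ M → Σ ℕ λ c → DecidesIn M Z (λ n → 2 ^ (c * n + c))

-- Permutations of {0}* (identified with ℕ)

IsPermutation : (ℕ → ℕ) → Set
IsPermutation S = Injective _≡_ _≡_ S × Surjective _≡_ _≡_ S

Word : Set
Word = List Bool

record Martingale : Set where
  field
    M        : Word → ℚ
    positive : ∀ x → 0ℚ ℚ.< M x
    fair     : ∀ x → M x ≡ ½ ℚ.* (M (x ++ false ∷ []) ℚ.+ M (x ++ true ∷ []))

PolyTimeMartingale : Martingale → Set
PolyTimeMartingale d = Σ TM λ T → Σ Polynomial λ p →
  ∀ x → HaltsWith T (map bitSym x) (p ⟦ length x ⟧) (encodeℚ (Martingale.M d x))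

_↾_ : (ℕ → Bool) → ℕ → Word
Z ↾ n = map Z (upTo n)

Succeeds : Martingale → (ℕ → Bool) → Set
Succeeds d Z = ∀ (k m : ℕ) → Σ ℕ λ n → m ≤ n × (Data.Integer.+ k ℚ./ 1) ℚ.< Martingale.M d (Z ↾ n)
  where import Data.Integer

PolyTimeRandom : (ℕ → Bool) → Set
PolyTimeRandom Z = ∀ (d : Martingale) → PolyTimeMartingale d → ¬ Succeeds d Z

_∘ˢ_ : (ℕ → Bool) → (ℕ → ℕ) → (ℕ → Bool)
(Z ∘ˢ S) n = Z (S n)

{-# OPTIONS --safe #-}
module Submission where

-- Let lev n count the j < n with (2 + S j) ^ (1 + lev j) ≤ j; the hypothesis on S makes
-- lev unbounded. Z n is found by simulating the martingales computed by the first n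
-- machines for clk n = (2 + n) ^ (1 + lev n) steps, keeping a rational capital for each,
-- and choosing the bit that does not increase the total capital. Since clk exceeds every
-- polynomial, each polynomial-time martingale is eventually simulated faithfully, so it
-- stays bounded on Z. At the j counted by lev, clk (S j) ≤ j, so Z (S j) is computable
-- from scratch in time polynomial in j: betting one unit on it each time wins lev n on
-- Z ∘ S. Since 2 ^ lev n ≤ n + 1, clk n is 2 ^ O(n).
--
-- Time bounds come from a class of functions on lists, pairs and unary numbers closed
-- under composition and size-bounded iteration, compiled to machines with four bit
-- stacks and from there to one tape. A bound on time then reduces to bounds on sizes.

open import Defs
open import Data.Bool using (Bool; true; false; if_then_else_; not)
open import Data.Empty using (⊥-elim)
open import Data.Fin using (Fin; _↑ˡ_; _↑ʳ_; splitAt; toℕ)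
open import Data.Fin.Properties using (splitAt-↑ˡ; splitAt-↑ʳ)
import Data.Integer as ℤ
import Data.Integer.Properties as ℤ
open import Data.List using (List; []; _∷_; _++_; _ʳ++_; map; replicate; length; reverse; foldl; foldr; upTo)
open import Data.List.Membership.Propositional using (_∈_)
open import Data.List.Membership.Propositional.Properties using (∈-map⁺)
open import Data.List.Properties using (++-assoc; ++-identityʳ; ++-ʳ++; foldl-++; length-++; length-map; length-replicate; length-upTo; length-ʳ++; map-++; map-replicate; reverse-++; reverse-foldl; reverse-foldr; reverse-involutive; unfold-reverse; upTo-∷ʳ; ʳ++-ʳ++)
open import Data.List.Relation.Unary.All using (All; []; _∷_)
open import Data.List.Relation.Unary.All.Properties using (++⁺)
open import Data.List.Relation.Unary.Any using (here; there)
open import Data.Maybe using (Maybe; just; nothing; maybe)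
open import Data.Nat hiding (_/_; _%_)
open import Data.Nat.Coprimality using (1-coprimeTo) renaming (sym to coprime-sym)
open import Data.Nat.DivMod using (_/_; _%_; m≡m%n+[m/n]*n; m%n<n; m/n<m)
open import Data.Nat.Properties
open import Data.Nat.Tactic.RingSolver using (solve-∀)
open import Data.Product hiding (map; swap)
open import Data.Rational as ℚ using (ℚ; 0ℚ; ½; mkℚ)
import Data.Rational.Properties as ℚ
open import Data.Rational.Unnormalised as ℚᵘ using (mkℚᵘ; *≡*; *<*)
import Data.Rational.Unnormalised.Properties as ℚᵘ
open import Data.Sum using (_⊎_; inj₁; inj₂)
open import Data.Unit using (⊤; tt)
open import Data.Vec using (Vec; []; _∷_; lookup; _[_]≔_)
open import Function using (_∘_; id)
open import Relation.Binary.PropositionalEquality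
open import Relation.Nullary using (¬_; contradiction)

-- Structured tape programs and their Turing machines

-- The two demands on the clock pull apart: it must exceed every polynomial, yet `clk (S j) ≤ j`
-- must hold for infinitely many `j`. They are reconciled by letting `lev` rise exactly when `j`
-- witnesses the inequality for the present level, so that each rise is itself an opportunity to
-- bet. Both uses of `Z` as an algorithm go through `Zcap F n`, the same construction with all
-- clocks cut off at `F`: it is polynomial in unary `F` and `n`, and agrees with `Z n` as soon as
-- `clk n ≤ F`. The gambler takes `F = j` at position `S j`; the exponential-time machine takes
-- `F = 2 ^ pad n`. A simulated machine need not compute a martingale. Only the ratio of its two
-- answers is used, as a betting ratio, so every output yields a fair strategy; a genuine martingale
-- is followed up to a constant factor, fixed at the stage from which its simulation is faithful.
-- Capitals are unreduced fractions of natural numbers, and all inequalities between them are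
-- cross-multiplied.

data Tape : Set where
  tape : List Sym → Sym → List Sym → Tape

shift : Move → List Sym → Sym → List Sym → Tape
shift N ls       a rs       = tape ls a rs
shift L []       a rs       = tape [] blank (a ∷ rs)
shift L (l ∷ ls) a rs       = tape ls l (a ∷ rs)
shift R ls       a []       = tape (a ∷ ls) blank []
shift R ls       a (r ∷ rs) = tape (a ∷ ls) r rs

infixr 5 _⨾_

data Prog : Set where
  act   : (Sym → Sym × Move) → Prog
  _⨾_   : Prog → Prog → Prog
  ifs   : (Sym → Bool) → Prog → Prog → Prog
  while : (Sym → Bool) → Prog → Prog

-- For `ifs` and `while` the state `nothing` tests the scanned symbol; passing through it costs one
-- step and leaves the tape alone.
St : Prog → Set
St (act f)     = ⊤
St (p ⨾ q)     = St p ⊎ St q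
St (ifs c p q) = Maybe (St p ⊎ St q)
St (while c p) = Maybe (St p)

entry : (p : Prog) → St p
entry (act f)     = tt
entry (p ⨾ q)     = inj₁ (entry p)
entry (ifs c p q) = nothing
entry (while c p) = nothing

-- The next state is `nothing` when the program exits.
step : (p : Prog) → St p → Sym → Maybe (St p) × Sym × Move
step (act f)     _               a = nothing , f a
step (p ⨾ q)     (inj₁ s)        a = map₁ (just ∘ maybe inj₁ (inj₂ (entry q))) (step p s a)
step (p ⨾ q)     (inj₂ s)        a = map₁ (Data.Maybe.map inj₂) (step q s a)
step (ifs c p q) nothing         a = just (just (if c a then inj₁ (entry p) else inj₂ (entry q))) , a , N
step (ifs c p q) (just (inj₁ s)) a = map₁ (Data.Maybe.map (just ∘ inj₁)) (step p s a)
step (ifs c p q) (just (inj₂ s)) a = map₁ (Data.Maybe.map (just ∘ inj₂)) (step q s a)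
step (while c p) nothing         a = (if c a then just (just (entry p)) else nothing) , a , N
step (while c p) (just s)        a = map₁ just (step p s a)

stepTape : (p : Prog) → St p → Tape → Maybe (St p) × Tape
stepTape p s (tape ls a rs) = let r , b , m = step p s a in r , shift m ls b rs

-- Run p s τ t τ′ : from state s on tape τ, p exits on τ′ after at most t steps.
data Run (p : Prog) : St p → Tape → ℕ → Tape → Set where
  stop : ∀ {s τ t τ′} → stepTape p s τ ≡ (nothing , τ′) → Run p s τ (suc t) τ′
  next : ∀ {s s₁ τ τ₁ t τ′} → stepTape p s τ ≡ (just s₁ , τ₁) → Run p s₁ τ₁ t τ′ → Run p s τ (suc t) τ′

infix 3 _⊢_⇓_#_

_⊢_⇓_#_ : Prog → Tape → Tape → ℕ → Set
p ⊢ τ ⇓ τ′ # t = Run p (entry p) τ t τ′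

weaken : ∀ {p s τ t u τ′} → t ≤ u → Run p s τ t τ′ → Run p s τ u τ′
weaken (s≤s le) (stop e)   = stop e
weaken (s≤s le) (next e r) = next e (weaken le r)

run-⨾ʳ : ∀ {p q s τ t τ′} → Run q s τ t τ′ → Run (p ⨾ q) (inj₂ s) τ t τ′
run-⨾ʳ {τ = tape _ _ _} (stop e)   = stop (cong (map₁ (Data.Maybe.map inj₂)) e)
run-⨾ʳ {τ = tape _ _ _} (next e r) = next (cong (map₁ (Data.Maybe.map inj₂)) e) (run-⨾ʳ r)

-- The exiting step of `p` already leads into the entry state of `q`, so the times simply add.
run-⨾ˡ : ∀ {p q s τ a b τ₁ τ₂} → Run p s τ a τ₁ → q ⊢ τ₁ ⇓ τ₂ # b → Run (p ⨾ q) (inj₁ s) τ (a + b) τ₂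
run-⨾ˡ {τ = tape _ _ _} {suc a} {b} (stop e)   r′ = next (cong (map₁ (just ∘ maybe inj₁ (inj₂ _))) e) (run-⨾ʳ (weaken (m≤n+m b a) r′))
run-⨾ˡ {τ = tape _ _ _} (next e r) r′ = next (cong (map₁ (just ∘ maybe inj₁ (inj₂ _))) e) (run-⨾ˡ r r′)

infixr 5 _⨟_

_⨟_ : ∀ {p q τ a b τ₁ τ₂} → p ⊢ τ ⇓ τ₁ # a → q ⊢ τ₁ ⇓ τ₂ # b → p ⨾ q ⊢ τ ⇓ τ₂ # a + b
_⨟_ = run-⨾ˡ

tapeHead : Tape → Sym
tapeHead (tape _ a _) = a

run-ifˡ : ∀ {c p q s τ t τ′} → Run p s τ t τ′ → Run (ifs c p q) (just (inj₁ s)) τ t τ′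
run-ifˡ {τ = tape _ _ _} (stop e)   = stop (cong (map₁ (Data.Maybe.map (just ∘ inj₁))) e)
run-ifˡ {τ = tape _ _ _} (next e r) = next (cong (map₁ (Data.Maybe.map (just ∘ inj₁))) e) (run-ifˡ r)

run-ifʳ : ∀ {c p q s τ t τ′} → Run q s τ t τ′ → Run (ifs c p q) (just (inj₂ s)) τ t τ′
run-ifʳ {τ = tape _ _ _} (stop e)   = stop (cong (map₁ (Data.Maybe.map (just ∘ inj₂))) e)
run-ifʳ {τ = tape _ _ _} (next e r) = next (cong (map₁ (Data.Maybe.map (just ∘ inj₂))) e) (run-ifʳ r)

if-true : ∀ {c p q τ t τ′} → c (tapeHead τ) ≡ true → p ⊢ τ ⇓ τ′ # t → ifs c p q ⊢ τ ⇓ τ′ # suc t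
if-true {c} {p} {q} {tape ls a rs} h r =
  next (cong (λ z → just (just (if z then inj₁ (entry p) else inj₂ (entry q))) , tape ls a rs) h) (run-ifˡ r)

if-false : ∀ {c p q τ t τ′} → c (tapeHead τ) ≡ false → q ⊢ τ ⇓ τ′ # t → ifs c p q ⊢ τ ⇓ τ′ # suc t
if-false {c} {p} {q} {tape ls a rs} h r =
  next (cong (λ z → just (just (if z then inj₁ (entry p) else inj₂ (entry q))) , tape ls a rs) h) (run-ifʳ r)

while-end : ∀ {c p τ} → c (tapeHead τ) ≡ false → while c p ⊢ τ ⇓ τ # 1
while-end {c} {p} {tape ls a rs} h = stop (cong (λ z → (if z then just (just (entry p)) else nothing) , tape ls a rs) h)

run-while : ∀ {c p s τ a b τ₁ τ₂} → Run p s τ a τ₁ → while c p ⊢ τ₁ ⇓ τ₂ # b → Run (while c p) (just s) τ (a + b) τ₂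
run-while {τ = tape _ _ _} {suc a} {b} (stop e) r′ = next (cong (map₁ just) e) (weaken (m≤n+m b a) r′)
run-while {τ = tape _ _ _} (next e r) r′ = next (cong (map₁ just) e) (run-while r r′)

while-step : ∀ {c p τ a b τ₁ τ₂} → c (tapeHead τ) ≡ true → p ⊢ τ ⇓ τ₁ # a → while c p ⊢ τ₁ ⇓ τ₂ # b →
  while c p ⊢ τ ⇓ τ₂ # suc (a + b)
while-step {c} {p} {tape ls a rs} h r r′ =
  next (cong (λ z → (if z then just (just (entry p)) else nothing) , tape ls a rs) h) (run-while r r′)

#St : Prog → ℕ
#St (act f)     = 1
#St (p ⨾ q)     = #St p + #St q
#St (ifs c p q) = suc (#St p + #St q)
#St (while c p) = suc (#St p)

toFin : (p : Prog) → St p → Fin (#St p)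
toFin (act f)     _               = Fin.zero
toFin (p ⨾ q)     (inj₁ s)        = toFin p s ↑ˡ #St q
toFin (p ⨾ q)     (inj₂ s)        = #St p ↑ʳ toFin q s
toFin (ifs c p q) nothing         = Fin.zero
toFin (ifs c p q) (just (inj₁ s)) = Fin.suc (toFin p s ↑ˡ #St q)
toFin (ifs c p q) (just (inj₂ s)) = Fin.suc (#St p ↑ʳ toFin q s)
toFin (while c p) nothing         = Fin.zero
toFin (while c p) (just s)        = Fin.suc (toFin p s)

fromFin : (p : Prog) → Fin (#St p) → St p
fromFin (act f)     _           = tt
fromFin (p ⨾ q)     i           = Data.Sum.map (fromFin p) (fromFin q) (splitAt (#St p) i)
fromFin (ifs c p q) Fin.zero    = nothing
fromFin (ifs c p q) (Fin.suc i) = just (Data.Sum.map (fromFin p) (fromFin q) (splitAt (#St p) i))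
fromFin (while c p) Fin.zero    = nothing
fromFin (while c p) (Fin.suc i) = just (fromFin p i)

-- Only states of the form `toFin p s` are ever entered, so this one-sided inverse is all that the
-- simulation by `machine` requires.
fromFin-toFin : (p : Prog) (s : St p) → fromFin p (toFin p s) ≡ s
fromFin-toFin (act f)     _               = refl
fromFin-toFin (p ⨾ q)     (inj₁ s)        rewrite splitAt-↑ˡ (#St p) (toFin p s) (#St q) = cong inj₁ (fromFin-toFin p s)
fromFin-toFin (p ⨾ q)     (inj₂ s)        rewrite splitAt-↑ʳ (#St p) (#St q) (toFin q s) = cong inj₂ (fromFin-toFin q s)
fromFin-toFin (ifs c p q) nothing         = refl
fromFin-toFin (ifs c p q) (just (inj₁ s)) rewrite splitAt-↑ˡ (#St p) (toFin p s) (#St q) = cong (just ∘ inj₁) (fromFin-toFin p s)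
fromFin-toFin (ifs c p q) (just (inj₂ s)) rewrite splitAt-↑ʳ (#St p) (#St q) (toFin q s) = cong (just ∘ inj₂) (fromFin-toFin q s)
fromFin-toFin (while c p) nothing         = refl
fromFin-toFin (while c p) (just s)        = cong just (fromFin-toFin p s)

-- State 0 jumps to the entry point of p, state 1 halts.
machine : Prog → TM
machine p = record { states = suc (#St p) ; δ = δ }
  where
  δ : Fin (suc (suc (#St p))) → Sym → Maybe (Fin (suc (suc (#St p))) × Sym × Move)
  δ Fin.zero              a = just (Fin.suc (Fin.suc (toFin p (entry p))) , a , N)
  δ (Fin.suc Fin.zero)    a = nothing
  δ (Fin.suc (Fin.suc i)) a = just (map₁ (maybe (Fin.suc ∘ Fin.suc ∘ toFin p) (Fin.suc Fin.zero)) (step p (fromFin p i) a))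

withState : {M : TM} → Fin (suc (TM.states M)) → Tape → Config M
withState q (tape ls a rs) = conf q ls a rs

moveHead-shift : ∀ {M} q ls a rs m → moveHead {M} q ls a rs m ≡ withState q (shift m ls a rs)
moveHead-shift q ls       a rs       N = refl
moveHead-shift q []       a rs       L = refl
moveHead-shift q (l ∷ ls) a rs       L = refl
moveHead-shift q ls       a []       R = refl
moveHead-shift q ls       a (r ∷ rs) R = refl

machine-run : ∀ {p s τ t τ′} → Run p s τ t τ′ →
  run (machine p) t (withState (Fin.suc (Fin.suc (toFin p s))) τ) ≡ just (withState (Fin.suc Fin.zero) τ′)
machine-run {p} {s} {tape ls a rs} (stop {t = t} e)
  rewrite fromFin-toFin p s | moveHead-shift {machine p} (maybe (Fin.suc ∘ Fin.suc ∘ toFin p) (Fin.suc Fin.zero) (proj₁ (step p s a))) ls (proj₁ (proj₂ (step p s a))) rs (proj₂ (proj₂ (step p s a)))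
  | cong proj₁ e | cong proj₂ e = halted t _
  where
  halted : ∀ t τ → run (machine p) t (withState (Fin.suc Fin.zero) τ) ≡ just (withState (Fin.suc Fin.zero) τ)
  halted zero    (tape _ _ _) = refl
  halted (suc t) (tape _ _ _) = refl
machine-run {p} {s} {tape ls a rs} (next {t = t} e r)
  rewrite fromFin-toFin p s | moveHead-shift {machine p} (maybe (Fin.suc ∘ Fin.suc ∘ toFin p) (Fin.suc Fin.zero) (proj₁ (step p s a))) ls (proj₁ (proj₂ (step p s a))) rs (proj₂ (proj₂ (step p s a)))
  | cong proj₁ e | cong proj₂ e = machine-run r

-- `from ls rs` has ls to the left of the head (nearest first) and rs from the head on.
from : List Sym → List Sym → Tape
from ls []       = tape ls blank []
from ls (a ∷ rs) = tape ls a rs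

-- The additional step is the jump from state 0 to the entry point.
machine-halts : ∀ {p x t τ′ ls ys} → p ⊢ from [] x ⇓ τ′ # t → τ′ ≡ from ls ys → HaltsWith (machine p) x (suc t) (readOut ys)
machine-halts {p} {x} {t} {τ′} {ls} {ys} r refl = withState (Fin.suc Fin.zero) (from ls ys) , go x r , out ys
  where
  go : ∀ x → p ⊢ from [] x ⇓ from ls ys # t → run (machine p) (suc t) (initConfig (machine p) x) ≡ just (withState (Fin.suc Fin.zero) (from ls ys))
  go []      r = machine-run r
  go (_ ∷ _) r = machine-run r
  out : ∀ ys → output {machine p} (withState (Fin.suc Fin.zero) (from ls ys)) ≡ readOut ys
  out []      = refl
  out (_ ∷ _) = refl

-- Bit stacks on a tape

-- Reduces an inequality of polynomials to an identity with the difference `k` made explicit, which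
-- the ring solver can prove.
m+k≡n⇒m≤n : ∀ {m n} k → m + k ≡ n → m ≤ n
m+k≡n⇒m≤n {m} k refl = m≤m+n m k

moveR moveL : Prog
moveR = act (λ a → a , R)
moveL = act (λ a → a , L)

write : Sym → Prog
write b = act (λ _ → b , N)

nonblank is0 is1 isBit : Sym → Bool
nonblank blank = false
nonblank _     = true
is0 s0 = true
is0 _  = false
is1 s1 = true
is1 _  = false
isBit s0 = true
isBit s1 = true
isBit _  = false

NonBlank : List Sym → Set
NonBlank = All (λ a → nonblank a ≡ true)

blanks : ℕ → List Sym
blanks m = replicate m blank

-- Cells beyond the recorded part of the tape are blank, so one blank may always be taken as
-- recorded.
from-blanks : ∀ ls m → from ls (blanks m) ≡ from ls (blank ∷ blanks (m ∸ 1))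
from-blanks ls zero    = refl
from-blanks ls (suc m) = refl

moveR-run : ∀ {ls a rs} → moveR ⊢ from ls (a ∷ rs) ⇓ from (a ∷ ls) rs # 1
moveR-run {rs = []}    = stop refl
moveR-run {rs = _ ∷ _} = stop refl

moveL-run : ∀ {l ls a rs} → moveL ⊢ from (l ∷ ls) (a ∷ rs) ⇓ from ls (l ∷ a ∷ rs) # 1
moveL-run = stop refl

write-run : ∀ {b ls a rs} → write b ⊢ from ls (a ∷ rs) ⇓ from ls (b ∷ rs) # 1
write-run = stop refl

walkR : (c : Sym → Bool) → Prog
walkR c = while c moveR

head-blanks : ∀ ls m → tapeHead (from ls (blanks m)) ≡ blank
head-blanks ls zero    = refl
head-blanks ls (suc m) = refl

walkR-run : ∀ {c ls} w {rs} → All (λ a → c a ≡ true) w → c (tapeHead (from (w ʳ++ ls) rs)) ≡ false →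
  walkR c ⊢ from ls (w ++ rs) ⇓ from (w ʳ++ ls) rs # 2 * length w + 1
walkR-run []      []       e = while-end e
walkR-run (a ∷ w) (x ∷ xs) e =
  weaken (≤-reflexive (cong (_+ 1) (sym (*-distribˡ-+ 2 1 (length w))))) (while-step x moveR-run (walkR-run w xs e))

-- Sends the head to the cell after the nearest blank on its left.
home : Prog
home = moveL ⨾ while nonblank moveL ⨾ moveR

walkL-run : ∀ w {c ls rs} → NonBlank (c ∷ w) →
  while nonblank moveL ⊢ from (w ++ blank ∷ ls) (c ∷ rs) ⇓ from ls (blank ∷ (w ʳ++ (c ∷ rs))) # 2 * length w + 3
walkL-run []      (x ∷ [])     = while-step x moveL-run (while-end refl)
walkL-run (a ∷ w) (x ∷ y ∷ xs) =
  weaken (≤-reflexive (cong (_+ 3) (sym (*-distribˡ-+ 2 1 (length w))))) (while-step x moveL-run (walkL-run w (y ∷ xs)))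

All-ʳ++ : ∀ {P : Sym → Set} {u v} → All P u → All P v → All P (u ʳ++ v)
All-ʳ++ []       ys = ys
All-ʳ++ (x ∷ xs) ys = All-ʳ++ xs (x ∷ ys)

ʳ++-++-assoc : ∀ (xs : List Sym) {ys zs} → (xs ʳ++ ys) ++ zs ≡ xs ʳ++ (ys ++ zs)
ʳ++-++-assoc []       = refl
ʳ++-++-assoc (x ∷ xs) = ʳ++-++-assoc xs

-- The scanned cell `d` is left without being tested and may be blank; the walk stops at the blank
-- in front of the layout.
home-run′ : ∀ w {c rs} → NonBlank (c ∷ w) → ∀ {d} →
  home ⊢ from (c ∷ w ++ blank ∷ []) (d ∷ rs) ⇓ from (blank ∷ []) ((c ∷ w) ʳ++ (d ∷ rs)) # 2 * length w + 5
home-run′ w xs =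
  weaken (≤-reflexive (solve-1 (length w))) (moveL-run ⨟ walkL-run w xs ⨟ moveR-run)
  where
  solve-1 : ∀ n → 1 + (2 * n + 3 + 1) ≡ 2 * n + 5
  solve-1 = solve-∀

home-run : ∀ c u {d rs} → NonBlank (c ∷ u) →
  home ⊢ from ((c ∷ u) ʳ++ (blank ∷ [])) (d ∷ rs) ⇓ from (blank ∷ []) ((c ∷ u) ++ (d ∷ rs)) # 2 * length (c ∷ u) + 5
home-run c u {d} {rs} xs with (c ∷ u) ʳ++ [] in eq
... | [] with () ← trans (sym (length-ʳ++ (c ∷ u))) (cong length eq)
... | c′ ∷ w = subst₂ (λ l r → home ⊢ from l (d ∷ rs) ⇓ from (blank ∷ []) r # 2 * length (c ∷ u) + 5) el er
    (weaken (+-monoˡ-≤ 5 (*-monoʳ-≤ 2 le)) (home-run′ w (subst NonBlank eq (All-ʳ++ xs []))))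
  where
  el : c′ ∷ w ++ blank ∷ [] ≡ (c ∷ u) ʳ++ (blank ∷ [])
  el = trans (cong (_++ blank ∷ []) (sym eq)) (ʳ++-++-assoc (c ∷ u))
  er : (c′ ∷ w) ʳ++ (d ∷ rs) ≡ (c ∷ u) ++ (d ∷ rs)
  er = trans (cong (_ʳ++ (d ∷ rs)) (sym eq)) (ʳ++-ʳ++ (c ∷ u))
  le : length w ≤ length (c ∷ u)
  le = ≤-trans (n≤1+n _) (≤-reflexive (trans (cong length (sym eq)) (trans (length-ʳ++ (c ∷ u)) (+-identityʳ _))))

-- The finite control remembers the symbol being carried: one branch for each nonblank symbol.
copyR copyL : Prog
copyR = ifs is0 (moveR ⨾ write s0 ⨾ moveL) (ifs is1 (moveR ⨾ write s1 ⨾ moveL) (moveR ⨾ write sep ⨾ moveL))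
copyL = ifs is0 (moveL ⨾ write s0 ⨾ moveR) (ifs is1 (moveL ⨾ write s1 ⨾ moveR) (moveL ⨾ write sep ⨾ moveR))

copyR-run : ∀ {c ls d rs} → nonblank c ≡ true → copyR ⊢ from ls (c ∷ d ∷ rs) ⇓ from ls (c ∷ c ∷ rs) # 5
copyR-run {s0}  _ = weaken (n≤1+n 4) (if-true refl (moveR-run ⨟ write-run ⨟ moveL-run))
copyR-run {s1}  _ = if-false refl (if-true refl (moveR-run ⨟ write-run ⨟ moveL-run))
copyR-run {sep} _ = if-false refl (if-false refl (moveR-run ⨟ write-run ⨟ moveL-run))

copyL-run : ∀ {c l ls rs} → nonblank c ≡ true → copyL ⊢ from (l ∷ ls) (c ∷ rs) ⇓ from (c ∷ ls) (c ∷ rs) # 5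
copyL-run {s0}  _ = weaken (n≤1+n 4) (if-true refl (moveL-run ⨟ write-run ⨟ moveR-run))
copyL-run {s1}  _ = if-false refl (if-true refl (moveL-run ⨟ write-run ⨟ moveR-run))
copyL-run {sep} _ = if-false refl (if-false refl (moveL-run ⨟ write-run ⨟ moveR-run))

fromHead : List Sym → List Sym → Tape
fromHead []       rs = from [] rs
fromHead (c ∷ ls) rs = tape ls c rs

-- Shifts `w` one cell to the right, beginning at its right end and overwriting `d`. The freed cell
-- keeps a stale symbol `d′`, to be overwritten by the caller.
bubble-run : ∀ w {ls d rs} → NonBlank w → ∃ λ d′ →
  while nonblank (copyR ⨾ moveL) ⊢ fromHead (w ++ blank ∷ ls) (d ∷ rs) ⇓ from ls (blank ∷ d′ ∷ (w ʳ++ rs)) # 7 * length w + 1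
bubble-run []      {d = d} []       = d , while-end refl
bubble-run (c ∷ w) (x ∷ xs) =
  let d′ , r = bubble-run w xs
  in d′ , weaken (≤-reflexive (eq (length w))) (while-step x (copyR-run x ⨟ moveL-to w) r)
  where
  eq : ∀ n → suc (5 + 1 + (7 * n + 1)) ≡ 7 * suc n + 1
  eq = solve-∀
  moveL-to : ∀ w {ls rs} → moveL ⊢ tape (w ++ blank ∷ ls) c rs ⇓ fromHead (w ++ blank ∷ ls) (c ∷ rs) # 1
  moveL-to []      = stop refl
  moveL-to (_ ∷ _) = stop refl

-- Everything to the right of the head is shifted one cell to the left. The last symbol then stands
-- twice, and its right copy is blanked.
delete : Prog
delete = moveR ⨾ while nonblank (copyL ⨾ moveR) ⨾ moveL ⨾ write blank

pull-run : ∀ v {h ls m} → NonBlank v → ∃ λ h′ →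
  while nonblank (copyL ⨾ moveR) ⊢ from (h ∷ ls) (v ++ blanks m) ⇓ from (h′ ∷ (v ʳ++ ls)) (blanks m) # 7 * length v + 1
pull-run []      {h} {ls} {m} [] = h , while-end (cong nonblank (head-blanks _ m))
pull-run (c ∷ v) (x ∷ xs) =
  let h′ , r = pull-run v xs
  in h′ , weaken (≤-reflexive (eq (length v))) (while-step x (copyL-run x ⨟ moveR-run) r)
  where
  eq : ∀ n → suc (5 + 1 + (7 * n + 1)) ≡ 7 * suc n + 1
  eq = solve-∀

delete-run : ∀ v {h ls m} → NonBlank v →
  delete ⊢ from ls (h ∷ v ++ blanks m) ⇓ from (v ʳ++ ls) (blank ∷ blank ∷ blanks (m ∸ 1)) # 7 * length v + 4
delete-run v {h} {ls} {m} xs with pull-run v {h} {ls} {m} xs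
... | h′ , r rewrite from-blanks (h′ ∷ (v ʳ++ ls)) m =
  weaken (≤-reflexive (eq (length v))) (moveR-run ⨟ r ⨟ moveL-run ⨟ write-run)
  where
  eq : ∀ n → 1 + (7 * n + 1 + (1 + 1)) ≡ 7 * n + 4
  eq = solve-∀

Stacks : ℕ → Set
Stacks = Vec (List Bool)

bits : List Bool → List Sym
bits = map bitSym

-- No blank occurs inside a layout, so either end of the used tape is found by walking to a blank.
-- The top of a stack is the bit next to its separator.
layout : ∀ {n} → Stacks n → List Sym
layout []      = []
layout (s ∷ σ) = sep ∷ bits s ++ layout σ

before after : ∀ {n} → Stacks n → Fin n → List Sym
before (s ∷ σ) Fin.zero    = sep ∷ []
before (s ∷ σ) (Fin.suc i) = sep ∷ bits s ++ before σ i
after  (s ∷ σ) Fin.zero    = layout σ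
after  (s ∷ σ) (Fin.suc i) = after σ i

layout-update : ∀ {n} (σ : Stacks n) i w → layout (σ [ i ]≔ w) ≡ before σ i ++ bits w ++ after σ i
layout-update (s ∷ σ) Fin.zero    w = refl
layout-update (s ∷ σ) (Fin.suc i) w =
  cong (sep ∷_) (trans (cong (bits s ++_) (layout-update σ i w)) (sym (++-assoc (bits s) (before σ i) _)))

layout-split : ∀ {n} (σ : Stacks n) i → layout σ ≡ before σ i ++ bits (lookup σ i) ++ after σ i
layout-split (s ∷ σ) Fin.zero    = refl
layout-split (s ∷ σ) (Fin.suc i) =
  cong (sep ∷_) (trans (cong (bits s ++_) (layout-split σ i)) (sym (++-assoc (bits s) (before σ i) _)))

bits-isBit : ∀ s → All (λ a → isBit a ≡ true) (bits s)
bits-isBit []          = []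
bits-isBit (true ∷ s)  = refl ∷ bits-isBit s
bits-isBit (false ∷ s) = refl ∷ bits-isBit s

bits-nonblank : ∀ s → NonBlank (bits s)
bits-nonblank []          = []
bits-nonblank (true ∷ s)  = refl ∷ bits-nonblank s
bits-nonblank (false ∷ s) = refl ∷ bits-nonblank s

layout-nonblank : ∀ {n} (σ : Stacks n) → NonBlank (layout σ)
layout-nonblank []      = []
layout-nonblank (s ∷ σ) = refl ∷ ++⁺ (bits-nonblank s) (layout-nonblank σ)

before-nonblank : ∀ {n} (σ : Stacks n) i → NonBlank (before σ i)
before-nonblank (s ∷ σ) Fin.zero    = refl ∷ []
before-nonblank (s ∷ σ) (Fin.suc i) = refl ∷ ++⁺ (bits-nonblank s) (before-nonblank σ i)

after-nonblank : ∀ {n} (σ : Stacks n) i → NonBlank (after σ i)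
after-nonblank (s ∷ σ) Fin.zero    = layout-nonblank σ
after-nonblank (s ∷ σ) (Fin.suc i) = after-nonblank σ i

after-head : ∀ {n} (σ : Stacks n) i ls m → isBit (tapeHead (from ls (after σ i ++ blanks m))) ≡ false
after-head (s ∷ [])    Fin.zero    ls m = cong isBit (head-blanks ls m)
after-head (s ∷ _ ∷ σ) Fin.zero    ls m = refl
after-head (s ∷ σ)     (Fin.suc i) ls m = after-head σ i ls m

goto : ∀ {n} → Fin n → Prog
goto Fin.zero    = moveR
goto (Fin.suc i) = moveR ⨾ walkR isBit ⨾ goto i

goto-run : ∀ {n} (σ : Stacks n) i {ls m} →
  goto i ⊢ from ls (layout σ ++ blanks m) ⇓ from (before σ i ʳ++ ls) (bits (lookup σ i) ++ after σ i ++ blanks m) # 2 * length (before σ i)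
goto-run (s ∷ σ) Fin.zero {ls} {m}
  rewrite ++-assoc (bits s) (layout σ) (blanks m) = weaken (n≤1+n 1) moveR-run
goto-run (s ∷ s′ ∷ σ) (Fin.suc i) {ls} {m}
  rewrite ++-assoc (bits s) (layout (s′ ∷ σ)) (blanks m) | ++-ʳ++ (bits s) {before (s′ ∷ σ) i} {sep ∷ ls} | length-++ (bits s) {before (s′ ∷ σ) i} =
  weaken (≤-reflexive (eq (length (bits s)) (length (before (s′ ∷ σ) i))))
    (moveR-run ⨟ walkR-run (bits s) (bits-isBit s) refl ⨟ goto-run (s′ ∷ σ) i)
  where
  eq : ∀ a b → 1 + (2 * a + 1 + 2 * b) ≡ 2 * suc (a + b)
  eq = solve-∀

-- The number `m` of trailing blanks depends on the history of the run and is therefore hidden.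
data Home {n} (σ : Stacks n) : Tape → Set where
  at-home : ∀ m → Home σ (from (blank ∷ []) (layout σ ++ blanks m))

data At {n} (σ : Stacks n) (i : Fin n) : Tape → Set where
  at-top : ∀ m → At σ i (from (before σ i ʳ++ (blank ∷ [])) (bits (lookup σ i) ++ after σ i ++ blanks m))

vol : ∀ {n} → Stacks n → ℕ
vol σ = length (layout σ)

vol-update : ∀ {n} (σ : Stacks n) i w → vol (σ [ i ]≔ w) ≡ length (before σ i) + (length w + length (after σ i))
vol-update σ i w rewrite layout-update σ i w | length-++ (before σ i) {bits w ++ after σ i} | length-++ (bits w) {after σ i} | length-map bitSym w = refl

vol-split : ∀ {n} (σ : Stacks n) i → vol σ ≡ length (before σ i) + (length (lookup σ i) + length (after σ i))
vol-split σ i rewrite cong length (layout-split σ i) | length-++ (before σ i) {bits (lookup σ i) ++ after σ i} | length-++ (bits (lookup σ i)) {after σ i} | length-map bitSym (lookup σ i) = refl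

before≤vol : ∀ {n} (σ : Stacks n) i → length (before σ i) ≤ vol σ
before≤vol σ i = ≤-trans (m≤m+n (length (before σ i)) _) (≤-reflexive (sym (vol-split σ i)))

goto-at : ∀ {n} (σ : Stacks n) i {τ} → Home σ τ → ∃ λ τ′ → At σ i τ′ × (goto i ⊢ τ ⇓ τ′ # 2 * vol σ)
goto-at σ i (at-home m) = _ , at-top m , weaken (*-monoʳ-≤ 2 (before≤vol σ i)) (goto-run σ i)

before-cons : ∀ {n} (σ : Stacks n) i → ∃ λ u → before σ i ≡ sep ∷ u
before-cons (s ∷ σ) Fin.zero    = _ , refl
before-cons (s ∷ σ) (Fin.suc i) = _ , refl

-- `from` cannot see whether its last blank is explicit.
explicit : ∀ ls v m → ∃₂ λ d rs → ∃ λ m′ → from ls (v ++ blanks m) ≡ from ls (d ∷ rs) × d ∷ rs ≡ v ++ blanks m′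
explicit ls []      zero    = _ , _ , 1 , refl , refl
explicit ls []      (suc m) = _ , _ , suc m , refl , refl
explicit ls (x ∷ v) m       = _ , _ , m , refl , refl

home-at : ∀ {n} (σ : Stacks n) i v {m} →
  ∃ λ m′ → home ⊢ from (before σ i ʳ++ (blank ∷ [])) (v ++ blanks m) ⇓ from (blank ∷ []) (before σ i ++ v ++ blanks m′) # 2 * length (before σ i) + 5
home-at σ i v {m} with before-cons σ i | before-nonblank σ i
... | u , eq | nb rewrite eq with explicit ((sep ∷ u) ʳ++ (blank ∷ [])) v m
... | d , rs , m′ , e₁ , e₂ rewrite e₁ = m′ , subst (λ z → home ⊢ _ ⇓ from (blank ∷ []) (sep ∷ u ++ z) # 2 * suc (length u) + 5) e₂ (home-run sep u nb)

return-run : ∀ {n} (σ : Stacks n) i {τ} → At σ i τ → ∃ λ τ′ → Home σ τ′ × (home ⊢ τ ⇓ τ′ # 2 * vol σ + 5)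
return-run σ i (at-top m) with home-at σ i (bits (lookup σ i) ++ after σ i) {m}
... | m′ , r rewrite ++-assoc (bits (lookup σ i)) (after σ i) (blanks m) =
  _ , subst (λ z → Home σ (from (blank ∷ []) z)) eq (at-home m′) , weaken (+-monoˡ-≤ 5 (*-monoʳ-≤ 2 (before≤vol σ i))) r
  where
  eq : layout σ ++ blanks m′ ≡ before σ i ++ (bits (lookup σ i) ++ after σ i) ++ blanks m′
  eq = trans (cong (_++ blanks m′) (layout-split σ i)) (++-assoc (before σ i) _ _)

popAt-run : ∀ {n} (σ : Stacks n) i b w {τ} → lookup σ i ≡ b ∷ w → At σ i τ →
  tapeHead τ ≡ bitSym b × ∃ λ τ′ → Home (σ [ i ]≔ w) τ′ × (delete ⨾ home ⊢ τ ⇓ τ′ # 9 * vol σ + 9)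
popAt-run σ i b w {τ} e (at-top m) with lookup σ i in eq
popAt-run σ i b w {τ} refl (at-top m) | _ = refl , _ , at-end , weaken le (del ⨟ hom)
  where
  v : List Sym
  v = bits w ++ after σ i
  nbv : NonBlank v
  nbv = ++⁺ (bits-nonblank w) (after-nonblank σ i)
  del : delete ⊢ from (before σ i ʳ++ (blank ∷ [])) (bitSym b ∷ bits w ++ after σ i ++ blanks m) ⇓ from (v ʳ++ (before σ i ʳ++ (blank ∷ []))) (blank ∷ blank ∷ blanks (m ∸ 1)) # 7 * length v + 4
  del = subst (λ z → delete ⊢ from (before σ i ʳ++ (blank ∷ [])) (bitSym b ∷ z) ⇓ from (v ʳ++ (before σ i ʳ++ (blank ∷ []))) (blank ∷ blank ∷ blanks (m ∸ 1)) # 7 * length v + 4) (++-assoc (bits w) (after σ i) (blanks m)) (delete-run v nbv)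
  hom : home ⊢ from (v ʳ++ (before σ i ʳ++ (blank ∷ []))) (blank ∷ blank ∷ blanks (m ∸ 1)) ⇓ from (blank ∷ []) ((before σ i ++ v) ++ (blank ∷ blank ∷ blanks (m ∸ 1))) # 2 * length (before σ i ++ v) + 5
  hom rewrite sym (++-ʳ++ (before σ i) {v} {blank ∷ []}) with before σ i | before-nonblank σ i | before-cons σ i
  ... | _ | nb | u , refl = home-run sep (u ++ v) (++⁺ nb nbv)
  at-end : Home (σ [ i ]≔ w) (from (blank ∷ []) ((before σ i ++ v) ++ (blank ∷ blank ∷ blanks (m ∸ 1))))
  at-end rewrite sym (layout-update σ i w) = at-home (suc (suc (m ∸ 1)))
  le : 7 * length v + 4 + (2 * length (before σ i ++ v) + 5) ≤ 9 * vol σ + 9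
  le rewrite length-++ (before σ i) {v} | vol-split σ i | eq | length-++ (bits w) {after σ i} | length-map bitSym w =
    subst (7 * (length w + length (after σ i)) + 4 + (2 * (length (before σ i) + (length w + length (after σ i))) + 5) ≤_) (arith (length (before σ i)) (length w) (length (after σ i))) (m≤m+n _ _)
    where
    arith : ∀ a b c → 7 * (b + c) + 4 + (2 * (a + (b + c)) + 5) + (7 * a + 9) ≡ 9 * (a + (suc b + c)) + 9
    arith = solve-∀

-- The separator in front of stack `i` is blanked for a while: it is the mark at which the shift of
-- the rest of the tape to the right stops. Then it is restored and the freed cell receives the new
-- bit.
push-prog : ∀ {n} → Fin n → Bool → Prog
push-prog i b = goto i ⨾ moveL ⨾ write blank ⨾ moveR ⨾ walkR nonblank ⨾ moveL ⨾ while nonblank (copyR ⨾ moveL) ⨾ write sep ⨾ moveR ⨾ write (bitSym b) ⨾ home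

before-snoc : ∀ {n} (σ : Stacks n) i → ∃ λ u → before σ i ≡ u ++ sep ∷ []
before-snoc (s ∷ σ) Fin.zero    = [] , refl
before-snoc (s ∷ σ) (Fin.suc i) with before-snoc σ i
... | u , e rewrite e = sep ∷ bits s ++ u , cong (sep ∷_) (sym (++-assoc (bits s) u _))

push-time : ∀ a b n → n ≡ a + b → 2 * a + (1 + (1 + (1 + (2 * b + 1 + (1 + (7 * b + 1 + (1 + (1 + (1 + (2 * a + 5)))))))))) ≤ 9 * n + 20
push-time a b _ refl = ≤-trans (m≤m+n _ (5 * a + 6)) (≤-reflexive (arith a b))
  where
  arith : ∀ a b → 2 * a + (1 + (1 + (1 + (2 * b + 1 + (1 + (7 * b + 1 + (1 + (1 + (1 + (2 * a + 5)))))))))) + (5 * a + 6) ≡ 9 * (a + b) + 20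
  arith = solve-∀

push-run : ∀ {n} (σ : Stacks n) i b {τ} → Home σ τ →
  ∃ λ τ′ → Home (σ [ i ]≔ (b ∷ lookup σ i)) τ′ × (push-prog i b ⊢ τ ⇓ τ′ # 9 * vol σ + 20)
push-run σ i b (at-home m) = _ , at-end , weaken le (goto-run σ i ⨟ mark)
  where
  u = proj₁ (before-snoc σ i)
  ls = u ʳ++ (blank ∷ [])
  v : List Sym
  v = bits (lookup σ i) ++ after σ i
  w = v ʳ++ []
  nbv : NonBlank v
  nbv = ++⁺ (bits-nonblank (lookup σ i)) (after-nonblank σ i)
  left : before σ i ʳ++ (blank ∷ []) ≡ sep ∷ ls
  left = trans (cong (_ʳ++ (blank ∷ [])) (proj₂ (before-snoc σ i))) (++-ʳ++ u)
  right : bits (lookup σ i) ++ after σ i ++ blanks m ≡ v ++ blanks m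
  right = sym (++-assoc (bits (lookup σ i)) _ _)
  d = proj₁ (explicit (sep ∷ ls) v m)
  rs = proj₁ (proj₂ (explicit (sep ∷ ls) v m))
  m₁ = proj₁ (proj₂ (proj₂ (explicit (sep ∷ ls) v m)))
  e₁ : from (sep ∷ ls) (v ++ blanks m) ≡ from (sep ∷ ls) (d ∷ rs)
  e₁ = proj₁ (proj₂ (proj₂ (proj₂ (explicit (sep ∷ ls) v m))))
  e₂ : d ∷ rs ≡ v ++ blanks m₁
  e₂ = proj₂ (proj₂ (proj₂ (proj₂ (explicit (sep ∷ ls) v m))))
  open-gap : ∀ {m} → moveL ⊢ from (v ʳ++ (blank ∷ ls)) (blanks m) ⇓ fromHead (w ++ blank ∷ ls) (blank ∷ blanks (m ∸ 1)) # 1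
  open-gap {m} rewrite sym (ʳ++-++-assoc v {[]} {blank ∷ ls}) | from-blanks ((v ʳ++ []) ++ blank ∷ ls) m with w
  ... | []    = stop refl
  ... | _ ∷ _ = stop refl
  bub = bubble-run w {ls} {blank} {blanks (m₁ ∸ 1)} (All-ʳ++ nbv [])
  bubbled : w ʳ++ blanks (m₁ ∸ 1) ≡ v ++ blanks (m₁ ∸ 1)
  bubbled = ʳ++-ʳ++ v
  len-w : length w ≡ length v
  len-w = trans (length-ʳ++ v) (+-identityʳ _)
  hom = home-at σ i (bitSym b ∷ v) {m₁ ∸ 1}
  mark : moveL ⨾ write blank ⨾ moveR ⨾ walkR nonblank ⨾ moveL ⨾ while nonblank (copyR ⨾ moveL) ⨾ write sep ⨾ moveR ⨾ write (bitSym b) ⨾ home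
    ⊢ from (before σ i ʳ++ (blank ∷ [])) (bits (lookup σ i) ++ after σ i ++ blanks m) ⇓ from (blank ∷ []) (before σ i ++ bitSym b ∷ v ++ blanks (proj₁ hom))
    # 1 + (1 + (1 + (2 * length v + 1 + (1 + (7 * length v + 1 + (1 + (1 + (1 + (2 * length (before σ i) + 5)))))))))
  mark rewrite left | right | e₁ =
    moveL-run ⨟ write-run ⨟ moveR-run ⨟
    subst (λ z → walkR nonblank ⊢ from (blank ∷ ls) z ⇓ from (v ʳ++ (blank ∷ ls)) (blanks m₁) # 2 * length v + 1) (sym e₂)
      (walkR-run v nbv (cong nonblank (head-blanks _ m₁))) ⨟
    open-gap {m₁} ⨟
    subst₂ (λ z n → while nonblank (copyR ⨾ moveL) ⊢ fromHead (w ++ blank ∷ ls) (blank ∷ blanks (m₁ ∸ 1)) ⇓ from ls (blank ∷ proj₁ bub ∷ z) # 7 * n + 1) bubbled len-w (proj₂ bub) ⨟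
    write-run ⨟ moveR-run ⨟ write-run ⨟
    subst (λ z → home ⊢ from z (bitSym b ∷ v ++ blanks (m₁ ∸ 1)) ⇓ from (blank ∷ []) (before σ i ++ bitSym b ∷ v ++ blanks (proj₁ hom)) # 2 * length (before σ i) + 5) left (proj₂ hom)
  at-end : Home (σ [ i ]≔ (b ∷ lookup σ i)) (from (blank ∷ []) (before σ i ++ bitSym b ∷ v ++ blanks (proj₁ hom)))
  at-end = subst (λ z → Home (σ [ i ]≔ (b ∷ lookup σ i)) (from (blank ∷ []) z))
    (trans (cong (_++ blanks (proj₁ hom)) (layout-update σ i (b ∷ lookup σ i))) (++-assoc (before σ i) _ _)) (at-home (proj₁ hom))
  le : 2 * length (before σ i) + (1 + (1 + (1 + (2 * length v + 1 + (1 + (7 * length v + 1 + (1 + (1 + (1 + (2 * length (before σ i) + 5)))))))))) ≤ 9 * vol σ + 20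
  le = push-time (length (before σ i)) (length v) (vol σ) (trans (cong length (layout-split σ i)) (length-++ (before σ i)))

-- A language of bit stacks and its compilation to tape programs

data SProg (n : ℕ) : Set where
  skip   : SProg n
  push   : Fin n → Bool → SProg n
  _▷_    : SProg n → SProg n → SProg n
  -- Pops the stack and continues with the branch for: empty, false, true.
  pop    : Fin n → SProg n → (Bool → SProg n) → SProg n
  -- While the stack is nonempty: pops it and runs the branch of the popped bit.
  loop   : Fin n → (Bool → SProg n) → SProg n

infixr 5 _▷_ _⟫_

infix 3 _⊩_⇓_#_

data _⊩_⇓_#_ {n} : SProg n → Stacks n → Stacks n → ℕ → Set where
  run-skip  : ∀ {σ} → skip ⊩ σ ⇓ σ # 1
  run-push  : ∀ {σ i b} → push i b ⊩ σ ⇓ σ [ i ]≔ (b ∷ lookup σ i) # 1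
  _⟫_       : ∀ {P Q σ σ₁ σ₂ a b} → P ⊩ σ ⇓ σ₁ # a → Q ⊩ σ₁ ⇓ σ₂ # b → P ▷ Q ⊩ σ ⇓ σ₂ # a + b
  pop-empty : ∀ {i P Q σ σ′ t} → lookup σ i ≡ [] → P ⊩ σ ⇓ σ′ # t → pop i P Q ⊩ σ ⇓ σ′ # suc t
  pop-bit   : ∀ {i P Q σ σ′ b w t} → lookup σ i ≡ b ∷ w → Q b ⊩ σ [ i ]≔ w ⇓ σ′ # t → pop i P Q ⊩ σ ⇓ σ′ # suc t
  loop-end  : ∀ {i Q σ} → lookup σ i ≡ [] → loop i Q ⊩ σ ⇓ σ # 1
  loop-bit  : ∀ {i Q σ σ₁ σ₂ b w t u} → lookup σ i ≡ b ∷ w → Q b ⊩ σ [ i ]≔ w ⇓ σ₁ # t → loop i Q ⊩ σ₁ ⇓ σ₂ # u →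
              loop i Q ⊩ σ ⇓ σ₂ # suc (t + u)
  slack     : ∀ {P σ σ′ t u} → t ≤ u → P ⊩ σ ⇓ σ′ # t → P ⊩ σ ⇓ σ′ # u

compile : ∀ {n} → SProg n → Prog
compile skip        = act (λ a → a , N)
compile (push i b)  = push-prog i b
compile (P ▷ Q)  = compile P ⨾ compile Q
compile (pop i P Q) = goto i ⨾ ifs is0 ((delete ⨾ home) ⨾ compile (Q false)) (ifs is1 ((delete ⨾ home) ⨾ compile (Q true)) (home ⨾ compile P))
compile (loop i Q)  = goto i ⨾ while isBit (ifs is0 ((delete ⨾ home) ⨾ compile (Q false)) ((delete ⨾ home) ⨾ compile (Q true)) ⨾ goto i) ⨾ home

vol-pop : ∀ {n} (σ : Stacks n) i {b w} → lookup σ i ≡ b ∷ w → vol (σ [ i ]≔ w) ≤ vol σ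
vol-pop σ i {b} {w} e rewrite vol-update σ i w | vol-split σ i | e = +-monoʳ-≤ (length (before σ i)) (n≤1+n _)

-- Each unit of time adds at most one bit. So a single bound `M` on initial volume plus time limits
-- the length of the tape, hence the cost of an instruction, during the whole run.
vol-run : ∀ {n} {P : SProg n} {σ σ′ t} → P ⊩ σ ⇓ σ′ # t → vol σ′ ≤ vol σ + t
vol-run run-skip = m≤m+n _ _
vol-run (run-push {σ} {i} {b}) rewrite vol-update σ i (b ∷ lookup σ i) | vol-split σ i =
  ≤-reflexive (trans (+-suc (length (before σ i)) _) (+-comm 1 _))
vol-run (_⟫_ {a = a} {b} x y) = ≤-trans (vol-run y) (≤-trans (+-monoˡ-≤ b (vol-run x)) (≤-reflexive (+-assoc _ a b)))
vol-run (pop-empty _ x) = ≤-trans (vol-run x) (+-monoʳ-≤ _ (n≤1+n _))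
vol-run (pop-bit {i = i} {σ = σ} e x) = ≤-trans (vol-run x) (+-mono-≤ (vol-pop σ i e) (n≤1+n _))
vol-run (loop-end _) = m≤m+n _ _
vol-run (loop-bit {i = i} {σ = σ} {t = t} {u} e x y) =
  ≤-trans (vol-run y) (≤-trans (+-monoˡ-≤ u (≤-trans (vol-run x) (+-monoˡ-≤ t (vol-pop σ i e))))
    (≤-trans (≤-reflexive (+-assoc _ t u)) (+-monoʳ-≤ _ (n≤1+n _))))
vol-run (slack le x) = ≤-trans (vol-run x) (+-monoʳ-≤ _ le)

run-pos : ∀ {n} {P : SProg n} {σ σ′ t} → P ⊩ σ ⇓ σ′ # t → 1 ≤ t
run-pos run-skip = ≤-refl
run-pos run-push = ≤-refl
run-pos (x ⟫ y) = ≤-trans (run-pos x) (m≤m+n _ _)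
run-pos (pop-empty _ x) = s≤s z≤n
run-pos (pop-bit _ x) = s≤s z≤n
run-pos (loop-end _) = ≤-refl
run-pos (loop-bit _ x y) = s≤s z≤n
run-pos (slack le x) = ≤-trans (run-pos x) le

-- The cost of one instruction when the stacks have total length at most M.
cost : ℕ → ℕ
cost M = 11 * M + 20

at-head : ∀ {n} (σ : Stacks n) i {τ} → At σ i τ → lookup σ i ≡ [] → isBit (tapeHead τ) ≡ false
at-head σ i (at-top m) e rewrite e = after-head σ i _ m

not-bit : ∀ a → isBit a ≡ false → is0 a ≡ false × is1 a ≡ false
not-bit blank _ = refl , refl
not-bit sep   _ = refl , refl

compile-run : ∀ {n} {P : SProg n} {σ σ′ t τ} M → P ⊩ σ ⇓ σ′ # t → vol σ + t ≤ M → Home σ τ →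
  ∃ λ τ′ → Home σ′ τ′ × (compile P ⊢ τ ⇓ τ′ # t * cost M)
-- The unit of `t` that belongs to the final test is held back (`pred t`): in `loop-whole` it pays
-- for going to the stack before the loop and for the way home after it.
loop-run : ∀ {n} {i Q} {σ σ′ : Stacks n} {t τ} M → loop i Q ⊩ σ ⇓ σ′ # t → vol σ + t ≤ M → At σ i τ →
  ∃ λ τ′ → At σ′ i τ′ × (while isBit (ifs is0 ((delete ⨾ home) ⨾ compile (Q false)) ((delete ⨾ home) ⨾ compile (Q true)) ⨾ goto i) ⊢ τ ⇓ τ′ # (pred t * cost M + 1))

loop-whole : ∀ {n} {i Q} {σ σ′ : Stacks n} {t τ} M → loop i Q ⊩ σ ⇓ σ′ # t → vol σ + t ≤ M → (h : Home σ τ) →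
  (∃ λ τ′ → At σ′ i τ′ × (while isBit (ifs is0 ((delete ⨾ home) ⨾ compile (Q false)) ((delete ⨾ home) ⨾ compile (Q true)) ⨾ goto i)
    ⊢ proj₁ (goto-at σ i h) ⇓ τ′ # (pred t * cost M + 1))) →
  ∃ λ τ′ → Home σ′ τ′ × (compile (loop i Q) ⊢ τ ⇓ τ′ # t * cost M)
loop-whole {i = i} {σ = σ} {σ′} {t} M x le h (τ₂ , at₂ , r₂) =
  let _ , _ , r₁ = goto-at σ i h
      τ₃ , h₃ , r₃ = return-run σ′ i at₂
  in τ₃ , h₃ , weaken (bound {vol σ} {vol σ′} {t} (run-pos x) (m+n≤o⇒m≤o (vol σ) le) (≤-trans (vol-run x) le)) (r₁ ⨟ r₂ ⨟ r₃)
  where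
  bound : ∀ {v v₁ t} → 1 ≤ t → v ≤ M → v₁ ≤ M → 2 * v + (pred t * cost M + 1 + (2 * v₁ + 5)) ≤ t * cost M
  bound {v} {v₁} {suc t} _ le₁ le₂ =
    ≤-trans (+-mono-≤ (*-monoʳ-≤ 2 le₁) (+-monoʳ-≤ (t * cost M + 1) (+-monoˡ-≤ 5 (*-monoʳ-≤ 2 le₂))))
      (≤-trans (m≤m+n _ (7 * M + 14)) (≤-reflexive (eq M (t * cost M))))
    where
    eq : ∀ M c → 2 * M + (c + 1 + (2 * M + 5)) + (7 * M + 14) ≡ 11 * M + 20 + c
    eq = solve-∀

compile-run {τ = tape _ _ _} M run-skip le h = _ , h , weaken (≤-trans (≤-trans (s≤s z≤n) (m≤n+m 20 (11 * M))) (≤-reflexive (sym (*-identityˡ (cost M))))) (stop {t = 0} refl)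
compile-run {σ = σ} M (run-push {i = i} {b}) le h =
  let τ′ , h′ , r = push-run σ i b h
  in τ′ , h′ , weaken (≤-trans (+-monoˡ-≤ 20 (*-mono-≤ {9} {11} (m≤n+m 9 2) (m+n≤o⇒m≤o (vol σ) le))) (≤-reflexive (sym (+-identityʳ _)))) r
compile-run {σ = σ} M (_⟫_ {a = a} {b} x y) le h =
  let τ₁ , h₁ , r₁ = compile-run M x (≤-trans (+-monoʳ-≤ (vol σ) (m≤m+n a b)) le) h
      τ₂ , h₂ , r₂ = compile-run M y (≤-trans (+-monoˡ-≤ b (vol-run x)) (≤-trans (≤-reflexive (+-assoc (vol σ) a b)) le)) h₁
  in τ₂ , h₂ , weaken (≤-reflexive (sym (*-distribʳ-+ (cost M) a b))) (r₁ ⨟ r₂)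
compile-run {σ = σ} M (pop-empty {i = i} {t = t} e x) le h =
  let τ₁ , at₁ , r₁ = goto-at σ i h
      h0 , h1 = not-bit _ (at-head σ i at₁ e)
      τ₂ , h₂ , r₂ = return-run σ i at₁
      τ₃ , h₃ , r₃ = compile-run M x (≤-trans (+-monoʳ-≤ (vol σ) (n≤1+n t)) le) h₂
  in τ₃ , h₃ , weaken (bound (vol σ) M (t * cost M) (m+n≤o⇒m≤o (vol σ) le)) (r₁ ⨟ if-false h0 (if-false h1 (r₂ ⨟ r₃)))
  where
  bound : ∀ v m c → v ≤ m → 2 * v + suc (suc (2 * v + 5 + c)) ≤ cost m + c
  bound v m c le with m≤n⇒∃[o]m+o≡n le
  ... | k , refl = ≤-trans (m≤m+n _ (7 * v + 11 * k + 13)) (≤-reflexive (eq v k c))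
    where
    eq : ∀ v k c → 2 * v + suc (suc (2 * v + 5 + c)) + (7 * v + 11 * k + 13) ≡ 11 * (v + k) + 20 + c
    eq = solve-∀
compile-run {σ = σ} M (pop-bit {i = i} {P} {Q} {b = b} {w} {t = t} e x) le h =
  let τ₁ , at₁ , r₁ = goto-at σ i h
      hd , τ₂ , h₂ , r₂ = popAt-run σ i b w e at₁
      τ₃ , h₃ , r₃ = compile-run M x (≤-trans (+-mono-≤ (vol-pop σ i e) (n≤1+n t)) le) h₂
  in τ₃ , h₃ , weaken (bound (vol σ) M (t * cost M) (m+n≤o⇒m≤o (vol σ) le)) (r₁ ⨟ branch b hd (r₂ ⨟ r₃))
  where
  branch : ∀ b {τ τ′ s} → tapeHead τ ≡ bitSym b → (delete ⨾ home) ⨾ compile (Q b) ⊢ τ ⇓ τ′ # s →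
    ifs is0 ((delete ⨾ home) ⨾ compile (Q false)) (ifs is1 ((delete ⨾ home) ⨾ compile (Q true)) (home ⨾ compile P)) ⊢ τ ⇓ τ′ # suc (suc s)
  branch false hd r = if-true (cong is0 hd) (weaken (n≤1+n _) r)
  branch true  hd r = if-false (cong is0 hd) (if-true (cong is1 hd) r)
  bound : ∀ v m c → v ≤ m → 2 * v + suc (suc (9 * v + 9 + c)) ≤ cost m + c
  bound v m c le with m≤n⇒∃[o]m+o≡n le
  ... | k , refl = ≤-trans (m≤m+n _ (11 * k + 9)) (≤-reflexive (eq v k c))
    where
    eq : ∀ v k c → 2 * v + suc (suc (9 * v + 9 + c)) + (11 * k + 9) ≡ 11 * (v + k) + 20 + c
    eq = solve-∀
compile-run M (slack {u = u} le′ x) le h =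
  let τ′ , h′ , r = compile-run M x (≤-trans (+-monoʳ-≤ _ le′) le) h
  in τ′ , h′ , weaken (*-monoˡ-≤ (cost M) le′) r
compile-run {σ = σ} M x@(loop-end {i = i} _) le h = loop-whole M x le h (loop-run M x le (proj₁ (proj₂ (goto-at σ i h))))
compile-run {σ = σ} M x@(loop-bit {i = i} _ _ _) le h = loop-whole M x le h (loop-run M x le (proj₁ (proj₂ (goto-at σ i h))))

loop-run {i = i} {σ = σ} M (loop-end e) le at₁ = _ , at₁ , while-end (at-head σ i at₁ e)
loop-run {i = i} {Q} {σ = σ} M (loop-bit {σ₁ = σ₁} {b = b} {w} {t = t} {u} e x y) le at₁ =
  let hd , τ₂ , h₂ , r₂ = popAt-run σ i b w e at₁
      τ₃ , h₃ , r₃ = compile-run M x (≤-trans (+-mono-≤ (vol-pop σ i e) (≤-trans (m≤m+n t u) (n≤1+n _))) le) h₂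
      τ₄ , at₄ , r₄ = goto-at _ i h₃
      le₁ = ≤-trans (+-monoˡ-≤ u (≤-trans (vol-run x) (+-monoˡ-≤ t (vol-pop σ i e))))
              (≤-trans (≤-reflexive (+-assoc (vol σ) t u)) (≤-trans (+-monoʳ-≤ (vol σ) (n≤1+n _)) le))
      τ₅ , at₅ , r₅ = loop-run M y le₁ at₄
  in τ₅ , at₅ , weaken (bound {vol σ} {vol σ₁} {t} {u} (run-pos y) (m+n≤o⇒m≤o (vol σ) le) (m+n≤o⇒m≤o (vol σ₁) le₁))
       (while-step (trans (cong isBit hd) (isBit-bit b)) (branch b hd (r₂ ⨟ r₃) ⨟ r₄) r₅)
  where
  isBit-bit : ∀ b → isBit (bitSym b) ≡ true
  isBit-bit true  = refl
  isBit-bit false = refl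
  branch : ∀ b {τ τ′ s} → tapeHead τ ≡ bitSym b → (delete ⨾ home) ⨾ compile (Q b) ⊢ τ ⇓ τ′ # s →
    ifs is0 ((delete ⨾ home) ⨾ compile (Q false)) ((delete ⨾ home) ⨾ compile (Q true)) ⊢ τ ⇓ τ′ # suc s
  branch false hd r = if-true (cong is0 hd) r
  branch true  hd r = if-false (cong is0 hd) r
  bound : ∀ {v v₁ t u} → 1 ≤ u → v ≤ M → v₁ ≤ M →
    suc (suc (9 * v + 9 + t * cost M) + 2 * v₁ + (pred u * cost M + 1)) ≤ (t + u) * cost M + 1
  bound {v} {v₁} {t} {suc u} _ le₁ le₂ =
    ≤-trans (+-monoˡ-≤ (u * cost M + 1) (s≤s (+-mono-≤ (s≤s (+-monoˡ-≤ (t * cost M) (+-monoˡ-≤ 9 (*-monoʳ-≤ 9 le₁)))) (*-monoʳ-≤ 2 le₂))))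
      (≤-trans (m≤m+n _ 9) (≤-reflexive (eq M t u)))
    where
    eq : ∀ M t u → suc (suc (9 * M + 9 + t * (11 * M + 20)) + 2 * M + (u * (11 * M + 20) + 1)) + 9 ≡ (t + suc u) * (11 * M + 20) + 1
    eq = solve-∀
loop-run {σ = σ} M (slack le′ x) le at₁ =
  let τ′ , at′ , r = loop-run M x (≤-trans (+-monoʳ-≤ (vol σ) le′) le) at₁
  in τ′ , at′ , weaken (+-monoˡ-≤ 1 (*-monoˡ-≤ (cost M) (pred-mono-≤ le′))) r

-- Trees on a stack

data Tree : Set where
  nil  : Tree
  cons : Tree → Tree → Tree

-- Polish notation is a prefix code: the end of a tree is found by counting pending subtrees, so
-- trees can lie on one stack without delimiters.
code : Tree → List Bool
code nil        = false ∷ []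
code (cons x y) = true ∷ code x ++ code y

size : Tree → ℕ
size nil        = 1
size (cons x y) = suc (size x + size y)

length-code : ∀ x → length (code x) ≡ size x
length-code nil        = refl
length-code (cons x y) = cong suc (trans (length-++ (code x)) (cong₂ _+_ (length-code x) (length-code y)))

pattern 𝖠 = Fin.zero
pattern 𝖡 = Fin.suc Fin.zero
pattern 𝖢 = Fin.suc (Fin.suc Fin.zero)
pattern 𝖪 = Fin.suc (Fin.suc (Fin.suc Fin.zero))

pattern stacks a b c k = a ∷ b ∷ c ∷ k ∷ []

-- 𝖪 counts the subtrees that remain to be read.
scan-body : Bool → Bool → Bool → SProg 4
scan-body pB pC _ = pop 𝖠 skip λ b →
  (if pB then push 𝖡 b else skip) ▷ (if pC then push 𝖢 b else skip) ▷
  (if b then push 𝖪 true ▷ push 𝖪 true else skip)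

-- Removes one tree from 𝖠; the flags select the stacks that receive its code, reversed. Unloading
-- such a stack reverses it again.
scan : Bool → Bool → SProg 4
scan pB pC = push 𝖪 true ▷ loop 𝖪 (scan-body pB pC)

store : Bool → List Bool → List Bool → List Bool
store p w s = if p then w ʳ++ s else s

store-++ : ∀ p w v s → store p v (store p w s) ≡ store p (w ++ v) s
store-++ true  w v s = sym (++-ʳ++ w)
store-++ false w v s = refl

store-run : ∀ pB pC b {Q a β γ κ σ′ t} → Q ⊩ stacks a (store pB (b ∷ []) β) (store pC (b ∷ []) γ) κ ⇓ σ′ # t →
  (if pB then push 𝖡 b else skip) ▷ (if pC then push 𝖢 b else skip) ▷ Q ⊩ stacks a β γ κ ⇓ σ′ # 2 + t
store-run true  true  b r = run-push ⟫ run-push ⟫ r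
store-run true  false b r = run-push ⟫ run-skip ⟫ r
store-run false true  b r = run-skip ⟫ run-push ⟫ r
store-run false false b r = run-skip ⟫ run-skip ⟫ r

scan-loop : ∀ pB pC x {r β γ κ σ′ t} →
  loop 𝖪 (scan-body pB pC) ⊩ stacks r (store pB (code x) β) (store pC (code x) γ) κ ⇓ σ′ # t →
  loop 𝖪 (scan-body pB pC) ⊩ stacks (code x ++ r) β γ (true ∷ κ) ⇓ σ′ # 6 * size x + t
scan-loop pB pC nil {t = t} h = slack (s≤s (s≤s (s≤s (s≤s (s≤s (n≤1+n t))))))
  (loop-bit refl (pop-bit refl (store-run pB pC false run-skip)) h)
scan-loop pB pC (cons x y) {r} {β} {γ} {κ} {σ′} {t} h
  rewrite ++-assoc (code x) (code y) r =
  slack (≤-reflexive (eq (size x) (size y) t)) (loop-bit refl (pop-bit refl (store-run pB pC true (run-push ⟫ run-push)))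
    (scan-loop pB pC x (scan-loop pB pC y (subst₂ (λ u v → loop 𝖪 (scan-body pB pC) ⊩ stacks r u v κ ⇓ σ′ # t)
      (sym (trans (store-++ pB (code x) (code y) _) (store-++ pB (true ∷ []) (code x ++ code y) β)))
      (sym (trans (store-++ pC (code x) (code y) _) (store-++ pC (true ∷ []) (code x ++ code y) γ))) h))))
  where
  eq : ∀ a b t → 6 + (6 * a + (6 * b + t)) ≡ 6 * suc (a + b) + t
  eq = solve-∀

scan-run : ∀ pB pC x {r β γ} →
  scan pB pC ⊩ stacks (code x ++ r) β γ [] ⇓ stacks r (store pB (code x) β) (store pC (code x) γ) [] # 1 + (6 * size x + 1)
scan-run pB pC x = run-push ⟫ scan-loop pB pC x (loop-end refl)

unloadB unloadC : SProg 4
unloadB = loop 𝖡 (push 𝖠)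
unloadC = loop 𝖢 (push 𝖠)

unloadB-run : ∀ w {a γ κ} → unloadB ⊩ stacks a w γ κ ⇓ stacks (w ʳ++ a) [] γ κ # 2 * length w + 1
unloadB-run []      = loop-end refl
unloadB-run (b ∷ w) = slack (≤-reflexive (cong (_+ 1) (sym (*-distribˡ-+ 2 1 (length w))))) (loop-bit refl run-push (unloadB-run w))

unloadC-run : ∀ w {a β κ} → unloadC ⊩ stacks a β w κ ⇓ stacks (w ʳ++ a) β [] κ # 2 * length w + 1
unloadC-run []      = loop-end refl
unloadC-run (b ∷ w) = slack (≤-reflexive (cong (_+ 1) (sym (*-distribˡ-+ 2 1 (length w))))) (loop-bit refl run-push (unloadC-run w))

restore : ∀ (w a : List Bool) → (w ʳ++ []) ʳ++ a ≡ w ++ a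
restore w a = ʳ++-ʳ++ w

size-stored : ∀ x → length (code x ʳ++ []) ≡ size x
size-stored x = trans (length-ʳ++ (code x)) (trans (+-identityʳ _) (length-code x))

restoreB : ∀ x {a γ κ} → unloadB ⊩ stacks a (code x ʳ++ []) γ κ ⇓ stacks (code x ++ a) [] γ κ # 2 * size x + 1
restoreB x {a} {γ} {κ} = subst₂ (λ u n → unloadB ⊩ stacks a (code x ʳ++ []) γ κ ⇓ stacks u [] γ κ # 2 * n + 1)
  (restore (code x) a) (size-stored x) (unloadB-run (code x ʳ++ []))

restoreC : ∀ x {a β κ} → unloadC ⊩ stacks a β (code x ʳ++ []) κ ⇓ stacks (code x ++ a) β [] κ # 2 * size x + 1
restoreC x {a} {β} {κ} = subst₂ (λ u n → unloadC ⊩ stacks a β (code x ʳ++ []) κ ⇓ stacks u β [] κ # 2 * n + 1)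
  (restore (code x) a) (size-stored x) (unloadC-run (code x ʳ++ []))

main : List Bool → Stacks 4
main a = stacks a [] [] []

dup swap : SProg 4
dup  = scan true true ▷ unloadB ▷ unloadC
swap = scan true false ▷ scan false true ▷ unloadB ▷ unloadC

dup-run : ∀ x {r} → dup ⊩ main (code x ++ r) ⇓ main (code x ++ code x ++ r) # 10 * size x + 4
dup-run x = slack (≤-reflexive (eq (size x))) (scan-run true true x ⟫ restoreB x ⟫ restoreC x)
  where
  eq : ∀ n → 1 + (6 * n + 1) + (2 * n + 1 + (2 * n + 1)) ≡ 10 * n + 4
  eq = solve-∀

swap-run : ∀ x y {r} → swap ⊩ main (code x ++ code y ++ r) ⇓ main (code y ++ code x ++ r) # 8 * (size x + size y) + 6
swap-run x y = slack (≤-reflexive (eq (size x) (size y))) (scan-run true false x ⟫ scan-run false true y ⟫ restoreB x ⟫ restoreC y)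
  where
  eq : ∀ a b → 1 + (6 * a + 1) + (1 + (6 * b + 1) + (2 * a + 1 + (2 * b + 1))) ≡ 8 * (a + b) + 6
  eq = solve-∀

infix 3 _∶_↦_#_

-- The quantifier over `r` expresses that whatever lies below the argument is left untouched, which
-- is what lets programs be combined on one stack.
_∶_↦_#_ : SProg 4 → Tree → Tree → ℕ → Set
P ∶ x ↦ y # t = ∀ r → P ⊩ main (code x ++ r) ⇓ main (code y ++ r) # t

nilP hdP tlP : SProg 4
nilP = scan false false ▷ push 𝖠 false
hdP  = pop 𝖠 skip λ b → if b then scan true false ▷ scan false false ▷ unloadB else push 𝖠 false
tlP  = pop 𝖠 skip λ b → if b then scan false false else push 𝖠 false

hd tl : Tree → Tree
hd nil        = nil
hd (cons x y) = x
tl nil        = nil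
tl (cons x y) = y

skip-computes : ∀ x → skip ∶ x ↦ x # 1
skip-computes x r = run-skip

nil-computes : ∀ x → nilP ∶ x ↦ nil # 6 * size x + 3
nil-computes x r = slack (≤-reflexive (eq (size x))) (scan-run false false x ⟫ run-push)
  where
  eq : ∀ n → 1 + (6 * n + 1) + 1 ≡ 6 * n + 3
  eq = solve-∀

hd-computes : ∀ x → hdP ∶ x ↦ hd x # 8 * size x + 6
hd-computes nil        r = slack (s≤s (s≤s z≤n)) (pop-bit refl run-push)
hd-computes (cons x y) r rewrite ++-assoc (code x) (code y) r =
  slack (m+k≡n⇒m≤n (8 + 2 * size y) (eq (size x) (size y))) (pop-bit refl (scan-run true false x ⟫ scan-run false false y ⟫ restoreB x))
  where
  eq : ∀ a b → suc (1 + (6 * a + 1) + (1 + (6 * b + 1) + (2 * a + 1))) + (8 + 2 * b) ≡ 8 * suc (a + b) + 6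
  eq = solve-∀

tl-computes : ∀ x → tlP ∶ x ↦ tl x # 8 * size x + 6
tl-computes nil        r = slack (s≤s (s≤s z≤n)) (pop-bit refl run-push)
tl-computes (cons x y) r rewrite ++-assoc (code x) (code y) r =
  slack (m+k≡n⇒m≤n (11 + 2 * size x + 8 * size y) (eq (size x) (size y))) (pop-bit refl (scan-run false false x))
  where
  eq : ∀ a b → suc (1 + (6 * a + 1)) + (11 + 2 * a + 8 * b) ≡ 8 * suc (a + b) + 6
  eq = solve-∀

then-computes : ∀ {P Q x y z s t} → P ∶ x ↦ y # s → Q ∶ y ↦ z # t → P ▷ Q ∶ x ↦ z # s + t
then-computes p q r = p r ⟫ q r

-- After `Q` the second copy of the argument lies below the result; `swap` brings it up, and `P`
-- then leaves the two results in the order in which `cons` is coded.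
pairP : SProg 4 → SProg 4 → SProg 4
pairP P Q = dup ▷ Q ▷ swap ▷ P ▷ push 𝖠 true

pair-computes : ∀ {P Q x y z s t} → P ∶ x ↦ y # s → Q ∶ x ↦ z # t → pairP P Q ∶ x ↦ cons y z # (18 * size x + 8 * size z + 11) + (s + t)
pair-computes {P} {Q} {x} {y} {z} {s} {t} p q r rewrite ++-assoc (code y) (code z) r =
  slack (≤-reflexive (eq (size x) (size z) s t)) (dup-run x ⟫ q (code x ++ r) ⟫ swap-run z x ⟫ p (code z ++ r) ⟫ run-push)
  where
  eq : ∀ a b s t → 10 * a + 4 + (t + (8 * (b + a) + 6 + (s + 1))) ≡ (18 * a + 8 * b + 11) + (s + t)
  eq = solve-∀

-- The only test available to loops and branches. On the code of a pair it asks whether the first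
-- component is `true`, a nonempty list or a positive number.
isPair : Tree → Bool
isPair (cons (cons _ _) _) = true
isPair _                   = false

-- Branches on isPair, which shows in the first two bits of the code.
testP : SProg 4 → SProg 4 → SProg 4
testP P Q = pop 𝖠 skip λ b → if b
  then (pop 𝖠 skip λ c → push 𝖠 c ▷ push 𝖠 true ▷ (if c then P else Q))
  else push 𝖠 false ▷ Q

test-true : ∀ {P Q} x {r β γ κ σ′ t} → isPair x ≡ true → P ⊩ stacks (code x ++ r) β γ κ ⇓ σ′ # t →
  testP P Q ⊩ stacks (code x ++ r) β γ κ ⇓ σ′ # 4 + t
test-true (cons (cons _ _) _) _ h = pop-bit refl (pop-bit refl (run-push ⟫ run-push ⟫ h))

test-false : ∀ {P Q} x {r β γ κ σ′ t} → isPair x ≡ false → Q ⊩ stacks (code x ++ r) β γ κ ⇓ σ′ # t →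
  testP P Q ⊩ stacks (code x ++ r) β γ κ ⇓ σ′ # 4 + t
test-false nil          _ h = slack (s≤s (s≤s (m≤n+m _ 2))) (pop-bit refl (run-push ⟫ h))
test-false (cons nil _) _ h = pop-bit refl (pop-bit refl (run-push ⟫ run-push ⟫ h))

-- A bit on 𝖪 requests one more test of the argument; it is put back only after a round of the body.
whileP : SProg 4 → SProg 4
whileP P = push 𝖪 true ▷ loop 𝖪 (λ _ → testP (P ▷ push 𝖪 true) skip)

record Loop (P : SProg 4) (x y : Tree) (t : ℕ) : Set where
  constructor mkLoop
  field unLoop : ∀ r → loop 𝖪 (λ _ → testP (P ▷ push 𝖪 true) skip) ⊩ stacks (code x ++ r) [] [] (true ∷ []) ⇓ main (code y ++ r) # t

loop-stop : ∀ {P} x → isPair x ≡ false → Loop P x x 7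
loop-stop x e = mkLoop λ r → loop-bit refl (test-false x e run-skip) (loop-end refl)

loop-step : ∀ {P x y z s t} → isPair x ≡ true → P ∶ x ↦ y # s → Loop P y z t → Loop P x z (6 + s + t)
loop-step {x = x} {s = s} {t} e p (mkLoop l) = mkLoop λ r → slack (≤-reflexive (cong (λ z → 5 + z + t) (+-comm s 1))) (loop-bit refl (test-true x e (p r ⟫ run-push)) (l r))

loop-slack : ∀ {P x y s t} → s ≤ t → Loop P x y s → Loop P x y t
loop-slack le (mkLoop l) = mkLoop λ r → slack le (l r)

while-computes : ∀ {P x y t} → Loop P x y t → whileP P ∶ x ↦ y # suc t
while-computes (mkLoop l) r = run-push ⟫ l r

-- Polynomial-time functions on typed data

infixr 6 _⊗_

data Ty : Set where
  𝟙 𝔹 𝕟 : Ty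
  _⊗_ : Ty → Ty → Ty
  𝕃 : Ty → Ty

⟦_⟧ᵗ : Ty → Set
⟦ 𝟙 ⟧ᵗ     = ⊤
⟦ 𝔹 ⟧ᵗ     = Bool
⟦ 𝕟 ⟧ᵗ     = ℕ
⟦ a ⊗ b ⟧ᵗ = ⟦ a ⟧ᵗ × ⟦ b ⟧ᵗ
⟦ 𝕃 a ⟧ᵗ   = List ⟦ a ⟧ᵗ

encList : ∀ {X : Set} → (X → Tree) → List X → Tree
encList e []      = nil
encList e (x ∷ l) = cons (e x) (encList e l)

-- Numbers are unary, and a nonempty list has the code of the pair of its head and tail. These
-- coincidences let `recode` change the type of a value at no cost.
enc : ∀ a → ⟦ a ⟧ᵗ → Tree
enc 𝟙       _       = nil
enc 𝔹       false   = nil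
enc 𝔹       true    = cons nil nil
enc 𝕟       zero    = nil
enc 𝕟       (suc n) = cons nil (enc 𝕟 n)
enc (a ⊗ b) (x , y) = cons (enc a x) (enc b y)
enc (𝕃 a)   l       = encList (enc a) l

sz : ∀ a → ⟦ a ⟧ᵗ → ℕ
sz a x = size (enc a x)

size-pos : ∀ x → 1 ≤ size x
size-pos nil        = ≤-refl
size-pos (cons _ _) = s≤s z≤n

-- Pure powers stand in for polynomials. Since the base is at least 2, constants are absorbed by
-- `k ≤ 2 ^ k` and sums by a larger exponent.
Bounded : ∀ a → (⟦ a ⟧ᵗ → ℕ) → Set
Bounded a g = Σ ℕ λ c → ∀ x → g x ≤ (2 + sz a x) ^ c

n≤2^n : ∀ n → n ≤ 2 ^ n
n≤2^n zero    = z≤n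
n≤2^n (suc n) = ≤-trans (+-mono-≤ (m^n>0 2 n) (n≤2^n n)) (≤-reflexive (cong (2 ^ n +_) (sym (+-identityʳ _))))

opaque
  bounded-≤ : ∀ {a g h} → (∀ x → g x ≤ h x) → Bounded a h → Bounded a g
  bounded-≤ le (c , b) = c , λ x → ≤-trans (le x) (b x)

  bounded-const : ∀ {a} k → Bounded a (λ _ → k)
  bounded-const k = k , λ x → ≤-trans (n≤2^n k) (^-monoˡ-≤ k (s≤s (s≤s z≤n)))

  bounded-sz : ∀ {a} → Bounded a (sz a)
  bounded-sz = 1 , λ x → ≤-trans (m≤n+m _ 2) (≤-reflexive (sym (*-identityʳ _)))

  pow-+ : ∀ s a b → (2 + s) ^ a + (2 + s) ^ b ≤ (2 + s) ^ suc (a + b)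
  pow-+ s a b = ≤-trans (+-mono-≤ (^-monoʳ-≤ (2 + s) (m≤m+n a b)) (^-monoʳ-≤ (2 + s) (m≤n+m b a)))
    (≤-trans (≤-reflexive (cong ((2 + s) ^ (a + b) +_) (sym (+-identityʳ _)))) (*-monoˡ-≤ ((2 + s) ^ (a + b)) (m≤m+n 2 s)))

  bounded-+ : ∀ {a g h} → Bounded a g → Bounded a h → Bounded a (λ x → g x + h x)
  bounded-+ (c , p) (d , q) = suc (c + d) , λ x → ≤-trans (+-mono-≤ (p x) (q x)) (pow-+ _ c d)

  bounded-* : ∀ {a g h} → Bounded a g → Bounded a h → Bounded a (λ x → g x * h x)
  bounded-* (c , p) (d , q) = c + d , λ x → ≤-trans (*-mono-≤ (p x) (q x)) (≤-reflexive (sym (^-distribˡ-+-* _ c d)))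

  pow-2+ : ∀ s d → 2 + (2 + s) ^ d ≤ (2 + s) ^ (2 + d)
  pow-2+ s d = ≤-trans (+-mono-≤ (*-monoʳ-≤ 2 (m^n>0 (2 + s) d)) (m≤m+n ((2 + s) ^ d) ((2 + s) ^ d)))
    (≤-trans (≤-reflexive (eq ((2 + s) ^ d))) (*-mono-≤ (m≤m+n 2 s) (*-monoˡ-≤ ((2 + s) ^ d) (m≤m+n 2 s))))
    where
    eq : ∀ y → 2 * y + (y + y) ≡ 2 * (2 * y)
    eq = solve-∀

  pow-pow : ∀ s t c d → t ≤ (2 + s) ^ d → (2 + t) ^ c ≤ (2 + s) ^ ((2 + d) * c)
  pow-pow s t c d le = ≤-trans (^-monoˡ-≤ c (≤-trans (s≤s (s≤s le)) (pow-2+ s d))) (≤-reflexive (^-*-assoc (2 + s) (2 + d) c))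

  bounded-∘ : ∀ {a b} {g : ⟦ b ⟧ᵗ → ℕ} {f : ⟦ a ⟧ᵗ → ⟦ b ⟧ᵗ} → Bounded b g → Bounded a (λ x → sz b (f x)) → Bounded a (λ x → g (f x))
  bounded-∘ {f = f} (c , p) (d , q) = (2 + d) * c , λ x → ≤-trans (p (f x)) (pow-pow _ _ c d (q x))

-- The size of the value is bounded alongside the time because composition evaluates the time bound
-- of the second program at that value.
record PT (a b : Ty) (f : ⟦ a ⟧ᵗ → ⟦ b ⟧ᵗ) : Set where
  constructor mkPT
  field
    prog       : SProg 4
    time       : ⟦ a ⟧ᵗ → ℕ
    computes   : ∀ x → prog ∶ enc a x ↦ enc b (f x) # time x
    time-bound : Bounded a time
    size-bound : Bounded a (λ x → sz b (f x))

open PT public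

ext : ∀ {a b f g} → (∀ x → f x ≡ g x) → PT a b f → PT a b g
ext {a} {b} e p = mkPT (prog p) (time p)
  (λ x → subst (λ y → prog p ∶ enc a x ↦ enc b y # time p x) (e x) (computes p x))
  (time-bound p) (bounded-≤ {a} (λ x → ≤-reflexive (cong (sz b) (sym (e x)))) (size-bound p))

var : ∀ {a} → PT a a id
var {a} = mkPT skip (λ _ → 1) (λ x → skip-computes (enc a x)) (bounded-const {a} 1) (bounded-sz {a})

infixr 9 _⊚_

_⊚_ : ∀ {a b c g f} → PT b c g → PT a b f → PT a c (λ x → g (f x))
_⊚_ {a} {b} {c} {g} {f} q p = mkPT (prog p ▷ prog q) (λ x → time p x + time q (f x))
  (λ x → then-computes (computes p x) (computes q (f x)))
  (bounded-+ {a} (time-bound p) (bounded-∘ {a} {b} {f = f} (time-bound q) (size-bound p)))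
  (bounded-∘ {a} {b} {f = f} (size-bound q) (size-bound p))

linear : ∀ {a} k l → Bounded a (λ x → k * sz a x + l)
linear {a} k l = bounded-+ {a} (bounded-* {a} (bounded-const {a} k) (bounded-sz {a})) (bounded-const {a} l)

π₁ : ∀ {a b} → PT (a ⊗ b) a proj₁
π₁ {a} {b} = mkPT hdP (λ x → 8 * sz (a ⊗ b) x + 6) (λ x → hd-computes (enc (a ⊗ b) x)) (linear {a ⊗ b} 8 6)
  (bounded-≤ {a ⊗ b} (λ x → ≤-trans (m≤m+n _ _) (n≤1+n _)) (bounded-sz {a ⊗ b}))

π₂ : ∀ {a b} → PT (a ⊗ b) b proj₂
π₂ {a} {b} = mkPT tlP (λ x → 8 * sz (a ⊗ b) x + 6) (λ x → tl-computes (enc (a ⊗ b) x)) (linear {a ⊗ b} 8 6)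
  (bounded-≤ {a ⊗ b} (λ x → ≤-trans (m≤n+m _ (sz a (proj₁ x))) (n≤1+n _)) (bounded-sz {a ⊗ b}))

infixr 4 _&_

_&_ : ∀ {a b c f g} → PT a b f → PT a c g → PT a (b ⊗ c) (λ x → f x , g x)
_&_ {a} {b} {c} {f} {g} p q = mkPT (pairP (prog p) (prog q))
  (λ x → (18 * sz a x + 8 * sz c (g x) + 11) + (time p x + time q x))
  (λ x → pair-computes (computes p x) (computes q x))
  (bounded-+ {a} (bounded-+ {a} (bounded-+ {a} (bounded-* {a} (bounded-const {a} 18) (bounded-sz {a})) (bounded-* {a} (bounded-const {a} 8) (size-bound q))) (bounded-const {a} 11))
    (bounded-+ {a} (time-bound p) (time-bound q)))
  (bounded-+ {a} (bounded-const {a} 1) (bounded-+ {a} (size-bound p) (size-bound q)))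

recode : ∀ {a b c f g} → (∀ x → enc b (f x) ≡ enc c (g x)) → PT a b f → PT a c g
recode {a} e p = mkPT (prog p) (time p) (λ x → subst (λ y → prog p ∶ enc a x ↦ y # time p x) (e x) (computes p x)) (time-bound p)
  (bounded-≤ {a} (λ x → ≤-reflexive (cong size (sym (e x)))) (size-bound p))

unit : ∀ {a} → PT a 𝟙 (λ _ → tt)
unit {a} = mkPT nilP (λ x → 6 * sz a x + 3) (λ x → nil-computes (enc a x)) (linear {a} 6 3) (bounded-const {a} 1)

infixr 5 _∷ₚ_

_∷ₚ_ : ∀ {a b f g} → PT a b f → PT a (𝕃 b) g → PT a (𝕃 b) (λ x → f x ∷ g x)
p ∷ₚ q = recode (λ _ → refl) (p & q)

[]ₚ : ∀ {a b} → PT a (𝕃 b) (λ _ → [])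
[]ₚ = recode (λ _ → refl) unit

zeroₚ : ∀ {a} → PT a 𝕟 (λ _ → 0)
zeroₚ = recode (λ _ → refl) unit

sucₚ : ∀ {a f} → PT a 𝕟 f → PT a 𝕟 (λ x → suc (f x))
sucₚ p = recode (λ _ → refl) (unit & p)

falseₚ : ∀ {a} → PT a 𝔹 (λ _ → false)
falseₚ = recode (λ _ → refl) unit

trueₚ : ∀ {a} → PT a 𝔹 (λ _ → true)
trueₚ = recode (λ _ → refl) (unit & unit)

constP : ∀ {a} b (v : ⟦ b ⟧ᵗ) → PT a b (λ _ → v)
constP 𝟙       _       = unit
constP 𝔹       false   = falseₚ
constP 𝔹       true    = trueₚ
constP 𝕟       zero    = zeroₚ
constP 𝕟       (suc n) = sucₚ (constP 𝕟 n)
constP (b ⊗ c) (x , y) = constP b x & constP c y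
constP (𝕃 b)   []      = []ₚ
constP (𝕃 b)   (x ∷ l) = constP b x ∷ₚ constP (𝕃 b) l

cond : ∀ {X : Set} → Bool → X → X → X
cond b x y = if b then x else y

-- The condition is paired with the argument so that `testP` can see it, and `tlP` then discards it.
-- Charging both branches keeps the time bound free of case distinctions.
ifₚ : ∀ {a b c f g} → PT a 𝔹 c → PT a b f → PT a b g → PT a b (λ x → cond (c x) (f x) (g x))
ifₚ {a} {b} {c} {f} {g} p q q′ = mkPT
  (prog (p & var) ▷ testP (tlP ▷ prog q) (tlP ▷ prog q′))
  (λ x → time (p & var) x + (4 + (8 * sz (𝔹 ⊗ a) (c x , x) + 6 + (time q x + time q′ x))))
  run-if
  (bounded-+ {a} (time-bound (p & var)) (bounded-+ {a} (bounded-const {a} 4) (bounded-+ {a} (bounded-+ {a} (bounded-* {a} (bounded-const {a} 8) (size-bound (p & var))) (bounded-const {a} 6)) (bounded-+ {a} (time-bound q) (time-bound q′)))))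
  (bounded-≤ {a} both (bounded-+ {a} (size-bound q) (size-bound q′)))
  where
  both : ∀ x → sz b (cond (c x) (f x) (g x)) ≤ sz b (f x) + sz b (g x)
  both x with c x
  ... | true  = m≤m+n _ _
  ... | false = m≤n+m _ _
  run-if : ∀ x → prog (p & var) ▷ testP (tlP ▷ prog q) (tlP ▷ prog q′) ∶ enc a x ↦ enc b (cond (c x) (f x) (g x))
    # time (p & var) x + (4 + (8 * sz (𝔹 ⊗ a) (c x , x) + 6 + (time q x + time q′ x)))
  run-if x r = computes (p & var) x r ⟫ branch (c x)
    where
    branch : ∀ b′ → testP (tlP ▷ prog q) (tlP ▷ prog q′) ⊩ main (code (enc (𝔹 ⊗ a) (b′ , x)) ++ r) ⇓ main (code (enc b (cond b′ (f x) (g x))) ++ r)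
      # 4 + (8 * sz (𝔹 ⊗ a) (b′ , x) + 6 + (time q x + time q′ x))
    branch true  = test-true (enc (𝔹 ⊗ a) (true , x)) refl
      (slack (+-monoʳ-≤ (8 * sz (𝔹 ⊗ a) (true , x) + 6) (m≤m+n _ _)) (tl-computes (enc (𝔹 ⊗ a) (true , x)) r ⟫ computes q x r))
    branch false = test-false (enc (𝔹 ⊗ a) (false , x)) refl
      (slack (+-monoʳ-≤ (8 * sz (𝔹 ⊗ a) (false , x) + 6) (m≤n+m _ _)) (tl-computes (enc (𝔹 ⊗ a) (false , x)) r ⟫ computes q′ x r))

isCons : ∀ {X : Set} → List X → Bool
isCons []      = false
isCons (_ ∷ _) = true

nonzero : ℕ → Bool
nonzero zero    = false
nonzero (suc _) = true

-- Pairing the list with a unit puts it where `isPair` looks.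
isConsₚ : ∀ {b} → PT (𝕃 b) 𝔹 isCons
isConsₚ {b} = mkPT (prog start ▷ testP (prog (trueₚ {𝕃 b ⊗ 𝟙})) (prog (falseₚ {𝕃 b ⊗ 𝟙})))
  (λ l → 4 + (time yes l + time no l))
  (λ l r → slack (le (time start l) (time (trueₚ {𝕃 b ⊗ 𝟙}) (l , tt)) (time (falseₚ {𝕃 b ⊗ 𝟙}) (l , tt))) (computes start l r ⟫ branch l r))
  (bounded-+ {𝕃 b} (bounded-const {𝕃 b} 4) (bounded-+ {𝕃 b} (time-bound yes) (time-bound no)))
  (bounded-≤ {𝕃 b} small (bounded-const {𝕃 b} 3))
  where
  start : PT (𝕃 b) (𝕃 b ⊗ 𝟙) (λ l → l , tt)
  start = var & unit
  yes : PT (𝕃 b) 𝔹 (λ _ → true)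
  yes = trueₚ ⊚ start
  no : PT (𝕃 b) 𝔹 (λ _ → false)
  no = falseₚ ⊚ start
  le : ∀ p q r → p + (4 + (q + r)) ≤ 4 + ((p + q) + (p + r))
  le p q r = m+k≡n⇒m≤n p (eq p q r)
    where
    eq : ∀ p q r → p + (4 + (q + r)) + p ≡ 4 + ((p + q) + (p + r))
    eq = solve-∀
  small : ∀ l → sz 𝔹 (isCons l) ≤ 3
  small []      = s≤s z≤n
  small (_ ∷ _) = ≤-refl
  branch : ∀ l r → testP (prog (trueₚ {𝕃 b ⊗ 𝟙})) (prog (falseₚ {𝕃 b ⊗ 𝟙})) ⊩ main (code (enc (𝕃 b ⊗ 𝟙) (l , tt)) ++ r) ⇓ main (code (enc 𝔹 (isCons l)) ++ r)
    # 4 + (time (trueₚ {𝕃 b ⊗ 𝟙}) (l , tt) + time (falseₚ {𝕃 b ⊗ 𝟙}) (l , tt))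
  branch []      r = test-false (enc (𝕃 b ⊗ 𝟙) ([] , tt)) refl (slack (m≤n+m _ (time (trueₚ {𝕃 b ⊗ 𝟙}) ([] , tt))) (computes (falseₚ {𝕃 b ⊗ 𝟙}) ([] , tt) r))
  branch (x ∷ l) r = test-true (enc (𝕃 b ⊗ 𝟙) (x ∷ l , tt)) refl (slack (m≤m+n _ _) (computes (trueₚ {𝕃 b ⊗ 𝟙}) (x ∷ l , tt) r))

enc-units : ∀ n → enc 𝕟 n ≡ enc (𝕃 𝟙) (replicate n tt)
enc-units zero    = refl
enc-units (suc n) = cong (cons nil) (enc-units n)

unitsₚ : PT 𝕟 (𝕃 𝟙) (λ n → replicate n tt)
unitsₚ = recode enc-units (var {𝕟})

nonzeroₚ : PT 𝕟 𝔹 nonzero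
nonzeroₚ = ext (λ { zero → refl ; (suc _) → refl }) (isConsₚ ⊚ unitsₚ)

tail : ∀ {X : Set} → List X → List X
tail []      = []
tail (_ ∷ l) = l

tailₚ : ∀ {b} → PT (𝕃 b) (𝕃 b) tail
tailₚ {b} = mkPT tlP (λ x → 8 * sz (𝕃 b) x + 6)
  (λ { [] → tl-computes nil ; (x ∷ l) → tl-computes (enc (𝕃 b) (x ∷ l)) }) (linear {𝕃 b} 8 6)
  (bounded-≤ {𝕃 b} (λ { [] → ≤-refl ; (x ∷ l) → ≤-trans (m≤n+m _ (sz b x)) (n≤1+n _) }) (bounded-sz {𝕃 b}))

predₚ : PT 𝕟 𝕟 pred
predₚ = mkPT tlP (λ x → 8 * sz 𝕟 x + 6)
  (λ { zero → tl-computes nil ; (suc n) → tl-computes (enc 𝕟 (suc n)) }) (linear {𝕟} 8 6)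
  (bounded-≤ {𝕟} (λ { zero → ≤-refl ; (suc n) → ≤-trans (n≤1+n _) (n≤1+n _) }) (bounded-sz {𝕟}))

headOr : ∀ {X : Set} → X → List X → X
headOr d []      = d
headOr d (x ∷ _) = x

-- Taking the first component of the empty list (coded by nil) yields nil.
headₚ : ∀ {b} d → enc b d ≡ nil → PT (𝕃 b) b (headOr d)
headₚ {b} d e = mkPT hdP (λ x → 8 * sz (𝕃 b) x + 6)
  (λ { [] → subst (λ z → hdP ∶ nil ↦ z # 8 + 6) (sym e) (hd-computes nil) ; (x ∷ l) → hd-computes (enc (𝕃 b) (x ∷ l)) }) (linear {𝕃 b} 8 6)
  (bounded-≤ {𝕃 b} (λ { [] → ≤-reflexive (cong size e) ; (x ∷ l) → ≤-trans (m≤m+n _ _) (n≤1+n _) }) (bounded-sz {𝕃 b}))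

length≤sz : ∀ b (l : ⟦ 𝕃 b ⟧ᵗ) → length l ≤ sz (𝕃 b) l
length≤sz b []      = z≤n
length≤sz b (x ∷ l) = s≤s (≤-trans (length≤sz b l) (m≤n+m _ _))

module Fold {g x b s} (step : PT (g ⊗ x ⊗ b) b s) where

  body : PT ((x ⊗ 𝕃 x) ⊗ g ⊗ b) (𝕃 x ⊗ g ⊗ b) (λ p → proj₂ (proj₁ p) , proj₁ (proj₂ p) , s (proj₁ (proj₂ p) , proj₁ (proj₁ p) , proj₂ (proj₂ p)))
  body = (π₂ ⊚ π₁) & (π₁ ⊚ π₂) & (step ⊚ ((π₁ ⊚ π₂) & (π₁ ⊚ π₁) & (π₂ ⊚ π₂)))

  fold : ⟦ g ⟧ᵗ → ⟦ b ⟧ᵗ → ⟦ 𝕃 x ⟧ᵗ → ⟦ b ⟧ᵗ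
  fold γ = foldl (λ v e → s (γ , e , v))

  deg : ℕ
  deg = proj₁ (time-bound body)

  -- The size bound `V` need not be polynomial: with an exponential one the same lemma later times
  -- the loop that produces `2 ^ pad n`.
  fold-loop : ∀ V γ v l → (∀ ys zs → ys ++ zs ≡ l → sz b (fold γ v ys) ≤ V) →
    Loop (prog body) (enc (𝕃 x ⊗ g ⊗ b) (l , γ , v)) (enc (𝕃 x ⊗ g ⊗ b) ([] , γ , fold γ v l)) (length l * (6 + (2 + (2 + sz (𝕃 x) l + sz g γ + V)) ^ deg) + 7)
  fold-loop V γ v []      h = loop-stop (enc (𝕃 x ⊗ g ⊗ b) ([] , γ , v)) refl
  fold-loop V γ v (e ∷ l) h = loop-slack le
    (loop-step {x = enc (𝕃 x ⊗ g ⊗ b) (e ∷ l , γ , v)} refl (computes body ((e , l) , γ , v))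
      (fold-loop V γ (s (γ , e , v)) l (λ ys zs eq → h (e ∷ ys) zs (cong (e ∷_) eq))))
    where
    present : sz ((x ⊗ 𝕃 x) ⊗ g ⊗ b) ((e , l) , γ , v) ≤ 2 + sz (𝕃 x) (e ∷ l) + sz g γ + V
    present = ≤-trans (≤-reflexive (eq (sz (𝕃 x) (e ∷ l)) (sz g γ) (sz b v))) (+-monoʳ-≤ (2 + sz (𝕃 x) (e ∷ l) + sz g γ) (h [] (e ∷ l) refl))
      where
      eq : ∀ p q r → suc (p + suc (q + r)) ≡ 2 + p + q + r
      eq = solve-∀
    mono : 2 + sz (𝕃 x) l + sz g γ + V ≤ 2 + sz (𝕃 x) (e ∷ l) + sz g γ + V
    mono = +-monoˡ-≤ V (+-monoˡ-≤ (sz g γ) (+-monoʳ-≤ 2 (≤-trans (m≤n+m _ (sz x e)) (n≤1+n _))))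
    W : ℕ
    W = (2 + (2 + sz (𝕃 x) (e ∷ l) + sz g γ + V)) ^ deg
    le : 6 + time body ((e , l) , γ , v) + (length l * (6 + (2 + (2 + sz (𝕃 x) l + sz g γ + V)) ^ deg) + 7) ≤ (6 + W) + length l * (6 + W) + 7
    le = ≤-trans (+-mono-≤ (+-monoʳ-≤ 6 (≤-trans (proj₂ (time-bound body) _) (^-monoˡ-≤ deg (s≤s (s≤s present)))))
           (+-monoˡ-≤ 7 (*-monoʳ-≤ (length l) (+-monoʳ-≤ 6 (^-monoˡ-≤ deg (s≤s (s≤s mono)))))))
         (≤-reflexive (sym (+-assoc (6 + W) (length l * (6 + W)) 7)))

  -- Bounded recursion in the sense of Cobham. A polynomial-time step may be iterated along a list
  -- provided that a polynomial `G` bounds the value after every prefix; without it a doubling step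
  -- would reach exponential size.
  foldₚ : ∀ {l v} → PT g (𝕃 x) l → PT g b v → (G : ⟦ g ⟧ᵗ → ℕ) → Bounded g G →
    (∀ γ ys zs → ys ++ zs ≡ l γ → sz b (fold γ (v γ) ys) ≤ G γ) →
    PT g b (λ γ → fold γ (v γ) (l γ))
  foldₚ {l} {v} pl pv G bG h = π₂ ⊚ π₂ ⊚ whole
    where
    start : PT g (𝕃 x ⊗ g ⊗ b) (λ γ → l γ , γ , v γ)
    start = pl & var & pv
    V : ⟦ g ⟧ᵗ → ℕ
    V γ = 2 + sz (𝕃 x) (l γ) + sz g γ + G γ
    bl : Bounded g (λ γ → length (l γ))
    bl = bounded-≤ {g} (λ γ → length≤sz x (l γ)) (size-bound pl)
    bV′ : Bounded g V
    bV′ = bounded-+ {g} (bounded-+ {g} (bounded-+ {g} (bounded-const {g} 2) (size-bound pl)) (bounded-sz {g})) bG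
    bV : Bounded g (λ γ → (2 + V γ) ^ deg)
    bV = (2 + proj₁ bV′) * deg , λ γ → pow-pow _ _ deg (proj₁ bV′) (proj₂ bV′ γ)
    whole : PT g (𝕃 x ⊗ g ⊗ b) (λ γ → [] , γ , fold γ (v γ) (l γ))
    whole = mkPT (prog start ▷ whileP (prog body))
      (λ γ → time start γ + suc (length (l γ) * (6 + (2 + V γ) ^ deg) + 7))
      (λ γ → then-computes {x = enc g γ} {enc (𝕃 x ⊗ g ⊗ b) (l γ , γ , v γ)} {enc (𝕃 x ⊗ g ⊗ b) ([] , γ , fold γ (v γ) (l γ))}
        (computes start γ) (while-computes (fold-loop (G γ) γ (v γ) (l γ) (h γ))))
      (bounded-+ {g} (time-bound start) (bounded-+ {g} (bounded-const {g} 1) (bounded-+ {g} (bounded-* {g} bl (bounded-+ {g} (bounded-const {g} 6) bV)) (bounded-const {g} 7))))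
      (bounded-≤ {g} (λ γ → +-monoʳ-≤ 3 (+-monoʳ-≤ (sz g γ) (h γ (l γ) [] (++-identityʳ _))))
        (bounded-+ {g} (bounded-const {g} 3) (bounded-+ {g} (bounded-sz {g}) bG)))

module _ {g x b s} (step : PT (g ⊗ x ⊗ b) b s) where

  open Fold {g} {x} {b} {s} step using (fold; foldₚ)

  fold-growth : ∀ (h : ⟦ g ⊗ x ⟧ᵗ → ℕ) (bh : Bounded (g ⊗ x) h) → (∀ γ e v → sz b (s (γ , e , v)) ≤ sz b v + h (γ , e)) →
    ∀ γ v ys zs → sz b (fold γ v ys) ≤ sz b v + length ys * (2 + (1 + (sz g γ + sz (𝕃 x) (ys ++ zs)))) ^ proj₁ bh
  fold-growth h bh grow γ v []       zs = m≤m+n _ _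
  fold-growth h bh@(c , hb) grow γ v (e ∷ ys) zs =
    ≤-trans (fold-growth h bh grow γ (s (γ , e , v)) ys zs)
      (≤-trans (+-mono-≤ (≤-trans (grow γ e v) (+-monoʳ-≤ (sz b v) (≤-trans (hb (γ , e)) (^-monoˡ-≤ c big))))
                         (*-monoʳ-≤ (length ys) (^-monoˡ-≤ c bigger)))
        (≤-reflexive (+-assoc (sz b v) _ _)))
    where
    big : 2 + suc (sz g γ + sz x e) ≤ 2 + suc (sz g γ + sz (𝕃 x) (e ∷ ys ++ zs))
    big = s≤s (s≤s (s≤s (+-monoʳ-≤ (sz g γ) (≤-trans (m≤m+n _ _) (n≤1+n _)))))
    bigger : 2 + suc (sz g γ + sz (𝕃 x) (ys ++ zs)) ≤ 2 + suc (sz g γ + sz (𝕃 x) (e ∷ ys ++ zs))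
    bigger = s≤s (s≤s (s≤s (+-monoʳ-≤ (sz g γ) (≤-trans (m≤n+m _ (sz x e)) (n≤1+n _)))))

  -- If each step adds an amount that does not depend on the accumulator, the size stays below the
  -- initial size plus the length of the list times the largest amount, so a suitable `G` exists.
  fold-add : (h : ⟦ g ⊗ x ⟧ᵗ → ℕ) → Bounded (g ⊗ x) h → (∀ γ e v → sz b (s (γ , e , v)) ≤ sz b v + h (γ , e)) →
    ∀ {l v} → PT g (𝕃 x) l → PT g b v → PT g b (λ γ → foldl (λ v e → s (γ , e , v)) (v γ) (l γ))
  fold-add h bh grow {l} {v} pl pv = foldₚ pl pv G bG bound
    where
    G : ⟦ g ⟧ᵗ → ℕ
    G γ = sz b (v γ) + length (l γ) * (2 + (1 + (sz g γ + sz (𝕃 x) (l γ)))) ^ proj₁ bh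
    inner : Bounded g (λ γ → 1 + (sz g γ + sz (𝕃 x) (l γ)))
    inner = bounded-+ {g} (bounded-const {g} 1) (bounded-+ {g} (bounded-sz {g}) (size-bound pl))
    bG : Bounded g G
    bG = bounded-+ {g} (size-bound pv) (bounded-* {g} (bounded-≤ {g} (λ γ → length≤sz x (l γ)) (size-bound pl))
      ((2 + proj₁ inner) * proj₁ bh , λ γ → pow-pow _ _ (proj₁ bh) (proj₁ inner) (proj₂ inner γ)))
    bound : ∀ γ ys zs → ys ++ zs ≡ l γ → sz b (fold γ (v γ) ys) ≤ G γ
    bound γ ys zs eq = subst (λ l → sz b (fold γ (v γ) ys) ≤ sz b (v γ) + length l * (2 + (1 + (sz g γ + sz (𝕃 x) l))) ^ proj₁ bh) eq
      (≤-trans (fold-growth h bh grow γ (v γ) ys zs)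
        (+-monoʳ-≤ (sz b (v γ)) (*-monoˡ-≤ ((2 + (1 + (sz g γ + sz (𝕃 x) (ys ++ zs)))) ^ proj₁ bh)
          (≤-trans (m≤m+n _ (length zs)) (≤-reflexive (sym (length-++ ys)))))))

-- Iteration, list operations and unary arithmetic

iter : ∀ {X : Set} → ℕ → (X → X) → X → X
iter zero    f v = v
iter (suc n) f v = iter n f (f v)

foldl-units : ∀ {X : Set} (f : X → X) v n → foldl (λ v _ → f v) v (replicate n tt) ≡ iter n f v
foldl-units f v zero    = refl
foldl-units f v (suc n) = foldl-units f (f v) n

units-split : ∀ ys zs n → ys ++ zs ≡ replicate n tt → ys ≡ replicate (length ys) tt × length ys ≤ n
units-split []        zs n       e = refl , z≤n
units-split (tt ∷ ys) zs (suc n) e with units-split ys zs n (cong tail e)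
... | p , q = cong (tt ∷_) p , s≤s q

module _ {g b s} (step : PT (g ⊗ b) b s) where

  private
    step′ : PT (g ⊗ 𝟙 ⊗ b) b (λ p → s (proj₁ p , proj₂ (proj₂ p)))
    step′ = step ⊚ (π₁ & (π₂ ⊚ π₂))

  iter-add : (h : ⟦ g ⟧ᵗ → ℕ) → Bounded g h → (∀ γ v → sz b (s (γ , v)) ≤ sz b v + h γ) →
    ∀ {n v} → PT g 𝕟 n → PT g b v → PT g b (λ γ → iter (n γ) (λ v → s (γ , v)) (v γ))
  iter-add h bh grow {n} {v} pn pv = ext (λ γ → foldl-units (λ v → s (γ , v)) (v γ) (n γ))
    (fold-add step′ (λ p → h (proj₁ p)) (bounded-∘ {g ⊗ 𝟙} {g} {f = proj₁} bh (size-bound (π₁ {g} {𝟙}))) (λ γ e v → grow γ v) (unitsₚ ⊚ pn) pv)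

  iter-bounded : ∀ {n v} → PT g 𝕟 n → PT g b v → (G : ⟦ g ⟧ᵗ → ℕ) → Bounded g G →
    (∀ γ i → i ≤ n γ → sz b (iter i (λ v → s (γ , v)) (v γ)) ≤ G γ) →
    PT g b (λ γ → iter (n γ) (λ v → s (γ , v)) (v γ))
  iter-bounded {n} {v} pn pv G bG h = ext (λ γ → foldl-units (λ v → s (γ , v)) (v γ) (n γ))
    (Fold.foldₚ {g} {𝟙} {b} step′ (unitsₚ ⊚ pn) pv G bG bound)
    where
    bound : ∀ γ ys zs → ys ++ zs ≡ replicate (n γ) tt → sz b (foldl (λ v _ → s (γ , v)) (v γ) ys) ≤ G γ
    bound γ ys zs eq with units-split ys zs (n γ) eq
    ... | p , q = ≤-trans (≤-reflexive (cong (sz b) (trans (cong (foldl (λ v _ → s (γ , v)) (v γ)) p) (foldl-units (λ v → s (γ , v)) (v γ) (length ys))))) (h γ (length ys) q)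

sz-𝕟 : ∀ n → sz 𝕟 n ≡ 2 * n + 1
sz-𝕟 zero    = refl
sz-𝕟 (suc n) = trans (cong (2 +_) (sz-𝕟 n)) (cong (_+ 1) (sym (*-distribˡ-+ 2 1 n)))

opaque
  reverseₚ : ∀ {b} → PT (𝕃 b) (𝕃 b) reverse
  reverseₚ {b} = fold-add {𝕃 b} {b} {𝕃 b} ((π₁ ⊚ π₂) ∷ₚ (π₂ ⊚ π₂)) (λ p → suc (sz b (proj₂ p)))
    (bounded-+ {𝕃 b ⊗ b} (bounded-const {𝕃 b ⊗ b} 1) (size-bound (π₂ {𝕃 b} {b})))
    (λ γ e v → ≤-reflexive (+-comm (suc (sz b e)) (sz (𝕃 b) v))) var []ₚ

foldl-cons-map : ∀ {X Y : Set} (f : X → Y) acc l → foldl (λ v e → f e ∷ v) acc l ≡ map f l ʳ++ acc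
foldl-cons-map f acc []      = refl
foldl-cons-map f acc (x ∷ l) = foldl-cons-map f (f x ∷ acc) l

opaque
  mapₚ : ∀ {g x y f l} → PT (g ⊗ x) y f → PT g (𝕃 x) l → PT g (𝕃 y) (λ γ → map (λ e → f (γ , e)) (l γ))
  mapₚ {g} {x} {y} {f} {l} pf pl = ext (λ γ → trans (cong reverse (foldl-cons-map _ [] (l γ))) (reverse-involutive _))
    (reverseₚ ⊚ fold-add {g} {x} {𝕃 y} ((pf ⊚ (π₁ & (π₁ ⊚ π₂))) ∷ₚ (π₂ ⊚ π₂)) (λ p → suc (sz y (f p)))
      (bounded-+ {g ⊗ x} (bounded-const {g ⊗ x} 1) (size-bound pf))
      (λ γ e v → ≤-reflexive (+-comm (suc (sz y (f (γ , e)))) (sz (𝕃 y) v))) pl []ₚ)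

opaque
  foldr-add : ∀ {g x b s} → PT (g ⊗ x ⊗ b) b s → (h : ⟦ g ⊗ x ⟧ᵗ → ℕ) → Bounded (g ⊗ x) h →
    (∀ γ e v → sz b (s (γ , e , v)) ≤ sz b v + h (γ , e)) →
    ∀ {l v} → PT g (𝕃 x) l → PT g b v → PT g b (λ γ → foldr (λ e v → s (γ , e , v)) (v γ) (l γ))
  foldr-add {s = s} step h bh grow {l} {v} pl pv =
    ext (λ γ → reverse-foldl (λ v e → s (γ , e , v)) (v γ) (l γ)) (fold-add step h bh grow (reverseₚ ⊚ pl) pv)

opaque
  foldr-bounded : ∀ {g x b s} → PT (g ⊗ x ⊗ b) b s → ∀ {l v} → PT g (𝕃 x) l → PT g b v → (G : ⟦ g ⟧ᵗ → ℕ) → Bounded g G →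
    (∀ γ zs ys → zs ++ ys ≡ l γ → sz b (foldr (λ e v → s (γ , e , v)) (v γ) ys) ≤ G γ) →
    PT g b (λ γ → foldr (λ e v → s (γ , e , v)) (v γ) (l γ))
  foldr-bounded {g} {x} {b} {s} step {l} {v} pl pv G bG h =
    ext (λ γ → reverse-foldl (λ v e → s (γ , e , v)) (v γ) (l γ)) (Fold.foldₚ {g} {x} {b} step (reverseₚ ⊚ pl) pv G bG bound)
    where
    bound : ∀ γ ys zs → ys ++ zs ≡ reverse (l γ) → sz b (foldl (λ v e → s (γ , e , v)) (v γ) ys) ≤ G γ
    bound γ ys zs eq = ≤-trans (≤-reflexive (cong (sz b) (sym (reverse-foldr (λ e v → s (γ , e , v)) (v γ) ys))))
      (h γ (reverse zs) (reverse ys) (trans (sym (reverse-++ ys zs)) (trans (cong reverse eq) (reverse-involutive _))))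

iter-suc : ∀ m n → iter m suc n ≡ m + n
iter-suc zero    n = refl
iter-suc (suc m) n = trans (iter-suc m (suc n)) (+-suc m n)

infixl 6 _+ₚ_ _∸ₚ_
infixl 7 _*ₚ_

opaque
  _+ₚ_ : ∀ {g m n} → PT g 𝕟 m → PT g 𝕟 n → PT g 𝕟 (λ γ → m γ + n γ)
  _+ₚ_ {g} {m} {n} p q = ext (λ γ → iter-suc (m γ) (n γ))
    (iter-add {g} {𝕟} (sucₚ π₂) (λ _ → 2) (bounded-const {g} 2) (λ γ v → ≤-reflexive (+-comm 2 (sz 𝕟 v))) p q)

sz-𝕟-+ : ∀ m n → sz 𝕟 (m + n) ≤ sz 𝕟 n + sz 𝕟 m
sz-𝕟-+ m n rewrite sz-𝕟 (m + n) | sz-𝕟 m | sz-𝕟 n = m+k≡n⇒m≤n 1 (eq m n)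
  where
  eq : ∀ m n → 2 * (m + n) + 1 + 1 ≡ 2 * n + 1 + (2 * m + 1)
  eq = solve-∀

iter-+ : ∀ m k n → iter m (k +_) n ≡ m * k + n
iter-+ zero    k n = refl
iter-+ (suc m) k n = trans (iter-+ m k (k + n)) (trans (sym (+-assoc (m * k) k n)) (cong (_+ n) (+-comm (m * k) k)))

opaque
  _*ₚ_ : ∀ {g m n} → PT g 𝕟 m → PT g 𝕟 n → PT g 𝕟 (λ γ → m γ * n γ)
  _*ₚ_ {g} {m} {n} p q = ext (λ γ → trans (iter-+ (m γ) (n γ) 0) (+-identityʳ _))
    (iter-add {g} {𝕟} ((q ⊚ π₁) +ₚ π₂) (λ γ → sz 𝕟 (n γ)) (size-bound q) (λ γ v → sz-𝕟-+ (n γ) v) p zeroₚ)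

iter-pred : ∀ n m → iter n pred m ≡ m ∸ n
iter-pred zero    m = refl
iter-pred (suc n) m = trans (iter-pred n (pred m)) (pred-∸ m)
  where
  pred-∸ : ∀ m → pred m ∸ n ≡ m ∸ suc n
  pred-∸ zero    = 0∸n≡0 n
  pred-∸ (suc m) = refl

sz-pred : ∀ n → sz 𝕟 (pred n) ≤ sz 𝕟 n
sz-pred zero    = ≤-refl
sz-pred (suc n) = m≤n+m _ 2

opaque
  _∸ₚ_ : ∀ {g m n} → PT g 𝕟 m → PT g 𝕟 n → PT g 𝕟 (λ γ → m γ ∸ n γ)
  _∸ₚ_ {g} {m} {n} p q = ext (λ γ → iter-pred (n γ) (m γ))
    (iter-add {g} {𝕟} (predₚ ⊚ π₂) (λ _ → 0) (bounded-const {g} 0) (λ γ v → ≤-trans (sz-pred v) (m≤m+n _ 0)) q p)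

notₚ : ∀ {g f} → PT g 𝔹 f → PT g 𝔹 (λ γ → not (f γ))
notₚ {f = f} p = ext (λ γ → eq (f γ)) (ifₚ p falseₚ trueₚ)
  where
  eq : ∀ b → cond b false true ≡ not b
  eq true  = refl
  eq false = refl

leq : ℕ → ℕ → Bool
leq m n = not (nonzero (m ∸ n))

opaque
  leqₚ : ∀ {g m n} → PT g 𝕟 m → PT g 𝕟 n → PT g 𝔹 (λ γ → leq (m γ) (n γ))
  leqₚ p q = notₚ (nonzeroₚ ⊚ (p ∸ₚ q))

leq⇒≤ : ∀ m n → leq m n ≡ true → m ≤ n
leq⇒≤ m n e with m ∸ n in eq
... | zero = m∸n≡0⇒m≤n eq

≤⇒leq : ∀ {m n} → m ≤ n → leq m n ≡ true
≤⇒leq le rewrite m≤n⇒m∸n≡0 le = refl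

foldl-length : ∀ {X : Set} n (l : List X) → foldl (λ n _ → suc n) n l ≡ length l + n
foldl-length n []      = refl
foldl-length n (x ∷ l) = trans (foldl-length (suc n) l) (+-suc (length l) n)

opaque
  lengthₚ : ∀ {b} → PT (𝕃 b) 𝕟 length
  lengthₚ {b} = ext (λ l → trans (foldl-length 0 l) (+-identityʳ _))
    (fold-add {𝕃 b} {b} {𝕟} (sucₚ (π₂ ⊚ π₂)) (λ _ → 2) (bounded-const {𝕃 b ⊗ b} 2) (λ γ e v → ≤-reflexive (+-comm 2 (sz 𝕟 v))) var zeroₚ)

sz-tail : ∀ b l → sz (𝕃 b) (tail l) ≤ sz (𝕃 b) l
sz-tail b []      = ≤-refl
sz-tail b (x ∷ l) = ≤-trans (m≤n+m _ (sz b x)) (n≤1+n _)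

opaque
  dropₚ : ∀ {g b n l} → PT g 𝕟 n → PT g (𝕃 b) l → PT g (𝕃 b) (λ γ → iter (n γ) tail (l γ))
  dropₚ {g} {b} p q = iter-add {g} {𝕃 b} (tailₚ ⊚ π₂) (λ _ → 0) (bounded-const {g} 0) (λ γ v → ≤-trans (sz-tail b v) (m≤m+n _ 0)) p q

powₚ : ∀ {g n} c → PT g 𝕟 n → PT g 𝕟 (λ γ → n γ ^ c)
powₚ zero    p = sucₚ zeroₚ
powₚ (suc c) p = p *ₚ powₚ c p

-- Binary arithmetic

bit : Bool → ℕ
bit false = 0
bit true  = 1

-- Binary numbers, least significant bit first.
val : List Bool → ℕ
val []      = 0
val (b ∷ l) = bit b + 2 * val l

maj xor3 : Bool → Bool → Bool → Bool
maj  a b c = cond a (cond b true c) (cond b c false)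
xor3 a b c = cond a (cond b c (not c)) (cond b (not c) c)

full-adder : ∀ a b c → bit (xor3 a b c) + 2 * bit (maj a b c) ≡ bit a + bit b + bit c
full-adder true  true  true  = refl
full-adder true  true  false = refl
full-adder true  false true  = refl
full-adder true  false false = refl
full-adder false true  true  = refl
full-adder false true  false = refl
full-adder false false true  = refl
full-adder false false false = refl

Num : Ty
Num = 𝕃 𝔹

hdb : List Bool → Bool
hdb = headOr false

hdbₚ : ∀ {g l} → PT g Num l → PT g 𝔹 (λ γ → hdb (l γ))
hdbₚ p = headₚ false refl ⊚ p

tlₚ : ∀ {g b l} → PT g (𝕃 b) l → PT g (𝕃 b) (λ γ → tail (l γ))
tlₚ p = tailₚ ⊚ p

val-hd-tail : ∀ l → val l ≡ bit (hdb l) + 2 * val (tail l)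
val-hd-tail []      = refl
val-hd-tail (b ∷ l) = refl

-- Ripple-carry addition with a prescribed number of digits. Since `hdb` and `tail` are total, the
-- shorter number is padded with zeros, and the function becomes a plain iteration of `addStep`.
addBits : ℕ → List Bool → List Bool → Bool → List Bool
addBits zero    as bs c = c ∷ []
addBits (suc n) as bs c = xor3 (hdb as) (hdb bs) c ∷ addBits n (tail as) (tail bs) (maj (hdb as) (hdb bs) c)

length-tail : ∀ {X : Set} (l : List X) {n} → length l ≤ suc n → length (tail l) ≤ n
length-tail []      _        = z≤n
length-tail (x ∷ l) (s≤s le) = le

val-addBits : ∀ n as bs c → length as ≤ n → length bs ≤ n → val (addBits n as bs c) ≡ val as + val bs + bit c
val-addBits zero    []  []  c _ _ = +-identityʳ (bit c)
val-addBits (suc n) as bs c p q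
  rewrite val-addBits n (tail as) (tail bs) (maj (hdb as) (hdb bs) c) (length-tail as p) (length-tail bs q)
        | val-hd-tail as | val-hd-tail bs =
  trans (eq₁ (bit (xor3 (hdb as) (hdb bs) c)) (val (tail as)) (val (tail bs)) (bit (maj (hdb as) (hdb bs) c)))
    (trans (cong (_+ (2 * val (tail as) + 2 * val (tail bs))) (full-adder (hdb as) (hdb bs) c))
      (eq₂ (bit (hdb as)) (bit (hdb bs)) (bit c) (val (tail as)) (val (tail bs))))
  where
  eq₁ : ∀ x p q m → x + 2 * (p + q + m) ≡ (x + 2 * m) + (2 * p + 2 * q)
  eq₁ = solve-∀
  eq₂ : ∀ a b c p q → (a + b + c) + (2 * p + 2 * q) ≡ a + 2 * p + (b + 2 * q) + c
  eq₂ = solve-∀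

length-addBits : ∀ n as bs c → length (addBits n as bs c) ≡ suc n
length-addBits zero    as bs c = refl
length-addBits (suc n) as bs c = cong suc (length-addBits n _ _ _)

maxlen : List Bool → List Bool → ℕ
maxlen as bs = length as + (length bs ∸ length as)

add : List Bool → List Bool → List Bool
add as bs = addBits (maxlen as bs) as bs false

val-add : ∀ as bs → val (add as bs) ≡ val as + val bs
val-add as bs = trans (val-addBits (maxlen as bs) as bs false (m≤m+n _ _) (m≤n+m∸n (length bs) (length as))) (+-identityʳ _)

sz-𝔹 : ∀ b → sz 𝔹 b ≤ 3
sz-𝔹 true  = ≤-refl
sz-𝔹 false = s≤s z≤n

1≤sz : ∀ a x → 1 ≤ sz a x
1≤sz a x = size-pos (enc a x)

sz-Num : ∀ l → sz Num l ≤ 4 * length l + 1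
sz-Num []      = ≤-refl
sz-Num (b ∷ l) = ≤-trans (s≤s (+-mono-≤ (sz-𝔹 b) (sz-Num l))) (≤-reflexive (eq (length l)))
  where
  eq : ∀ n → suc (3 + (4 * n + 1)) ≡ 4 * suc n + 1
  eq = solve-∀

AddState : Ty
AddState = Num ⊗ Num ⊗ 𝔹 ⊗ Num

addStep : ⟦ AddState ⟧ᵗ → ⟦ AddState ⟧ᵗ
addStep (as , bs , c , out) = tail as , tail bs , maj (hdb as) (hdb bs) c , xor3 (hdb as) (hdb bs) c ∷ out

addResult : ⟦ AddState ⟧ᵗ → List Bool
addResult (as , bs , c , out) = reverse (c ∷ out)

addIter : ∀ n as bs c out → addResult (iter n addStep (as , bs , c , out)) ≡ out ʳ++ addBits n as bs c
addIter zero    as bs c out = refl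
addIter (suc n) as bs c out = addIter n _ _ _ _

majₚ : ∀ {g f₁ f₂ f₃} → PT g 𝔹 f₁ → PT g 𝔹 f₂ → PT g 𝔹 f₃ → PT g 𝔹 (λ γ → maj (f₁ γ) (f₂ γ) (f₃ γ))
majₚ a b c = ifₚ a (ifₚ b trueₚ c) (ifₚ b c falseₚ)

xor3ₚ : ∀ {g f₁ f₂ f₃} → PT g 𝔹 f₁ → PT g 𝔹 f₂ → PT g 𝔹 f₃ → PT g 𝔹 (λ γ → xor3 (f₁ γ) (f₂ γ) (f₃ γ))
xor3ₚ a b c = ifₚ a (ifₚ b c (notₚ c)) (ifₚ b (notₚ c) c)

addStepₚ : PT AddState AddState addStep
addStepₚ = tlₚ π₁ & tlₚ (π₁ ⊚ π₂) & majₚ a b c & (xor3ₚ a b c ∷ₚ (π₂ ⊚ π₂ ⊚ π₂))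
  where
  a = hdbₚ {AddState} π₁
  b = hdbₚ {AddState} (π₁ ⊚ π₂)
  c : PT AddState 𝔹 (λ p → proj₁ (proj₂ (proj₂ p)))
  c = π₁ ⊚ π₂ ⊚ π₂

addStep-growth : ∀ p → sz AddState (addStep p) ≤ sz AddState p + 6
addStep-growth (as , bs , c , out) =
  ≤-trans (s≤s (+-mono-≤ (sz-tail 𝔹 as) (s≤s (+-mono-≤ (sz-tail 𝔹 bs) (s≤s (+-mono-≤ (≤-trans (sz-𝔹 m) (+-monoʳ-≤ 2 (1≤sz 𝔹 c))) (s≤s (+-monoˡ-≤ (sz Num out) (sz-𝔹 x)))))))))
    (≤-reflexive (eq (sz Num as) (sz Num bs) (sz 𝔹 c) (sz Num out)))
  where
  m = maj (hdb as) (hdb bs) c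
  x = xor3 (hdb as) (hdb bs) c
  eq : ∀ a b c o → suc (a + suc (b + suc (2 + c + suc (3 + o)))) ≡ suc (a + suc (b + suc (c + o))) + 6
  eq = solve-∀

maxlenₚ : ∀ {g l₁ l₂} → PT g Num l₁ → PT g Num l₂ → PT g 𝕟 (λ γ → maxlen (l₁ γ) (l₂ γ))
maxlenₚ p q = (lengthₚ ⊚ p) +ₚ ((lengthₚ ⊚ q) ∸ₚ (lengthₚ ⊚ p))

opaque
  addₚ : ∀ {g l₁ l₂} → PT g Num l₁ → PT g Num l₂ → PT g Num (λ γ → add (l₁ γ) (l₂ γ))
  addₚ {g} {l₁} {l₂} p q = ext (λ γ → addIter (maxlen (l₁ γ) (l₂ γ)) (l₁ γ) (l₂ γ) false [])
    ((reverseₚ ⊚ ((π₁ ⊚ π₂ ⊚ π₂) ∷ₚ (π₂ ⊚ π₂ ⊚ π₂))) ⊚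
     iter-add {g} {AddState} (addStepₚ ⊚ π₂) (λ _ → 6) (bounded-const {g} 6) (λ γ v → addStep-growth v) (maxlenₚ p q) (p & q & falseₚ & []ₚ))

LeqState : Ty
LeqState = Num ⊗ Num ⊗ 𝔹

-- Digits arrive least significant first, so a later difference overrides the verdict `r` about the
-- earlier ones.
leqStep : ⟦ LeqState ⟧ᵗ → ⟦ LeqState ⟧ᵗ
leqStep (as , bs , r) = tail as , tail bs , cond (hdb as) (cond (hdb bs) r false) (cond (hdb bs) true r)

leqB : List Bool → List Bool → Bool
leqB as bs = proj₂ (proj₂ (iter (maxlen as bs) leqStep (as , bs , true)))

leqStepₚ : PT LeqState LeqState leqStep
leqStepₚ = tlₚ π₁ & tlₚ (π₁ ⊚ π₂) & ifₚ a (ifₚ b r falseₚ) (ifₚ b trueₚ r)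
  where
  a = hdbₚ {LeqState} π₁
  b = hdbₚ {LeqState} (π₁ ⊚ π₂)
  r : PT LeqState 𝔹 (λ p → proj₂ (proj₂ p))
  r = π₂ ⊚ π₂

leqStep-growth : ∀ p → sz LeqState (leqStep p) ≤ sz LeqState p + 2
leqStep-growth (as , bs , r) =
  ≤-trans (s≤s (+-mono-≤ (sz-tail 𝔹 as) (s≤s (+-mono-≤ (sz-tail 𝔹 bs) (≤-trans (sz-𝔹 x) (+-monoʳ-≤ 2 (1≤sz 𝔹 r)))))))
    (≤-reflexive (eq (sz Num as) (sz Num bs) (sz 𝔹 r)))
  where
  x = cond (hdb as) (cond (hdb bs) r false) (cond (hdb bs) true r)
  eq : ∀ a b c → suc (a + suc (b + (2 + c))) ≡ suc (a + suc (b + c)) + 2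
  eq = solve-∀

opaque
  leqBₚ : ∀ {g l₁ l₂} → PT g Num l₁ → PT g Num l₂ → PT g 𝔹 (λ γ → leqB (l₁ γ) (l₂ γ))
  leqBₚ {g} p q = π₂ ⊚ π₂ ⊚ iter-add {g} {LeqState} (leqStepₚ ⊚ π₂) (λ _ → 2) (bounded-const {g} 2) (λ γ v → leqStep-growth v) (maxlenₚ p q) (p & q & trueₚ)

-- The third component compares the bits read so far; `bit (not r)` is what they require of the remaining ones.
Compared : ℕ → ℕ → Bool → Bool → Set
Compared m n r true  = m + bit (not r) ≤ n
Compared m n r false = n < m + bit (not r)

compare-step : ∀ a b r m n s → Compared m n (cond a (cond b r false) (cond b true r)) s → Compared (bit a + 2 * m) (bit b + 2 * n) r s
compare-step a b r m n s = go a b r s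
  where
  above : ∀ α β d d′ → α + d ≤ β + 2 * d′ → m + d′ ≤ n → α + 2 * m + d ≤ β + 2 * n
  above α β d d′ c h = ≤-trans (≤-reflexive (e₁ α m d)) (≤-trans (+-monoˡ-≤ (2 * m) c) (≤-trans (≤-reflexive (e₂ β d′ m)) (+-monoʳ-≤ β (*-monoʳ-≤ 2 h))))
    where
    e₁ : ∀ α m d → α + 2 * m + d ≡ α + d + 2 * m
    e₁ = solve-∀
    e₂ : ∀ β d m → β + 2 * d + 2 * m ≡ β + 2 * (m + d)
    e₂ = solve-∀
  below : ∀ α β d d′ → β + 1 + 2 * d′ ≤ α + d + 2 → n < m + d′ → β + 2 * n < α + 2 * m + d
  below α β d d′ c h = +-cancelʳ-≤ 2 _ _ (≤-trans (≤-reflexive (e₁ β n)) (≤-trans (+-monoʳ-≤ (β + 1) (*-monoʳ-≤ 2 h))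
      (≤-trans (≤-reflexive (e₂ β m d′)) (≤-trans (+-monoˡ-≤ (2 * m) c) (≤-reflexive (e₃ α m d))))))
    where
    e₁ : ∀ β n → suc (β + 2 * n) + 2 ≡ β + 1 + 2 * suc n
    e₁ = solve-∀
    e₂ : ∀ β m d → β + 1 + 2 * (m + d) ≡ β + 1 + 2 * d + 2 * m
    e₂ = solve-∀
    e₃ : ∀ α m d → α + d + 2 + 2 * m ≡ α + 2 * m + d + 2
    e₃ = solve-∀
  go : ∀ a b r s → Compared m n (cond a (cond b r false) (cond b true r)) s → Compared (bit a + 2 * m) (bit b + 2 * n) r s
  go true  true  true  true  = above 1 1 0 0 (≤ᵇ⇒≤ _ _ tt)
  go true  true  false true  = above 1 1 1 1 (≤ᵇ⇒≤ _ _ tt)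
  go true  true  true  false = below 1 1 0 0 (≤ᵇ⇒≤ _ _ tt)
  go true  true  false false = below 1 1 1 1 (≤ᵇ⇒≤ _ _ tt)
  go true  false true  true  = above 1 0 0 1 (≤ᵇ⇒≤ _ _ tt)
  go true  false false true  = above 1 0 1 1 (≤ᵇ⇒≤ _ _ tt)
  go true  false true  false = below 1 0 0 1 (≤ᵇ⇒≤ _ _ tt)
  go true  false false false = below 1 0 1 1 (≤ᵇ⇒≤ _ _ tt)
  go false true  true  true  = above 0 1 0 0 (≤ᵇ⇒≤ _ _ tt)
  go false true  false true  = above 0 1 1 0 (≤ᵇ⇒≤ _ _ tt)
  go false true  true  false = below 0 1 0 0 (≤ᵇ⇒≤ _ _ tt)
  go false true  false false = below 0 1 1 0 (≤ᵇ⇒≤ _ _ tt)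
  go false false true  true  = above 0 0 0 0 (≤ᵇ⇒≤ _ _ tt)
  go false false false true  = above 0 0 1 1 (≤ᵇ⇒≤ _ _ tt)
  go false false true  false = below 0 0 0 0 (≤ᵇ⇒≤ _ _ tt)
  go false false false false = below 0 0 1 1 (≤ᵇ⇒≤ _ _ tt)

compared-refl : ∀ r → Compared 0 0 r r
compared-refl true  = z≤n
compared-refl false = s≤s z≤n

leqB-compares : ∀ n as bs r → length as ≤ n → length bs ≤ n → Compared (val as) (val bs) r (proj₂ (proj₂ (iter n leqStep (as , bs , r))))
leqB-compares zero    [] [] r _ _ = compared-refl r
leqB-compares (suc n) as bs r p q rewrite val-hd-tail as | val-hd-tail bs =
  compare-step (hdb as) (hdb bs) r (val (tail as)) (val (tail bs)) _ (leqB-compares n (tail as) (tail bs) _ (length-tail as p) (length-tail bs q))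

leqB-true : ∀ as bs → leqB as bs ≡ true → val as ≤ val bs
leqB-true as bs e with leqB as bs | leqB-compares (maxlen as bs) as bs true (m≤m+n _ _) (m≤n+m∸n (length bs) (length as))
... | true | h = ≤-trans (m≤m+n _ 0) h

leqB-false : ∀ as bs → leqB as bs ≡ false → val bs < val as
leqB-false as bs e with leqB as bs | leqB-compares (maxlen as bs) as bs true (m≤m+n _ _) (m≤n+m∸n (length bs) (length as))
... | false | h = ≤-trans h (≤-reflexive (+-identityʳ _))

mul : List Bool → List Bool → List Bool
mul w p = foldr (λ b acc → add (false ∷ acc) (cond b p [])) [] w

val-mul : ∀ w p → val (mul w p) ≡ val w * val p
val-mul []      p = refl
val-mul (b ∷ w) p = trans (val-add (false ∷ mul w p) (cond b p [])) (trans (cong₂ (λ x y → 2 * x + y) (val-mul w p) (val-cond b)) (eq (bit b) (val w) (val p)))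
  where
  val-cond : ∀ b → val (cond b p []) ≡ bit b * val p
  val-cond true  = sym (+-identityʳ _)
  val-cond false = refl
  eq : ∀ b w p → 2 * (w * p) + b * p ≡ (b + 2 * w) * p
  eq = solve-∀

length-add : ∀ as bs {n} → length as ≤ n → length bs ≤ n → length (add as bs) ≤ suc n
length-add as bs {n} p q rewrite length-addBits (maxlen as bs) as bs false = s≤s max≤
  where
  max≤ : maxlen as bs ≤ n
  max≤ with ≤-total (length as) (length bs)
  ... | inj₁ le = ≤-trans (≤-reflexive (m+[n∸m]≡n le)) q
  ... | inj₂ le = ≤-trans (≤-reflexive (trans (cong (length as +_) (m≤n⇒m∸n≡0 le)) (+-identityʳ _))) p

length-cond : ∀ b (p : List Bool) → length (cond b p []) ≤ length p
length-cond true  p = ≤-refl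
length-cond false p = z≤n

-- `add` keeps leading zeros, so each digit of `w` costs one digit for the doubling and one for the
-- carry. The asymmetry matters: a short first factor lengthens the second one only by an additive
-- term.
length-mul : ∀ w p → length (mul w p) ≤ length p + 2 * length w
length-mul []      p = z≤n
length-mul (b ∷ w) p = ≤-trans (length-add (false ∷ mul w p) (cond b p []) (s≤s (length-mul w p))
    (≤-trans (length-cond b p) (≤-trans (m≤m+n _ _) (n≤1+n _)))) (≤-reflexive (eq (length p) (length w)))
  where
  eq : ∀ p w → suc (suc (p + 2 * w)) ≡ p + 2 * suc w
  eq = solve-∀

length-≤-sz : ∀ l → 2 * length l + 1 ≤ sz Num l
length-≤-sz []      = ≤-refl
length-≤-sz (b ∷ l) = ≤-trans (≤-reflexive (eq (length l))) (s≤s (+-mono-≤ (1≤sz 𝔹 b) (length-≤-sz l)))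
  where
  eq : ∀ n → 2 * suc n + 1 ≡ suc (1 + (2 * n + 1))
  eq = solve-∀

opaque
  mulₚ : ∀ {g l₁ l₂} → PT g Num l₁ → PT g Num l₂ → PT g Num (λ γ → mul (l₁ γ) (l₂ γ))
  mulₚ {g} {l₁} {l₂} p q = foldr-bounded {g} {𝔹} {Num} (addₚ (falseₚ ∷ₚ (π₂ ⊚ π₂)) (ifₚ (π₁ ⊚ π₂) (q ⊚ π₁) []ₚ)) p []ₚ
    (λ γ → 4 * (sz Num (l₂ γ) + 2 * sz Num (l₁ γ)) + 1)
    (bounded-+ {g} (bounded-* {g} (bounded-const {g} 4) (bounded-+ {g} (size-bound q) (bounded-* {g} (bounded-const {g} 2) (size-bound p)))) (bounded-const {g} 1))
    (λ γ zs ys eq → ≤-trans (sz-Num (mul ys (l₂ γ))) (+-monoˡ-≤ 1 (*-monoʳ-≤ 4 (≤-trans (length-mul ys (l₂ γ))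
      (+-mono-≤ (length≤sz 𝔹 (l₂ γ)) (*-monoʳ-≤ 2 (≤-trans (≤-trans (m≤n+m _ (length zs)) (≤-reflexive (trans (sym (length-++ zs)) (cong length eq)))) (length≤sz 𝔹 (l₁ γ)))))))))

binc : List Bool → List Bool
binc []          = true ∷ []
binc (false ∷ l) = true ∷ l
binc (true ∷ l)  = false ∷ binc l

incStep : Bool → Bool × List Bool → Bool × List Bool
incStep b (c , out) = cond c b false , xor3 b c false ∷ out

incEnd : Bool × List Bool → List Bool
incEnd (c , out) = reverse (cond c (true ∷ out) out)

inc-idle : ∀ l out → incEnd (foldl (λ v b → incStep b v) (false , out) l) ≡ out ʳ++ l
inc-idle []          out = refl
inc-idle (true ∷ l)  out = inc-idle l (true ∷ out)
inc-idle (false ∷ l) out = inc-idle l (false ∷ out)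

inc-fold : ∀ l out → incEnd (foldl (λ v b → incStep b v) (true , out) l) ≡ out ʳ++ binc l
inc-fold []          out = refl
inc-fold (true ∷ l)  out = inc-fold l (false ∷ out)
inc-fold (false ∷ l) out = inc-idle l (true ∷ out)

opaque
  bincₚ : PT Num Num binc
  bincₚ = ext (λ l → inc-fold l [])
    ((reverseₚ ⊚ ifₚ π₁ (trueₚ ∷ₚ π₂) π₂) ⊚
     fold-add {Num} {𝔹} {𝔹 ⊗ Num} (ifₚ c b falseₚ & (xor3ₚ b c falseₚ ∷ₚ (π₂ ⊚ π₂ ⊚ π₂))) (λ _ → 6) (bounded-const {Num ⊗ 𝔹} 6) growth var (trueₚ & []ₚ))
    where
    c : PT (Num ⊗ 𝔹 ⊗ 𝔹 ⊗ Num) 𝔹 (λ p → proj₁ (proj₂ (proj₂ p)))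
    c = π₁ ⊚ π₂ ⊚ π₂
    b : PT (Num ⊗ 𝔹 ⊗ 𝔹 ⊗ Num) 𝔹 (λ p → proj₁ (proj₂ p))
    b = π₁ ⊚ π₂
    growth : ∀ (γ : List Bool) e v → sz (𝔹 ⊗ Num) (incStep e v) ≤ sz (𝔹 ⊗ Num) v + 6
    growth γ e (c , out) = ≤-trans (s≤s (+-mono-≤ (≤-trans (sz-𝔹 (cond c e false)) (+-monoʳ-≤ 2 (1≤sz 𝔹 c))) (s≤s (+-monoˡ-≤ (sz Num out) (sz-𝔹 (xor3 e c false))))))
      (≤-reflexive (eq (sz 𝔹 c) (sz Num out)))
      where
      eq : ∀ c o → suc (2 + c + suc (3 + o)) ≡ suc (c + o) + 6
      eq = solve-∀

toBits : ℕ → List Bool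
toBits n = iter n binc []

val-binc : ∀ l → val (binc l) ≡ suc (val l)
val-binc []          = refl
val-binc (false ∷ l) = refl
val-binc (true ∷ l)  = trans (cong (2 *_) (val-binc l)) (*-distribˡ-+ 2 1 (val l))

length-binc : ∀ l → length (binc l) ≤ suc (length l)
length-binc []          = ≤-refl
length-binc (false ∷ l) = n≤1+n _
length-binc (true ∷ l)  = s≤s (length-binc l)

iter-snoc : ∀ {X : Set} n (f : X → X) v → iter n f (f v) ≡ f (iter n f v)
iter-snoc zero    f v = refl
iter-snoc (suc n) f v = iter-snoc n f (f v)

toBits-suc : ∀ n → toBits (suc n) ≡ binc (toBits n)
toBits-suc n = iter-snoc n binc []

length-toBits : ∀ n → length (toBits n) ≤ n
length-toBits zero    = z≤n
length-toBits (suc n) = ≤-trans (≤-reflexive (cong length (toBits-suc n))) (≤-trans (length-binc (toBits n)) (s≤s (length-toBits n)))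

val-toBits : ∀ n → val (toBits n) ≡ n
val-toBits zero    = refl
val-toBits (suc n) = trans (cong val (toBits-suc n)) (trans (val-binc (toBits n)) (cong suc (val-toBits n)))

opaque
  toBitsₚ : ∀ {g n} → PT g 𝕟 n → PT g Num (λ γ → toBits (n γ))
  toBitsₚ {g} {n} p = iter-bounded {g} {Num} (bincₚ ⊚ π₂) p []ₚ (λ γ → 4 * sz 𝕟 (n γ) + 1)
    (bounded-+ {g} (bounded-* {g} (bounded-const {g} 4) (size-bound p)) (bounded-const {g} 1))
    (λ γ i le → ≤-trans (sz-Num (toBits i)) (+-monoˡ-≤ 1 (*-monoʳ-≤ 4 (≤-trans (length-toBits i) (≤-trans le (n≤sz-𝕟 (n γ)))))))
    where
    n≤sz-𝕟 : ∀ n → n ≤ sz 𝕟 n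
    n≤sz-𝕟 n = ≤-trans (≤-trans (m≤m+n n _) (m≤m+n (2 * n) 1)) (≤-reflexive (sym (sz-𝕟 n)))

-- Two increments restore the lowest digit and send exactly one carry to the next.
iter-binc-2 : ∀ n b l → iter (n * 2) binc (b ∷ l) ≡ b ∷ iter n binc l
iter-binc-2 zero    b     l = refl
iter-binc-2 (suc n) true  l = iter-binc-2 n true (binc l)
iter-binc-2 (suc n) false l = iter-binc-2 n false (binc l)

toBits-odd : ∀ n → toBits (suc (n * 2)) ≡ true ∷ toBits n
toBits-odd n = iter-binc-2 n true []

toBits-even : ∀ n → toBits (suc n * 2) ≡ false ∷ toBits (suc n)
toBits-even n = iter-binc-2 n false (true ∷ [])

toBits-cons : ∀ b n → toBits n ≢ [] → b ∷ toBits n ≡ toBits (bit b + n * 2)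
toBits-cons true  n       _ = sym (toBits-odd n)
toBits-cons false zero    h = ⊥-elim (h refl)
toBits-cons false (suc n) _ = sym (toBits-even n)

-- Exactly the words ending in a `true` (the leading bit) are binary representations.
toBits-onto : ∀ l → ∃ λ n → toBits n ≡ l ++ true ∷ []
toBits-onto []      = 1 , refl
toBits-onto (b ∷ l) with toBits-onto l
... | n , e = bit b + n * 2 , trans (sym (toBits-cons b n (λ z → snoc≢[] l (trans (sym e) z)))) (cong (b ∷_) e)
  where
  snoc≢[] : ∀ (l : List Bool) → l ++ true ∷ [] ≢ []
  snoc≢[] [] ()
  snoc≢[] (_ ∷ _) ()

binaryRev-toBits : ∀ f n → n ≤ f → binaryRev f n ≡ toBits n
binaryRev-toBits zero    zero    _  = refl
binaryRev-toBits (suc f) zero    _  = refl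
binaryRev-toBits (suc f) (suc n) (s≤s le) = trans (cong ((suc n % 2 Data.Nat.≡ᵇ 1) ∷_) (binaryRev-toBits f (suc n / 2) (≤-trans half≤ le)))
    (digit (suc n % 2) (suc n / 2) (m%n<n (suc n) 2) (m≡m%n+[m/n]*n (suc n) 2))
  where
  half≤ : suc n / 2 ≤ n
  half≤ = ≤-pred (m/n<m (suc n) 2 (s≤s (s≤s z≤n)))
  digit : ∀ r q → r < 2 → suc n ≡ r + q * 2 → (r Data.Nat.≡ᵇ 1) ∷ toBits q ≡ toBits (suc n)
  digit zero          (suc q) _ e = trans (sym (toBits-even q)) (cong toBits (sym e))
  digit (suc zero)    q       _ e = trans (sym (toBits-odd q)) (cong toBits (sym e))
  digit (suc (suc r)) q (s≤s (s≤s ())) e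

binary-toBits : ∀ n → binary n ≡ reverse (toBits n)
binary-toBits n = cong reverse (binaryRev-toBits n n ≤-refl)

-- The universal machine

hd0 : List ℕ → ℕ
hd0 = headOr 0

hd0ₚ : ∀ {g l} → PT g (𝕃 𝕟) l → PT g 𝕟 (λ γ → hd0 (l γ))
hd0ₚ p = headₚ 0 refl ⊚ p

-- A table holds three numbers (next state, symbol, move) per state and symbol.
-- States are represented by the offset of their block, and a symbol ≥ 4 means halting.
Cfg : Ty
Cfg = 𝕟 ⊗ 𝕃 𝕟 ⊗ 𝕃 𝕟

Table : Ty
Table = 𝕃 𝕟

-- Absent cells and absent table entries read as 0, the number of the blank symbol. Hence the step
-- is total, and every word, meaningful or not, codes some table.
apply : List ℕ → ⟦ Cfg ⟧ᵗ → ⟦ Cfg ⟧ᵗ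
apply t (q , ls , rs) =
  cond (leq 4 (hd0 (tail t))) (q , ls , rs)
    (cond (leq 2 (hd0 (tail (tail t)))) (hd0 t , ls , hd0 (tail t) ∷ tail rs)
      (cond (nonzero (hd0 (tail (tail t)))) (hd0 t , hd0 (tail t) ∷ ls , tail rs)
        (hd0 t , tail ls , hd0 ls ∷ hd0 (tail t) ∷ tail rs)))

instruction : List ℕ → ⟦ Cfg ⟧ᵗ → List ℕ
instruction tb (q , ls , rs) = iter (q + 3 * hd0 rs) tail tb

ustep : List ℕ → ⟦ Cfg ⟧ᵗ → ⟦ Cfg ⟧ᵗ
ustep tb c = apply (instruction tb c) c

opaque
  applyₚ : PT (Table ⊗ Cfg) Cfg (λ p → apply (proj₁ p) (proj₂ p))
  applyₚ = ifₚ (leqₚ (constP 𝕟 4) s) π₂ (ifₚ (leqₚ (constP 𝕟 2) m) (q & ls & (s ∷ₚ tlₚ rs)) (ifₚ (nonzeroₚ ⊚ m) (q & (s ∷ₚ ls) & tlₚ rs) (q & tlₚ ls & (hd0ₚ ls ∷ₚ s ∷ₚ tlₚ rs))))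
    where
    ls : PT (Table ⊗ Cfg) (𝕃 𝕟) (λ p → proj₁ (proj₂ (proj₂ p)))
    ls = π₁ ⊚ π₂ ⊚ π₂
    rs : PT (Table ⊗ Cfg) (𝕃 𝕟) (λ p → proj₂ (proj₂ (proj₂ p)))
    rs = π₂ ⊚ π₂ ⊚ π₂
    q : PT (Table ⊗ Cfg) 𝕟 (λ p → hd0 (proj₁ p))
    q = hd0ₚ {Table ⊗ Cfg} π₁
    s : PT (Table ⊗ Cfg) 𝕟 (λ p → hd0 (tail (proj₁ p)))
    s = hd0ₚ {Table ⊗ Cfg} (tlₚ π₁)
    m : PT (Table ⊗ Cfg) 𝕟 (λ p → hd0 (tail (tail (proj₁ p))))
    m = hd0ₚ {Table ⊗ Cfg} (tlₚ (tlₚ π₁))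

opaque
  ustepₚ : PT (Table ⊗ Cfg) Cfg (λ p → ustep (proj₁ p) (proj₂ p))
  ustepₚ = applyₚ ⊚ (dropₚ ((π₁ ⊚ π₂) +ₚ (constP 𝕟 3 *ₚ hd0ₚ (π₂ ⊚ π₂ ⊚ π₂))) π₁ & π₂)

sz-hd0 : ∀ l → sz 𝕟 (hd0 l) ≤ sz (𝕃 𝕟) l
sz-hd0 []      = ≤-refl
sz-hd0 (x ∷ l) = ≤-trans (m≤m+n _ _) (n≤1+n _)

sz-drop : ∀ n l → sz (𝕃 𝕟) (iter n tail l) ≤ sz (𝕃 𝕟) l
sz-drop zero    l = ≤-refl
sz-drop (suc n) l = ≤-trans (sz-drop n (tail l)) (sz-tail 𝕟 l)

sz-hd-tail : ∀ l → sz 𝕟 (hd0 l) + sz (𝕃 𝕟) (tail l) ≤ sz (𝕃 𝕟) l + 1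
sz-hd-tail []      = ≤-refl
sz-hd-tail (x ∷ l) = ≤-trans (n≤1+n _) (m≤m+n _ 1)

cond-≤ : ∀ {X : Set} (f : X → ℕ) b {x y n} → f x ≤ n → f y ≤ n → f (cond b x y) ≤ n
cond-≤ f true  p q = p
cond-≤ f false p q = q

-- The new state and the written symbol are copied from the table, whose size bounds both.
apply-growth : ∀ t c → sz Cfg (apply t c) ≤ sz Cfg c + (2 * sz Table t + 4)
apply-growth t (q , ls , rs) = cond-≤ (sz Cfg) (leq 4 (hd0 (tail t))) (m≤m+n _ _)
  (cond-≤ (sz Cfg) (leq 2 (hd0 (tail (tail t)))) stay (cond-≤ (sz Cfg) (nonzero (hd0 (tail (tail t)))) right left))
  where
  T = sz Table t
  hq : sz 𝕟 (hd0 t) ≤ T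
  hq = sz-hd0 t
  hs : sz 𝕟 (hd0 (tail t)) ≤ T
  hs = ≤-trans (sz-hd0 (tail t)) (sz-tail 𝕟 t)
  ht : sz (𝕃 𝕟) (tail rs) ≤ sz (𝕃 𝕟) rs
  ht = sz-tail 𝕟 rs
  l = sz (𝕃 𝕟) ls
  r = sz (𝕃 𝕟) rs
  e₁ : ∀ T l r q → suc (T + suc (l + suc (T + r))) + (q + 3) ≡ suc (q + suc (l + r)) + (2 * T + 4)
  e₁ = solve-∀
  e₂ : ∀ T l r q → suc (T + suc (suc (T + l) + r)) + (q + 3) ≡ suc (q + suc (l + r)) + (2 * T + 4)
  e₂ = solve-∀
  e₃ : ∀ T h tl r → suc (T + suc (tl + suc (h + suc (T + r)))) ≡ suc (suc (suc (suc (h + tl + (2 * T + r)))))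
  e₃ = solve-∀
  e₄ : ∀ T l r q → suc (suc (suc (suc (l + 1 + (2 * T + r))))) + (q + 1) ≡ suc (q + suc (l + r)) + (2 * T + 4)
  e₄ = solve-∀
  bound = sz Cfg (q , ls , rs) + (2 * T + 4)
  stay : sz Cfg (hd0 t , ls , hd0 (tail t) ∷ tail rs) ≤ bound
  stay = ≤-trans (s≤s (+-mono-≤ hq (s≤s (+-monoʳ-≤ l (s≤s (+-mono-≤ hs ht)))))) (m+k≡n⇒m≤n (sz 𝕟 q + 3) (e₁ T l r (sz 𝕟 q)))
  right : sz Cfg (hd0 t , hd0 (tail t) ∷ ls , tail rs) ≤ bound
  right = ≤-trans (s≤s (+-mono-≤ hq (s≤s (+-mono-≤ (s≤s (+-monoˡ-≤ l hs)) ht)))) (m+k≡n⇒m≤n (sz 𝕟 q + 3) (e₂ T l r (sz 𝕟 q)))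
  left : sz Cfg (hd0 t , tail ls , hd0 ls ∷ hd0 (tail t) ∷ tail rs) ≤ bound
  left = ≤-trans (s≤s (+-mono-≤ hq (s≤s (+-monoʳ-≤ (sz (𝕃 𝕟) (tail ls)) (s≤s (+-monoʳ-≤ (sz 𝕟 (hd0 ls)) (s≤s (+-mono-≤ hs ht))))))))
    (≤-trans (≤-reflexive (e₃ T (sz 𝕟 (hd0 ls)) (sz (𝕃 𝕟) (tail ls)) r))
      (≤-trans (s≤s (s≤s (s≤s (s≤s (+-monoˡ-≤ (2 * T + r) (sz-hd-tail ls)))))) (m+k≡n⇒m≤n (sz 𝕟 q + 1) (e₄ T l r (sz 𝕟 q)))))

ustep-growth : ∀ tb c → sz Cfg (ustep tb c) ≤ sz Cfg c + (2 * sz Table tb + 4)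
ustep-growth tb c@(q , ls , rs) = ≤-trans (apply-growth (instruction tb c) c) (+-monoʳ-≤ (sz Cfg c) (+-monoˡ-≤ 4 (*-monoʳ-≤ 2 (sz-drop (q + 3 * hd0 rs) tb))))

simulate : List ℕ → ℕ → List ℕ → ⟦ Cfg ⟧ᵗ
simulate tb t x = iter t (ustep tb) (0 , [] , x)

opaque
  simulateₚ : ∀ {g tb t x} → PT g Table tb → PT g 𝕟 t → PT g (𝕃 𝕟) x → PT g Cfg (λ γ → simulate (tb γ) (t γ) (x γ))
  simulateₚ {g} {tb} p q r = iter-add {g} {Cfg} (ustepₚ ⊚ ((p ⊚ π₁) & π₂)) (λ γ → 2 * sz Table (tb γ) + 4)
    (bounded-+ {g} (bounded-* {g} (bounded-const {g} 2) (size-bound p)) (bounded-const {g} 4)) (λ γ v → ustep-growth (tb γ) v) q (zeroₚ & []ₚ & r)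

-- Splits an output into the bits before and after the separator, last bit first.
Parse : Ty
Parse = 𝕟 ⊗ Num ⊗ Num

-- Phase 0 collects the numerator, phase 1 the denominator; phase 2, entered at a blank or a second
-- separator, ignores the rest. Outputs have the most significant bit first, so consing yields the
-- digit order of `val`.
parseStep : ℕ → ⟦ Parse ⟧ᵗ → ⟦ Parse ⟧ᵗ
parseStep a (ph , n , d) =
  cond (leq 2 ph) (ph , n , d)
    (cond (nonzero a)
      (cond (leq 3 a) (suc ph , n , d) (cond (nonzero ph) (ph , n , leq 2 a ∷ d) (ph , leq 2 a ∷ n , d)))
      (2 , n , d))

parse : List ℕ → ⟦ Num ⊗ Num ⟧ᵗ
parse l = proj₂ (foldl (λ v a → parseStep a v) (0 , [] , []) l)

parseStepₚ : ∀ {g} → PT (g ⊗ 𝕟 ⊗ Parse) Parse (λ p → parseStep (proj₁ (proj₂ p)) (proj₂ (proj₂ p)))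
parseStepₚ {g} = ifₚ (leqₚ (constP 𝕟 2) ph) (π₂ ⊚ π₂) (ifₚ (nonzeroₚ ⊚ a)
    (ifₚ (leqₚ (constP 𝕟 3) a) (sucₚ ph & n & d) (ifₚ (nonzeroₚ ⊚ ph) (ph & n & (b ∷ₚ d)) (ph & (b ∷ₚ n) & d)))
    (constP 𝕟 2 & n & d))
  where
  c = g ⊗ 𝕟 ⊗ Parse
  a : PT c 𝕟 (λ p → proj₁ (proj₂ p))
  a = π₁ ⊚ π₂
  ph : PT c 𝕟 (λ p → proj₁ (proj₂ (proj₂ p)))
  ph = π₁ ⊚ π₂ ⊚ π₂
  n : PT c Num (λ p → proj₁ (proj₂ (proj₂ (proj₂ p))))
  n = π₁ ⊚ π₂ ⊚ π₂ ⊚ π₂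
  d : PT c Num (λ p → proj₂ (proj₂ (proj₂ (proj₂ p))))
  d = π₂ ⊚ π₂ ⊚ π₂ ⊚ π₂
  b = leqₚ (constP 𝕟 2) a

parse-growth : ∀ a v → sz Parse (parseStep a v) ≤ sz Parse v + 4
parse-growth a (ph , n , d) = cond-≤ (sz Parse) (leq 2 ph) (m≤m+n _ 4) (cond-≤ (sz Parse) (nonzero a)
  (cond-≤ (sz Parse) (leq 3 a) (m+k≡n⇒m≤n 2 (e₁ p x y)) (cond-≤ (sz Parse) (nonzero ph) (digit (leq 2 a)) (digit′ (leq 2 a)))) two)
  where
  p = sz 𝕟 ph
  x = sz Num n
  y = sz Num d
  e₁ : ∀ p x y → suc (2 + p + suc (x + y)) + 2 ≡ suc (p + suc (x + y)) + 4
  e₁ = solve-∀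
  e₂ : ∀ p x y → suc (p + suc (x + suc (3 + y))) ≡ suc (p + suc (x + y)) + 4
  e₂ = solve-∀
  e₃ : ∀ p x y → suc (p + suc (suc (3 + x) + y)) ≡ suc (p + suc (x + y)) + 4
  e₃ = solve-∀
  e₄ : ∀ p x y → suc (5 + suc (x + y)) + p ≡ suc (p + suc (x + y)) + 4 + 1
  e₄ = solve-∀
  two : suc (5 + suc (x + y)) ≤ suc (p + suc (x + y)) + 4
  two = +-cancelʳ-≤ 1 _ _ (≤-trans (+-monoʳ-≤ (suc (5 + suc (x + y))) (1≤sz 𝕟 ph)) (≤-reflexive (e₄ p x y)))
  bound = sz Parse (ph , n , d) + 4
  digit : ∀ b → sz Parse (ph , n , b ∷ d) ≤ bound
  digit b = ≤-trans (s≤s (+-monoʳ-≤ p (s≤s (+-monoʳ-≤ x (s≤s (+-monoˡ-≤ y (sz-𝔹 b))))))) (≤-reflexive (e₂ p x y))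
  digit′ : ∀ b → sz Parse (ph , b ∷ n , d) ≤ bound
  digit′ b = ≤-trans (s≤s (+-monoʳ-≤ p (s≤s (+-monoˡ-≤ y (s≤s (+-monoˡ-≤ x (sz-𝔹 b))))))) (≤-reflexive (e₃ p x y))

opaque
  parseₚ : ∀ {g l} → PT g (𝕃 𝕟) l → PT g (Num ⊗ Num) (λ γ → parse (l γ))
  parseₚ {g} p = π₂ ⊚ fold-add {g} {𝕟} {Parse} parseStepₚ (λ _ → 4) (bounded-const {g ⊗ 𝕟} 4) (λ γ a v → parse-growth a v) p (zeroₚ & []ₚ & []ₚ)

-- A word codes the list of the numbers of `false`s before each `true`.
decode : List Bool → List ℕ
decode = foldr (λ b l → cond b (0 ∷ l) (suc (hd0 l) ∷ tail l)) []

opaque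
  decodeₚ : ∀ {g w} → PT g Num w → PT g Table (λ γ → decode (w γ))
  decodeₚ {g} p = foldr-add {g} {𝔹} {Table} (ifₚ (π₁ ⊚ π₂) (zeroₚ ∷ₚ (π₂ ⊚ π₂)) (sucₚ (hd0ₚ (π₂ ⊚ π₂)) ∷ₚ tlₚ (π₂ ⊚ π₂))) (λ _ → 4) (bounded-const {g ⊗ 𝔹} 4)
    (λ γ b l → growth b l) p []ₚ
    where
    growth : ∀ b l → sz Table (cond b (0 ∷ l) (suc (hd0 l) ∷ tail l)) ≤ sz Table l + 4
    growth true  l = ≤-trans (m≤n+m _ 2) (≤-reflexive (+-comm 4 (sz Table l)))
    growth false l = ≤-trans (s≤s (s≤s (s≤s (sz-hd-tail l)))) (≤-reflexive (eq (sz Table l)))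
      where
      eq : ∀ n → suc (suc (suc (n + 1))) ≡ n + 4
      eq = solve-∀

evaluate : List Bool → ℕ → List Bool → ⟦ Num ⊗ Num ⟧ᵗ
evaluate w t x = parse (proj₂ (proj₂ (simulate (decode w) t (map (λ b → cond b 2 1) x))))

opaque
  evaluateₚ : ∀ {g w t x} → PT g Num w → PT g 𝕟 t → PT g Num x → PT g (Num ⊗ Num) (λ γ → evaluate (w γ) (t γ) (x γ))
  evaluateₚ {g} p q r = parseₚ (π₂ ⊚ π₂ ⊚ simulateₚ (decodeₚ p) q (mapₚ {g} {𝔹} {𝕟} (ifₚ π₂ (constP 𝕟 2) (constP 𝕟 1)) r))

symN : Sym → ℕ
symN blank = 0
symN s0    = 1
symN s1    = 2
symN sep   = 3

moveN : Move → ℕ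
moveN L = 0
moveN R = 1
moveN N = 2

module Universal (M : TM) where

  open TM M
  open Config

  entryOf : Maybe (Fin (suc states) × Sym × Move) → List ℕ → List ℕ
  entryOf nothing            r = 0 ∷ 4 ∷ 0 ∷ r
  entryOf (just (q , b , m)) r = 12 * toℕ q ∷ symN b ∷ moveN m ∷ r

  skip-entry : ∀ x k r → iter (3 + k) tail (entryOf x r) ≡ iter k tail r
  skip-entry nothing            k r = refl
  skip-entry (just (q , b , m)) k r = refl

  row : Fin (suc states) → List ℕ → List ℕ
  row q r = entryOf (δ q blank) (entryOf (δ q s0) (entryOf (δ q s1) (entryOf (δ q sep) r)))

  skip-row : ∀ q k r → iter (12 + k) tail (row q r) ≡ iter k tail r
  skip-row q k r = trans (skip-entry (δ q blank) (9 + k) _) (trans (skip-entry (δ q s0) (6 + k) _) (trans (skip-entry (δ q s1) (3 + k) _) (skip-entry (δ q sep) k r)))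

  rows : ∀ n → (Fin n → Fin (suc states)) → List ℕ
  rows zero    f = []
  rows (suc n) f = row (f Fin.zero) (rows n (f ∘ Fin.suc))

  table : List ℕ
  table = rows (suc states) id

  find-row : ∀ n (f : Fin n → Fin (suc states)) q k → ∃ λ r → iter (12 * toℕ q + k) tail (rows n f) ≡ iter k tail (row (f q) r)
  find-row (suc n) f Fin.zero    k = _ , refl
  find-row (suc n) f (Fin.suc q) k with find-row n (f ∘ Fin.suc) q k
  ... | r , e = r , trans (cong (λ z → iter (z + k) tail (rows (suc n) f)) (*-distribˡ-+ 12 1 (toℕ q))) (trans (skip-row (f Fin.zero) (12 * toℕ q + k) _) e)

  find-entry : ∀ q a → ∃ λ r → iter (12 * toℕ q + 3 * symN a) tail table ≡ entryOf (δ q a) r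
  find-entry q a with find-row (suc states) id q (3 * symN a)
  ... | r , e with a
  ... | blank = _ , e
  ... | s0    = _ , trans e (skip-entry (δ q blank) 0 _)
  ... | s1    = _ , trans e (trans (skip-entry (δ q blank) 3 _) (skip-entry (δ q s0) 0 _))
  ... | sep   = _ , trans e (trans (skip-entry (δ q blank) 6 _) (trans (skip-entry (δ q s0) 3 _) (skip-entry (δ q s1) 0 _)))

  -- A blank under the head at the end of the tape may be missing from the list.
  record Represents (v : ⟦ Cfg ⟧ᵗ) (c : Config M) : Set where
    constructor rep
    field
      st  : proj₁ v ≡ 12 * toℕ (state c)
      lft : proj₁ (proj₂ v) ≡ map symN (left c)
      hed : hd0 (proj₂ (proj₂ v)) ≡ symN (head c)
      rgt : tail (proj₂ (proj₂ v)) ≡ map symN (right c)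

  open Represents

  ustep-entry : ∀ {v c} → Represents v c → ∃ λ r → ustep table v ≡ apply (entryOf (δ (state c) (head c)) r) v
  ustep-entry {v} {c} ρ with find-entry (state c) (head c)
  ... | r , e = r , cong (λ z → apply z v) (trans (cong₂ (λ x y → iter (x + 3 * y) tail table) (st ρ) (hed ρ)) e)

  written : Fin (suc states) → ℕ → Move → ⟦ Cfg ⟧ᵗ → ⟦ Cfg ⟧ᵗ
  written q n L (_ , ls , rs) = 12 * toℕ q , tail ls , hd0 ls ∷ n ∷ tail rs
  written q n R (_ , ls , rs) = 12 * toℕ q , n ∷ ls , tail rs
  written q n N (_ , ls , rs) = 12 * toℕ q , ls , n ∷ tail rs

  apply-written : ∀ q b m r v → apply (entryOf (just (q , b , m)) r) v ≡ written q (symN b) m v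
  apply-written q blank L r v = refl
  apply-written q blank R r v = refl
  apply-written q blank N r v = refl
  apply-written q s0    L r v = refl
  apply-written q s0    R r v = refl
  apply-written q s0    N r v = refl
  apply-written q s1    L r v = refl
  apply-written q s1    R r v = refl
  apply-written q s1    N r v = refl
  apply-written q sep   L r v = refl
  apply-written q sep   R r v = refl
  apply-written q sep   N r v = refl

  written-represents : ∀ {v c} → Represents v c → ∀ q b m → Represents (written q (symN b) m v) (moveHead q (left c) b (right c) m)
  written-represents {c = conf _ []       _ rs}       ρ q b L = rep refl (cong tail (lft ρ)) (cong hd0 (lft ρ)) (cong (symN b ∷_) (rgt ρ))
  written-represents {c = conf _ (l ∷ ls) _ rs}       ρ q b L = rep refl (cong tail (lft ρ)) (cong hd0 (lft ρ)) (cong (symN b ∷_) (rgt ρ))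
  written-represents {c = conf _ ls       _ []}       ρ q b R = rep refl (cong (symN b ∷_) (lft ρ)) (cong hd0 (rgt ρ)) (cong tail (rgt ρ))
  written-represents {c = conf _ ls       _ (r ∷ rs)} ρ q b R = rep refl (cong (symN b ∷_) (lft ρ)) (cong hd0 (rgt ρ)) (cong tail (rgt ρ))
  written-represents {c = conf _ ls       _ rs}       ρ q b N = rep refl (lft ρ) refl (rgt ρ)

  iter-fixed : ∀ {X : Set} (f : X → X) v n → f v ≡ v → iter n f v ≡ v
  iter-fixed f v zero    e = refl
  iter-fixed f v (suc n) e = trans (cong (iter n f) e) (iter-fixed f v n e)

  -- A halted configuration is a fixed point of `ustep`, so surplus steps do no harm and any `t′`
  -- above the running time will do.
  simulates : ∀ t t′ {c c′ v} → t ≤ t′ → run M t c ≡ just c′ → Represents v c → Represents (iter t′ (ustep table) v) c′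
  simulates t t′ {c} {c′} {v} le e ρ with ustep-entry ρ
  ... | r , eq with δ (state c) (head c)
  simulates t       t′       {c} {_} {v} le       refl ρ | r , eq | nothing = subst (λ z → Represents z c) (sym (iter-fixed (ustep table) v t′ eq)) ρ
  simulates (suc t) (suc t′) {c} {c′} {v} (s≤s le) e    ρ | r , eq | just (q , b , m) =
    simulates t t′ le e (subst (λ z → Represents z _) (sym (trans eq (apply-written q b m r v))) (written-represents ρ q b m))

  phase2 : ∀ l ph n d → leq 2 ph ≡ true → foldl (λ v a → parseStep a v) (ph , n , d) l ≡ (ph , n , d)
  phase2 []      ph n d e = refl
  phase2 (a ∷ l) ph n d e rewrite e = phase2 l ph n d e

  parse-readOut : ∀ l v → proj₂ (foldl (λ v a → parseStep a v) v (map symN l)) ≡ proj₂ (foldl (λ v a → parseStep a v) v (map symN (readOut l)))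
  parse-readOut []          v = refl
  parse-readOut (blank ∷ l) v@(ph , n , d) with leq 2 ph in e
  ... | true  = cong proj₂ (phase2 (map symN l) ph n d e)
  ... | false = cong proj₂ (phase2 (map symN l) 2 n d refl)
  parse-readOut (s0 ∷ l)    v = parse-readOut l (parseStep 1 v)
  parse-readOut (s1 ∷ l)    v = parse-readOut l (parseStep 2 v)
  parse-readOut (sep ∷ l)   v = parse-readOut l (parseStep 3 v)

  parse-output : ∀ l → parse (map symN l) ≡ parse (map symN (readOut l))
  parse-output l = parse-readOut l (0 , [] , [])

  on-tape : ∀ rs h r → hd0 rs ≡ symN h → tail rs ≡ map symN r → parse rs ≡ parse (map symN (h ∷ r))
  on-tape []       blank []      e₁ e₂ = refl
  on-tape []       blank (x ∷ r) e₁ ()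
  on-tape []       s0    r       () e₂
  on-tape []       s1    r       () e₂
  on-tape []       sep   r       () e₂
  on-tape (a ∷ rs) h     r       e₁ e₂ = cong₂ (λ x y → parse (x ∷ y)) e₁ e₂

  parse-represented : ∀ {v c} → Represents v c → parse (proj₂ (proj₂ v)) ≡ parse (map symN (output c))
  parse-represented {_ , _ , rs} {conf _ _ h r} ρ = trans (on-tape rs h r (hed ρ) (rgt ρ)) (parse-output (h ∷ r))

  input-sym : ∀ x → map (λ b → cond b 2 1) x ≡ map symN (map bitSym x)
  input-sym []          = refl
  input-sym (true ∷ x)  = cong (2 ∷_) (input-sym x)
  input-sym (false ∷ x) = cong (1 ∷_) (input-sym x)

  init-represents : ∀ x → Represents (0 , [] , map symN x) (initConfig M x)
  init-represents []      = rep refl refl refl refl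
  init-represents (a ∷ x) = rep refl refl refl refl

  encodeNums : List ℕ → List Bool
  encodeNums []      = []
  encodeNums (n ∷ l) = replicate n false ++ true ∷ encodeNums l

  decode-encode : ∀ l → decode (encodeNums l) ≡ l
  decode-encode []      = refl
  decode-encode (n ∷ l) = trans (count n) (cong (n ∷_) (decode-encode l))
    where
    count : ∀ n → decode (replicate n false ++ true ∷ encodeNums l) ≡ n ∷ decode (encodeNums l)
    count zero    = refl
    count (suc n) rewrite count n = refl

  encode-snoc : ∀ n l → ∃ λ w → encodeNums (n ∷ l) ≡ w ++ true ∷ []
  encode-snoc n []      = replicate n false , refl
  encode-snoc n (m ∷ l) with encode-snoc m l
  ... | w , e = replicate n false ++ true ∷ w , trans (cong (λ z → replicate n false ++ true ∷ z) e) (sym (++-assoc (replicate n false) (true ∷ w) _))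

  -- The code of a nonempty table ends in `true`, the leading digit of a numeral; so every machine
  -- occurs in the enumeration by `toBits`.
  index-exists : ∃ λ i → decode (toBits i) ≡ table
  index-exists with table | table-cons
    where
    entry-cons : ∀ x r → ∃₂ λ n l → entryOf x r ≡ n ∷ l
    entry-cons nothing  r = _ , _ , refl
    entry-cons (just x) r = _ , _ , refl
    table-cons : ∃₂ λ n l → table ≡ n ∷ l
    table-cons = entry-cons (δ Fin.zero blank) _
  ... | _ | n , l , refl with encode-snoc n l
  ... | w , e with toBits-onto w
  ... | i , e′ = i , trans (cong decode (trans e′ (sym e))) (decode-encode (n ∷ l))

  index : ℕ
  index = proj₁ index-exists

  evaluate-index : ∀ x t t′ {y} → HaltsWith M (map bitSym x) t y → t ≤ t′ → evaluate (toBits index) t′ x ≡ parse (map symN y)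
  evaluate-index x t t′ (c , e , o) le = trans (cong₂ (λ tb z → parse (proj₂ (proj₂ (simulate tb t′ z)))) (proj₂ index-exists) (input-sym x))
    (trans (parse-represented (simulates t t′ le e (init-represents (map bitSym x)))) (cong (parse ∘ map symN) o))

parse-bits : ∀ ns ph n d → foldl (λ v a → parseStep a v) (0 , n , d) (map symN (map bitSym ns) ++ ph) ≡ foldl (λ v a → parseStep a v) (0 , ns ʳ++ n , d) ph
parse-bits []           ph n d = refl
parse-bits (true ∷ ns)  ph n d = parse-bits ns ph (true ∷ n) d
parse-bits (false ∷ ns) ph n d = parse-bits ns ph (false ∷ n) d

parse-bits₁ : ∀ ns n d → foldl (λ v a → parseStep a v) (1 , n , d) (map symN (map bitSym ns)) ≡ (1 , n , ns ʳ++ d)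
parse-bits₁ []           n d = refl
parse-bits₁ (true ∷ ns)  n d = parse-bits₁ ns n (true ∷ d)
parse-bits₁ (false ∷ ns) n d = parse-bits₁ ns n (false ∷ d)

parse-fraction : ∀ ns ds → parse (map symN (map bitSym ns ++ sep ∷ map bitSym ds)) ≡ (reverse ns , reverse ds)
parse-fraction ns ds = cong proj₂ (trans (cong (foldl (λ v a → parseStep a v) (0 , [] , [])) (map-++ symN (map bitSym ns) _))
  (trans (parse-bits ns _ [] []) (parse-bits₁ ds (reverse ns) [])))

unary-bits : ∀ n → unary n ≡ map bitSym (replicate n false)
unary-bits zero    = refl
unary-bits (suc n) = cong (s0 ∷_) (unary-bits n)

parse-unary : ∀ n → length (proj₁ (parse (map symN (unary n)))) ≡ n
parse-unary n = trans (cong (λ z → length (proj₁ (parse z))) (trans (cong (map symN) (unary-bits n)) (sym (++-identityʳ _))))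
  (trans (cong (λ z → length (proj₁ (proj₂ z))) (parse-bits (replicate n false) [] [] []))
    (trans (length-ʳ++ (replicate n false)) (trans (+-identityʳ _) (length-replicate n))))

-- The construction of Z

evalPoly-bound : ∀ as → ∃ λ c → ∀ n → evalPoly as n ≤ (2 + n) ^ c
evalPoly-bound []       = 0 , λ n → z≤n
evalPoly-bound (a ∷ as) with evalPoly-bound as
... | c , h = suc (a + suc c) , λ n →
  ≤-trans (+-mono-≤ (≤-trans (n≤2^n a) (^-monoˡ-≤ a (m≤m+n 2 n))) (*-mono-≤ (m≤n+m n 2) (h n))) (pow-+ n a (suc c))

falsesₚ : ∀ {g n} → PT g 𝕟 n → PT g Num (λ γ → replicate (n γ) false)
falsesₚ {g} {n} p = ext (λ γ → map-replicate (λ _ → false) (n γ) tt) (mapₚ {g} {𝟙} {𝔹} falseₚ (unitsₚ ⊚ p))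

opaque
  -- A function given only by a Turing machine enters the class through the universal machine with a
  -- constant table. The answer `unary (S n)` is parsed as a numerator with `S n` digits.
  polyTimeFunctionₚ : ∀ {S} → PolyTimeFunction S → PT 𝕟 𝕟 S
  polyTimeFunctionₚ {S} (M , p , halts) = ext value (lengthₚ ⊚ π₁ ⊚ evaluateₚ (constP Num (toBits index)) (powₚ c (constP 𝕟 2 +ₚ var)) (falsesₚ var))
    where
    open Universal M
    c : ℕ
    c = proj₁ (evalPoly-bound (Polynomial.coeffs p))
    value : ∀ n → length (proj₁ (evaluate (toBits index) ((2 + n) ^ c) (replicate n false))) ≡ S n
    value n = trans (cong (length ∘ proj₁) (evaluate-index (replicate n false) (p ⟦ n ⟧) ((2 + n) ^ c)
        (subst (λ x → HaltsWith M x (p ⟦ n ⟧) (unary (S n))) (unary-bits n) (halts n)) (proj₂ (evalPoly-bound (Polynomial.coeffs p)) n)))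
      (parse-unary (S n))

one : List Bool
one = true ∷ []

-- If the machine answers a₀ / b₀ on the word extended by 0 and a₁ / b₁ on the word extended by 1,
-- `raw` is (a₀ b₁ , a₁ b₀), their ratio without denominators. If either product is 0 the answers
-- are unusable, and `uv` falls back on 1 : 1, that is, no bet. The word `xr` has its last bit
-- first.
raw uv : ℕ → List Bool → List Bool → List Bool × List Bool
raw t xr w = mul (proj₁ (evaluate w t (reverse (false ∷ xr)))) (proj₂ (evaluate w t (reverse (true ∷ xr))))
           , mul (proj₁ (evaluate w t (reverse (true ∷ xr)))) (proj₂ (evaluate w t (reverse (false ∷ xr))))
uv t xr w = cond (leqB one (proj₁ (raw t xr w))) (cond (leqB one (proj₂ (raw t xr w))) (raw t xr w) (one , one)) (one , one)

opaque
  uvₚ : PT (𝕟 ⊗ Num ⊗ Num) (Num ⊗ Num) (λ p → uv (proj₁ p) (proj₁ (proj₂ p)) (proj₂ (proj₂ p)))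
  uvₚ = checked ⊚ rawₚ
    where
    ev : ∀ b → PT (𝕟 ⊗ Num ⊗ Num) (Num ⊗ Num) (λ p → evaluate (proj₂ (proj₂ p)) (proj₁ p) (reverse (b ∷ proj₁ (proj₂ p))))
    ev b = evaluateₚ (π₂ ⊚ π₂) π₁ (reverseₚ ⊚ (constP 𝔹 b ∷ₚ (π₁ ⊚ π₂)))
    rawₚ : PT (𝕟 ⊗ Num ⊗ Num) (Num ⊗ Num) (λ p → raw (proj₁ p) (proj₁ (proj₂ p)) (proj₂ (proj₂ p)))
    rawₚ = mulₚ (π₁ ⊚ ev false) (π₂ ⊚ ev true) & mulₚ (π₁ ⊚ ev true) (π₂ ⊚ ev false)
    checked : PT (Num ⊗ Num) (Num ⊗ Num) (λ r → cond (leqB one (proj₁ r)) (cond (leqB one (proj₂ r)) r (one , one)) (one , one))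
    checked = ifₚ (leqBₚ (constP Num one) π₁) (ifₚ (leqBₚ (constP Num one) π₂) var (constP (Num ⊗ Num) (one , one))) (constP (Num ⊗ Num) (one , one))

-- (w , P , Q) records that the martingale with code w has capital P / Q.
Entry : Ty
Entry = Num ⊗ Num ⊗ Num

pick : Bool → List Bool × List Bool → List Bool
pick b r = cond b (proj₂ r) (proj₁ r)

-- For the ratio u : v the capital is multiplied by 2u / (u + v) on 0 and by 2v / (u + v) on 1,
-- which is fair for all positive u and v. The new denominator does not depend on the bit.
cand : Bool → ℕ → List Bool → ⟦ Entry ⟧ᵗ → ⟦ Entry ⟧ᵗ
cand b t xr (w , P , Q) = w , mul (false ∷ pick b (uv t xr w)) P , mul (add (proj₁ (uv t xr w)) (proj₂ (uv t xr w))) Q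

opaque
  candₚ : ∀ b → PT ((𝕟 ⊗ Num) ⊗ Entry) Entry (λ p → cand b (proj₁ (proj₁ p)) (proj₂ (proj₁ p)) (proj₂ p))
  candₚ b = build ⊚ ((uvₚ ⊚ ((π₁ ⊚ π₁) & (π₂ ⊚ π₁) & (π₁ ⊚ π₂))) & π₂)
    where
    build : PT ((Num ⊗ Num) ⊗ Entry) Entry (λ p → proj₁ (proj₂ p) , mul (false ∷ pick b (proj₁ p)) (proj₁ (proj₂ (proj₂ p))) , mul (add (proj₁ (proj₁ p)) (proj₂ (proj₁ p))) (proj₂ (proj₂ (proj₂ p))))
    build = (π₁ ⊚ π₂) & mulₚ (falseₚ ∷ₚ ifₚ (constP 𝔹 b) (π₂ ⊚ π₁) (π₁ ⊚ π₁)) (π₁ ⊚ π₂ ⊚ π₂) & mulₚ (addₚ (π₁ ⊚ π₁) (π₂ ⊚ π₁)) (π₂ ⊚ π₂ ⊚ π₂)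

frac : List ⟦ Entry ⟧ᵗ → List Bool × List Bool
frac = foldr (λ e r → add (mul (proj₁ (proj₂ e)) (proj₂ r)) (mul (proj₂ (proj₂ e)) (proj₁ r)) , mul (proj₂ (proj₂ e)) (proj₂ r)) ([] , one)

-- `mul` charges twice the length of its first factor, and the size of a list of bits is at least
-- twice its length. So with `P` and `Q` as first factors each entry pays for its own contribution.
frac-length : ∀ l → length (proj₁ (frac l)) ≤ sz (𝕃 Entry) l × length (proj₂ (frac l)) ≤ sz (𝕃 Entry) l
frac-length [] = z≤n , ≤-refl
frac-length ((w , P , Q) ∷ l) with frac-length l
... | hN , hD = length-add (mul P (proj₂ (frac l))) (mul Q (proj₁ (frac l)))
      (≤-trans (length-mul P (proj₂ (frac l))) (≤-trans (+-mono-≤ hD p≤) (≤-reflexive (+-comm k s))))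
      (≤-trans (length-mul Q (proj₁ (frac l))) (≤-trans (+-mono-≤ hN q≤) (≤-reflexive (+-comm k s))))
  , ≤-trans (length-mul Q (proj₂ (frac l))) (≤-trans (+-mono-≤ hD q≤) (≤-trans (≤-reflexive (+-comm k s)) (n≤1+n _)))
  where
  k = sz (𝕃 Entry) l
  s = sz Entry (w , P , Q)
  p≤ : 2 * length P ≤ s
  p≤ = ≤-trans (m≤m+n _ 1) (≤-trans (length-≤-sz P) (≤-trans (m≤m+n _ _) (≤-trans (n≤1+n _) (≤-trans (m≤n+m _ (sz Num w)) (n≤1+n _)))))
  q≤ : 2 * length Q ≤ s
  q≤ = ≤-trans (m≤m+n _ 1) (≤-trans (length-≤-sz Q) (≤-trans (m≤n+m _ (sz Num P)) (≤-trans (n≤1+n _) (≤-trans (m≤n+m _ (sz Num w)) (n≤1+n _)))))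

sz-suffix : ∀ b zs ys → sz (𝕃 b) ys ≤ sz (𝕃 b) (zs ++ ys)
sz-suffix b []       ys = ≤-refl
sz-suffix b (z ∷ zs) ys = ≤-trans (sz-suffix b zs ys) (≤-trans (m≤n+m _ (sz b z)) (n≤1+n _))

opaque
  fracₚ : PT (𝕃 Entry) (Num ⊗ Num) frac
  fracₚ = foldr-bounded {𝕃 Entry} {Entry} {Num ⊗ Num} (addₚ (mulₚ P D) (mulₚ Q Nᵣ) & mulₚ Q D) var ([]ₚ & constP Num one)
    (λ l → 8 * sz (𝕃 Entry) l + 3) (bounded-+ {𝕃 Entry} (bounded-* {𝕃 Entry} (bounded-const {𝕃 Entry} 8) (bounded-sz {𝕃 Entry})) (bounded-const {𝕃 Entry} 3))
    (λ { _ zs ys refl → ≤-trans (size-le ys) (+-monoˡ-≤ 3 (*-monoʳ-≤ 8 (sz-suffix Entry zs ys))) })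
    where
    P : PT (𝕃 Entry ⊗ Entry ⊗ Num ⊗ Num) Num (λ p → proj₁ (proj₂ (proj₁ (proj₂ p))))
    P = π₁ ⊚ π₂ ⊚ π₁ ⊚ π₂
    Q : PT (𝕃 Entry ⊗ Entry ⊗ Num ⊗ Num) Num (λ p → proj₂ (proj₂ (proj₁ (proj₂ p))))
    Q = π₂ ⊚ π₂ ⊚ π₁ ⊚ π₂
    Nᵣ : PT (𝕃 Entry ⊗ Entry ⊗ Num ⊗ Num) Num (λ p → proj₁ (proj₂ (proj₂ p)))
    Nᵣ = π₁ ⊚ π₂ ⊚ π₂
    D : PT (𝕃 Entry ⊗ Entry ⊗ Num ⊗ Num) Num (λ p → proj₂ (proj₂ (proj₂ p)))
    D = π₂ ⊚ π₂ ⊚ π₂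
    size-le : ∀ l → sz (Num ⊗ Num) (frac l) ≤ 8 * sz (𝕃 Entry) l + 3
    size-le l = ≤-trans (s≤s (+-mono-≤ (≤-trans (sz-Num (proj₁ (frac l))) (+-monoˡ-≤ 1 (*-monoʳ-≤ 4 (proj₁ (frac-length l)))))
                                       (≤-trans (sz-Num (proj₂ (frac l))) (+-monoˡ-≤ 1 (*-monoʳ-≤ 4 (proj₂ (frac-length l)))))))
      (≤-reflexive (eq (sz (𝕃 Entry) l)))
      where
      eq : ∀ n → suc (4 * n + 1 + (4 * n + 1)) ≡ 8 * n + 3
      eq = solve-∀

-- The power (2 + m) ^ (1 + e), capped at F.
cap : ℕ → ℕ → ℕ
cap F y = F ∸ (F ∸ y)

cpow : ℕ → ℕ → ℕ → ℕ
cpow F m e = iter (suc e) (λ a → cap F (a * (2 + m))) 1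

cap≤ : ∀ F y → cap F y ≤ F
cap≤ F y = m∸n≤m F (F ∸ y)

cpow≤ : ∀ F m e → cpow F m e ≤ F
cpow≤ F m e = ≤-trans (≤-reflexive (iter-snoc e (λ a → cap F (a * (2 + m))) 1)) (cap≤ F (iter e (λ a → cap F (a * (2 + m))) 1 * (2 + m)))

cap-small : ∀ {F y} → y ≤ F → cap F y ≡ y
cap-small = m∸[m∸n]≡n

cap-large : ∀ {F y} → F ≤ y → cap F y ≡ F
cap-large {F} le = cong (F ∸_) (m≤n⇒m∸n≡0 le)

cpow-step : ∀ F m k a → a * (2 + m) ^ k ≤ F → iter k (λ a → cap F (a * (2 + m))) a ≡ a * (2 + m) ^ k
cpow-step F m zero    a le = sym (*-identityʳ a)
cpow-step F m (suc k) a le = trans (cong (iter k _) (cap-small (≤-trans (≤-trans (m≤m*n (a * (2 + m)) ((2 + m) ^ k) {{m^n≢0 (2 + m) k}}) (≤-reflexive (*-assoc a (2 + m) _))) le)))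
  (trans (cpow-step F m k (a * (2 + m)) (≤-trans (≤-reflexive (*-assoc a (2 + m) _)) le)) (*-assoc a (2 + m) _))

cpow-small : ∀ F m e → (2 + m) ^ suc e ≤ F → cpow F m e ≡ (2 + m) ^ suc e
cpow-small F m e le = trans (cpow-step F m (suc e) 1 (≤-trans (≤-reflexive (*-identityˡ _)) le)) (*-identityˡ _)

cpow-full : ∀ F m k → iter k (λ a → cap F (a * (2 + m))) F ≡ F
cpow-full F m zero    = refl
cpow-full F m (suc k) = trans (cong (iter k _) (cap-large (m≤m*n F (2 + m)))) (cpow-full F m k)

cpow-over : ∀ F m k a → a ≤ F → F < a * (2 + m) ^ k → iter k (λ a → cap F (a * (2 + m))) a ≡ F
cpow-over F m zero    a le lt with () ← <⇒≱ lt (≤-trans (≤-reflexive (*-identityʳ a)) le)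
cpow-over F m (suc k) a le lt with ≤-total (a * (2 + m)) F
... | inj₁ p = trans (cong (iter k _) (cap-small p)) (cpow-over F m k (a * (2 + m)) p (≤-trans lt (≤-reflexive (sym (*-assoc a (2 + m) _)))))
... | inj₂ p = trans (cong (iter k _) (cap-large p)) (cpow-full F m k)

cpow-large : ∀ F m e → 1 ≤ F → F < (2 + m) ^ suc e → cpow F m e ≡ F
cpow-large F m e le lt = cpow-over F m (suc e) 1 le (≤-trans lt (≤-reflexive (sym (*-identityˡ _))))

opaque
  -- Capping after every multiplication keeps all intermediate values at most `F`; the uncapped
  -- power is not polynomially bounded when the exponent varies.
  cpowₚ : ∀ {g F m e} → PT g 𝕟 F → PT g 𝕟 m → PT g 𝕟 e → PT g 𝕟 (λ γ → cpow (F γ) (m γ) (e γ))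
  cpowₚ {g} {F} {m} {e} pF pm pe = iter-bounded {g} {𝕟} ((pF ⊚ π₁) ∸ₚ ((pF ⊚ π₁) ∸ₚ (π₂ *ₚ (constP 𝕟 2 +ₚ (pm ⊚ π₁))))) (sucₚ pe) (constP 𝕟 1)
    (λ γ → sz 𝕟 (F γ) + 3) (bounded-+ {g} (size-bound pF) (bounded-const {g} 3)) bound
    where
    mono : ∀ {x y} → x ≤ y → sz 𝕟 x ≤ sz 𝕟 y
    mono {x} {y} le = ≤-trans (≤-reflexive (sz-𝕟 x)) (≤-trans (+-monoˡ-≤ 1 (*-monoʳ-≤ 2 le)) (≤-reflexive (sym (sz-𝕟 y))))
    bound : ∀ γ i → i ≤ suc (e γ) → sz 𝕟 (iter i (λ a → cap (F γ) (a * (2 + m γ))) 1) ≤ sz 𝕟 (F γ) + 3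
    bound γ zero    _ = m≤n+m 3 _
    bound γ (suc i) _ = ≤-trans (mono (cpow≤ (F γ) (m γ) i)) (m≤m+n _ 3)

pow2 : ℕ → List Bool
pow2 k = iter k (false ∷_) one

val-pow2 : ∀ k → val (pow2 k) ≡ 2 ^ k
val-pow2 zero    = refl
val-pow2 (suc k) = trans (cong val (iter-snoc k (false ∷_) one)) (cong (2 *_) (val-pow2 k))

length-pow2 : ∀ k → length (pow2 k) ≡ suc k
length-pow2 zero    = refl
length-pow2 (suc k) = trans (cong length (iter-snoc k (false ∷_) one)) (cong suc (length-pow2 k))

opaque
  pow2ₚ : ∀ {g n} → PT g 𝕟 n → PT g Num (λ γ → pow2 (n γ))
  pow2ₚ {g} p = iter-add {g} {Num} (falseₚ ∷ₚ π₂) (λ _ → 2) (bounded-const {g} 2) (λ γ v → ≤-reflexive (+-comm 2 (sz Num v))) p (constP Num one)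

module Construction (S : ℕ → ℕ) (Sₚ : PT 𝕟 𝕟 S) where

  -- The cap `suc j` is just large enough: a power up to `suc j` is computed exactly, and a larger
  -- one still comes out above `j`. So `(2 + S j) ^ suc e ≤ j` is decided in time polynomial in `j`.
  bump : ℕ → ℕ → Bool
  bump j e = leq (cpow (suc j) (S j) e) j

  cpow-above : ∀ j m e → j < (2 + m) ^ suc e → cpow (suc j) m e ≡ suc j
  cpow-above j m e lt with m≤n⇒m<n∨m≡n lt
  ... | inj₁ lt′ = cpow-large (suc j) m e (s≤s z≤n) lt′
  ... | inj₂ eq  = trans (cpow-small (suc j) m e (≤-reflexive (sym eq))) (sym eq)

  bump-sound : ∀ j e → bump j e ≡ true → (2 + S j) ^ suc e ≤ j
  bump-sound j e h with ≤-<-connex ((2 + S j) ^ suc e) j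
  ... | inj₁ le = le
  ... | inj₂ lt with () ← <⇒≱ ≤-refl (≤-trans (≤-reflexive (sym (cpow-above j (S j) e lt))) (leq⇒≤ (cpow (suc j) (S j) e) j h))

  bump-complete : ∀ j e → (2 + S j) ^ suc e ≤ j → bump j e ≡ true
  bump-complete j e le = ≤⇒leq (≤-trans (≤-reflexive (cpow-small (suc j) (S j) e (m≤n⇒m≤1+n le))) le)

  lev : ℕ → ℕ
  lev zero    = 0
  lev (suc j) = cond (bump j (lev j)) (suc (lev j)) (lev j)

  clk : ℕ → ℕ
  clk k = (2 + k) ^ suc (lev k)

  -- Position, level, bits chosen so far (last first) and capitals.
  State : Ty
  State = 𝕟 ⊗ 𝕟 ⊗ Num ⊗ 𝕃 Entry

  word : ⟦ State ⟧ᵗ → List Bool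
  word s = proj₁ (proj₂ (proj₂ s))

  entries : ⟦ State ⟧ᵗ → List ⟦ Entry ⟧ᵗ
  entries s = proj₂ (proj₂ (proj₂ s))

  -- Machine number `j` joins after stage `j` with capital 1 / 2 ^ (j + 1); these endowments sum to
  -- less than 1, so infinitely many strategies can be opposed at once.
  extend : ⟦ State ⟧ᵗ → List ⟦ Entry ⟧ᵗ → List ⟦ Entry ⟧ᵗ → Bool → ⟦ State ⟧ᵗ
  extend s E₀ E₁ b = suc (proj₁ s) , cond (bump (proj₁ s) (proj₁ (proj₂ s))) (suc (proj₁ (proj₂ s))) (proj₁ (proj₂ s)) ,
    b ∷ word s , (toBits (proj₁ s) , one , pow2 (suc (proj₁ s))) ∷ cond b E₁ E₀

  cands : Bool → ℕ → ⟦ State ⟧ᵗ → List ⟦ Entry ⟧ᵗ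
  cands b t s = map (cand b t (word s)) (entries s)

  -- The two lists of candidates have the same denominators, so comparing numerators compares the
  -- total capitals. A tie gives `false`.
  choice : ℕ → ⟦ State ⟧ᵗ → Bool
  choice t s = not (leqB (proj₁ (frac (cands false t s))) (proj₁ (frac (cands true t s))))

  stage : ℕ → ⟦ State ⟧ᵗ → ⟦ State ⟧ᵗ
  stage t s = extend s (cands false t s) (cands true t s) (choice t s)

  bumpₚ : ∀ {g j e} → PT g 𝕟 j → PT g 𝕟 e → PT g 𝔹 (λ γ → bump (j γ) (e γ))
  bumpₚ pj pe = leqₚ (cpowₚ (sucₚ pj) (Sₚ ⊚ pj) pe) pj

  opaque
    stageₚ : PT (𝕟 ⊗ State) State (λ p → stage (proj₁ p) (proj₂ p))
    stageₚ = extendₚ ⊚ (chooseₚ ⊚ (π₂ & candsₚ false & candsₚ true))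
      where
      candsₚ : ∀ b → PT (𝕟 ⊗ State) (𝕃 Entry) (λ p → cands b (proj₁ p) (proj₂ p))
      candsₚ b = mapₚ {𝕟 ⊗ State} {Entry} {Entry} (candₚ b ⊚ (((π₁ ⊚ π₁) & (π₁ ⊚ π₂ ⊚ π₂ ⊚ π₂ ⊚ π₁)) & π₂)) (π₂ ⊚ π₂ ⊚ π₂ ⊚ π₂)
      chooseₚ : PT (State ⊗ 𝕃 Entry ⊗ 𝕃 Entry) ((State ⊗ 𝕃 Entry ⊗ 𝕃 Entry) ⊗ 𝔹) (λ p → p , not (leqB (proj₁ (frac (proj₁ (proj₂ p)))) (proj₁ (frac (proj₂ (proj₂ p))))))
      chooseₚ = var & notₚ (leqBₚ (π₁ ⊚ fracₚ ⊚ π₁ ⊚ π₂) (π₁ ⊚ fracₚ ⊚ π₂ ⊚ π₂))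
      extendₚ : PT ((State ⊗ 𝕃 Entry ⊗ 𝕃 Entry) ⊗ 𝔹) State (λ p → extend (proj₁ (proj₁ p)) (proj₁ (proj₂ (proj₁ p))) (proj₂ (proj₂ (proj₁ p))) (proj₂ p))
      extendₚ = sucₚ j & ifₚ (bumpₚ j e) (sucₚ e) e & (π₂ ∷ₚ (π₁ ⊚ π₂ ⊚ π₂ ⊚ π₁ ⊚ π₁)) &
          ((toBitsₚ j & constP Num one & pow2ₚ (sucₚ j)) ∷ₚ ifₚ π₂ (π₂ ⊚ π₂ ⊚ π₁) (π₁ ⊚ π₂ ⊚ π₁))
        where
        j : PT ((State ⊗ 𝕃 Entry ⊗ 𝕃 Entry) ⊗ 𝔹) 𝕟 (λ p → proj₁ (proj₁ (proj₁ p)))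
        j = π₁ ⊚ π₁ ⊚ π₁
        e : PT ((State ⊗ 𝕃 Entry ⊗ 𝕃 Entry) ⊗ 𝔹) 𝕟 (λ p → proj₁ (proj₂ (proj₁ (proj₁ p))))
        e = π₁ ⊚ π₂ ⊚ π₁ ⊚ π₁

  start : ⟦ State ⟧ᵗ
  start = 0 , 0 , [] , []

  opaque
    -- κ gives the time allowed at a position and level.
    σ : (ℕ → ℕ → ℕ) → ℕ → ⟦ State ⟧ᵗ
    σ κ n = iter n (λ s → stage (κ (proj₁ s) (proj₁ (proj₂ s))) s) start

    σ-zero : ∀ κ → σ κ 0 ≡ start
    σ-zero κ = refl

    σ-suc : ∀ κ n → σ κ (suc n) ≡ stage (κ (proj₁ (σ κ n)) (proj₁ (proj₂ (σ κ n)))) (σ κ n)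
    σ-suc κ n = iter-snoc n (λ s → stage (κ (proj₁ s) (proj₁ (proj₂ s))) s) start

  σ-position : ∀ κ n → proj₁ (σ κ n) ≡ n
  σ-position κ zero    = cong proj₁ (σ-zero κ)
  σ-position κ (suc n) = trans (cong proj₁ (σ-suc κ n)) (cong suc (σ-position κ n))

  σ-level : ∀ κ n → proj₁ (proj₂ (σ κ n)) ≡ lev n
  σ-level κ zero    = cong (proj₁ ∘ proj₂) (σ-zero κ)
  σ-level κ (suc n) = trans (cong (proj₁ ∘ proj₂) (σ-suc κ n)) (cong₂ (λ j e → cond (bump j e) (suc e) e) (σ-position κ n) (σ-level κ n))

  σ-step : ∀ κ n → σ κ (suc n) ≡ stage (κ n (lev n)) (σ κ n)
  σ-step κ n = trans (σ-suc κ n) (cong₂ (λ j e → stage (κ j e) (σ κ n)) (σ-position κ n) (σ-level κ n))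

  σ-agree : ∀ κ κ′ n → (∀ j → j < n → κ j (lev j) ≡ κ′ j (lev j)) → σ κ n ≡ σ κ′ n
  σ-agree κ κ′ zero    h = trans (σ-zero κ) (sym (σ-zero κ′))
  σ-agree κ κ′ (suc n) h = trans (σ-step κ n) (trans (cong₂ stage (h n ≤-refl) (σ-agree κ κ′ n (λ j lt → h j (m≤n⇒m≤1+n lt)))) (sym (σ-step κ′ n)))

  full : ℕ → ℕ → ℕ
  full j e = (2 + j) ^ suc e

  Z : ℕ → Bool
  Z n = hdb (word (σ full (suc n)))

  Zcap : ℕ → ℕ → Bool
  Zcap F n = hdb (word (σ (cpow F) (suc n)))

  lev-mono : ∀ {i j} → i ≤ j → lev i ≤ lev j
  lev-mono {i} {j} le with m≤n⇒∃[o]m+o≡n le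
  ... | k , refl = go k
    where
    go : ∀ k → lev i ≤ lev (i + k)
    go zero    = ≤-reflexive (cong lev (sym (+-identityʳ i)))
    go (suc k) = ≤-trans (go k) (≤-trans (step′ (i + k)) (≤-reflexive (cong lev (sym (+-suc i k)))))
      where
      step′ : ∀ j → lev j ≤ lev (suc j)
      step′ j with bump j (lev j)
      ... | true  = n≤1+n _
      ... | false = ≤-refl

  clk-mono : ∀ {i j} → i ≤ j → clk i ≤ clk j
  clk-mono {i} {j} le = ≤-trans (^-monoˡ-≤ (suc (lev i)) (s≤s (s≤s le))) (^-monoʳ-≤ (2 + j) (s≤s (lev-mono le)))

  -- `clk` is monotone, so a cap that is harmless at `n` is harmless at all earlier stages too.
  Zcap≡Z : ∀ F n → clk n ≤ F → Zcap F n ≡ Z n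
  Zcap≡Z F n le = cong (hdb ∘ word) (σ-agree (cpow F) full (suc n) (λ j lt → cpow-small F j (lev j) (≤-trans (clk-mono (≤-pred lt)) le)))

  word-Z : ∀ n → Z ↾ n ≡ reverse (word (σ full n))
  word-Z zero    = cong (reverse ∘ word) (sym (σ-zero full))
  word-Z (suc n) = trans (cong (map Z) (sym (upTo-∷ʳ n))) (trans (map-++ Z (upTo n) (n ∷ [])) (trans (cong (_++ Z n ∷ []) (word-Z n))
    (trans (sym (unfold-reverse (Z n) (word (σ full n)))) (cong reverse (trans (cong (λ z → hdb z ∷ word (σ full n)) (cong word (σ-step full n))) (sym (cong word (σ-step full n))))))))

  lev≤ : ∀ n → lev n ≤ n
  lev≤ zero    = z≤n
  lev≤ (suc n) with bump n (lev n)
  ... | true  = s≤s (lev≤ n)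
  ... | false = m≤n⇒m≤1+n (lev≤ n)

  -- Sizes of the simulated capitals under a capped clock

  module Sizes (F N : ℕ) where

    -- `U` bounds the betting ratios in terms of the cap and the number of stages alone,
    -- independently of the capitals. Hence numerators and denominators grow by at most `H` digits
    -- per stage, and repeated multiplication keeps their lengths polynomial.
    U H Bd : ℕ
    U = (2 + (2 * F + 8 * N + 5)) ^ proj₁ (size-bound uvₚ)
    H = 2 * (1 + U)
    Bd = 2 + (4 * N + 1) + (4 * (1 + N * H) + 1) + (4 * (1 + N + N * H) + 1)

    record Small (i : ℕ) (e : ⟦ Entry ⟧ᵗ) : Set where
      constructor small
      field
        w-small : length (proj₁ e) ≤ N
        P-small : length (proj₁ (proj₂ e)) ≤ 1 + i * H
        Q-small : length (proj₂ (proj₂ e)) ≤ 1 + N + i * H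

    uv-small : ∀ t xr w → t ≤ F → length xr ≤ N → length w ≤ N → length (proj₁ (uv t xr w)) ≤ U × length (proj₂ (uv t xr w)) ≤ U
    uv-small t xr w ht hx hw = ≤-trans (length≤sz 𝔹 u) (≤-trans (m≤m+n (sz Num u) (sz Num v)) (≤-trans (n≤1+n _) both))
                             , ≤-trans (length≤sz 𝔹 v) (≤-trans (m≤n+m (sz Num v) (sz Num u)) (≤-trans (n≤1+n _) both))
      where
      u = proj₁ (uv t xr w)
      v = proj₂ (uv t xr w)
      eq : ∀ F N → suc (2 * F + 1 + suc (4 * N + 1 + (4 * N + 1))) ≡ 2 * F + 8 * N + 5
      eq = solve-∀
      arg : sz (𝕟 ⊗ Num ⊗ Num) (t , xr , w) ≤ 2 * F + 8 * N + 5
      arg = ≤-trans (s≤s (+-mono-≤ (≤-trans (≤-reflexive (sz-𝕟 t)) (+-monoˡ-≤ 1 (*-monoʳ-≤ 2 ht)))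
              (s≤s (+-mono-≤ (≤-trans (sz-Num xr) (+-monoˡ-≤ 1 (*-monoʳ-≤ 4 hx))) (≤-trans (sz-Num w) (+-monoˡ-≤ 1 (*-monoʳ-≤ 4 hw))))))) (≤-reflexive (eq F N))
      both : sz (Num ⊗ Num) (u , v) ≤ U
      both = ≤-trans (proj₂ (size-bound uvₚ) (t , xr , w)) (^-monoˡ-≤ (proj₁ (size-bound uvₚ)) (s≤s (s≤s arg)))

    cand-small : ∀ b t xr e {i} → t ≤ F → length xr ≤ N → Small i e → Small (suc i) (cand b t xr e)
    cand-small b t xr (w , P , Q) {i} ht hx (small hw hP hQ) = small hw
        (≤-trans (length-mul (false ∷ pick b (uv t xr w)) P) (≤-trans (+-mono-≤ hP (*-monoʳ-≤ 2 (s≤s (picked b)))) (≤-reflexive (eq 1 (i * H) H))))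
        (≤-trans (length-mul (add u v) Q) (≤-trans (+-mono-≤ hQ (*-monoʳ-≤ 2 (length-add u v (proj₁ huv) (proj₂ huv)))) (≤-reflexive (eq (1 + N) (i * H) H))))
      where
      u = proj₁ (uv t xr w)
      v = proj₂ (uv t xr w)
      huv = uv-small t xr w ht hx hw
      picked : ∀ b → length (pick b (uv t xr w)) ≤ U
      picked true  = proj₂ huv
      picked false = proj₁ huv
      eq : ∀ x y z → x + y + z ≡ x + (z + y)
      eq = solve-∀

    cands-small : ∀ b t xr l {i} → t ≤ F → length xr ≤ N → All (Small i) l → All (Small (suc i)) (map (cand b t xr) l)
    cands-small b t xr []      ht hx []       = []
    cands-small b t xr (e ∷ l) ht hx (s ∷ ss) = cand-small b t xr e ht hx s ∷ cands-small b t xr l ht hx ss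

    record Inv (i : ℕ) (s : ⟦ State ⟧ᵗ) : Set where
      constructor inv
      field
        word-length  : length (word s) ≡ i
        entry-length : length (entries s) ≡ i
        all-small    : All (Small i) (entries s)

    stage-inv : ∀ t s {i} → t ≤ F → proj₁ s ≡ i → i < N → Inv i s → Inv (suc i) (stage t s)
    stage-inv t s {i} ht refl lt (inv hw he ha) = inv (cong suc hw) (cong suc (len (choice t s))) (new ∷ old (choice t s))
      where
      hx = ≤-trans (≤-reflexive hw) (<⇒≤ lt)
      len : ∀ b → length (cond b (cands true t s) (cands false t s)) ≡ i
      len true  = trans (length-map (cand true t (word s)) (entries s)) he
      len false = trans (length-map (cand false t (word s)) (entries s)) he
      old : ∀ b → All (Small (suc i)) (cond b (cands true t s) (cands false t s))
      old true  = cands-small true t (word s) (entries s) ht hx ha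
      old false = cands-small false t (word s) (entries s) ht hx ha
      new : Small (suc i) (toBits i , one , pow2 (suc i))
      new = small (≤-trans (length-toBits i) (<⇒≤ lt)) (m≤m+n 1 _) (≤-trans (≤-reflexive (length-pow2 (suc i))) (≤-trans (s≤s lt) (m≤m+n (1 + N) _)))

    σ-inv : ∀ i → i ≤ N → Inv i (σ (cpow F) i)
    σ-inv zero    le = subst (Inv 0) (sym (σ-zero (cpow F))) (inv refl refl [])
    σ-inv (suc i) le = subst (Inv (suc i)) (sym (σ-step (cpow F) i))
      (stage-inv (cpow F i (lev i)) (σ (cpow F) i) (cpow≤ F i (lev i)) (σ-position (cpow F) i) le (σ-inv i (<⇒≤ le)))

    small-sz : ∀ {i} e → i ≤ N → Small i e → sz Entry e ≤ Bd
    small-sz {i} (w , P , Q) le (small hw hP hQ) = ≤-trans (s≤s (+-mono-≤ (≤-trans (sz-Num w) (+-monoˡ-≤ 1 (*-monoʳ-≤ 4 hw)))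
        (s≤s (+-mono-≤ (≤-trans (sz-Num P) (+-monoˡ-≤ 1 (*-monoʳ-≤ 4 (≤-trans hP (+-monoʳ-≤ 1 (*-monoˡ-≤ H le))))))
                       (≤-trans (sz-Num Q) (+-monoˡ-≤ 1 (*-monoʳ-≤ 4 (≤-trans hQ (+-monoʳ-≤ (1 + N) (*-monoˡ-≤ H le)))))))))) (≤-reflexive (eq _ _ _))
      where
      eq : ∀ x y z → suc (x + suc (y + z)) ≡ 2 + x + y + z
      eq = solve-∀

    entries-sz : ∀ {i} l → i ≤ N → All (Small i) l → sz (𝕃 Entry) l ≤ length l * (1 + Bd) + 1
    entries-sz []      le []       = ≤-refl
    entries-sz (e ∷ l) le (s ∷ ss) = ≤-trans (s≤s (+-mono-≤ (small-sz e le s) (entries-sz l le ss))) (≤-reflexive (sym (+-assoc (1 + Bd) (length l * (1 + Bd)) 1)))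

    G : ℕ
    G = 3 + (2 * N + 1) + (2 * N + 1) + (4 * N + 1) + (N * (1 + Bd) + 1)

    σ-sz : ∀ i → i ≤ N → sz State (σ (cpow F) i) ≤ G
    σ-sz i le = ≤-trans (s≤s (+-mono-≤ (≤-trans (≤-reflexive (sz-𝕟 (proj₁ s))) (+-monoˡ-≤ 1 (*-monoʳ-≤ 2 hj)))
          (s≤s (+-mono-≤ (≤-trans (≤-reflexive (sz-𝕟 (proj₁ (proj₂ s)))) (+-monoˡ-≤ 1 (*-monoʳ-≤ 2 he)))
            (s≤s (+-mono-≤ (≤-trans (sz-Num (word s)) (+-monoˡ-≤ 1 (*-monoʳ-≤ 4 (≤-trans (≤-reflexive (Inv.word-length I)) le))))
              (≤-trans (entries-sz (entries s) le (Inv.all-small I)) (+-monoˡ-≤ 1 (*-monoˡ-≤ (1 + Bd) (≤-trans (≤-reflexive (Inv.entry-length I)) le))))))))))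
        (≤-reflexive (eq (2 * N + 1) (2 * N + 1) (4 * N + 1) (N * (1 + Bd) + 1)))
      where
      s = σ (cpow F) i
      I = σ-inv i le
      hj : proj₁ s ≤ N
      hj = ≤-trans (≤-reflexive (σ-position (cpow F) i)) le
      he : proj₁ (proj₂ s) ≤ N
      he = ≤-trans (≤-reflexive (σ-level (cpow F) i)) (≤-trans (lev≤ i) le)
      eq : ∀ a b c d → suc (a + suc (b + suc (c + d))) ≡ 3 + a + b + c + d
      eq = solve-∀

  opaque
    unfolding σ

    Zcapₚ : PT (𝕟 ⊗ 𝕟) 𝔹 (λ p → Zcap (proj₁ p) (proj₂ p))
    Zcapₚ = hdbₚ (π₁ ⊚ π₂ ⊚ π₂) ⊚ iter-bounded {𝕟 ⊗ 𝕟} {State} step′ (sucₚ π₂) (constP State start) (λ γ → Sizes.G (proj₁ γ) (suc (proj₂ γ))) bG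
        (λ γ i le → Sizes.σ-sz (proj₁ γ) (suc (proj₂ γ)) i le)
      where
      step′ : PT ((𝕟 ⊗ 𝕟) ⊗ State) State (λ p → stage (cpow (proj₁ (proj₁ p)) (proj₁ (proj₂ p)) (proj₁ (proj₂ (proj₂ p)))) (proj₂ p))
      step′ = stageₚ ⊚ (cpowₚ (π₁ ⊚ π₁) (π₁ ⊚ π₂) (π₁ ⊚ π₂ ⊚ π₂) & π₂)
      k : ∀ n → Bounded (𝕟 ⊗ 𝕟) (λ _ → n)
      k n = bounded-const {𝕟 ⊗ 𝕟} n
      _⊕_ : ∀ {f h} → Bounded (𝕟 ⊗ 𝕟) f → Bounded (𝕟 ⊗ 𝕟) h → Bounded (𝕟 ⊗ 𝕟) (λ x → f x + h x)
      _⊕_ = bounded-+ {𝕟 ⊗ 𝕟}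
      _⊛_ : ∀ {f h} → Bounded (𝕟 ⊗ 𝕟) f → Bounded (𝕟 ⊗ 𝕟) h → Bounded (𝕟 ⊗ 𝕟) (λ x → f x * h x)
      _⊛_ = bounded-* {𝕟 ⊗ 𝕟}
      infixl 6 _⊕_
      infixl 7 _⊛_
      bF : Bounded (𝕟 ⊗ 𝕟) proj₁
      bF = bounded-≤ {𝕟 ⊗ 𝕟} (λ p → ≤-trans (m≤n*m (proj₁ p) 2) (≤-trans (m≤m+n _ 1) (≤-reflexive (sym (sz-𝕟 (proj₁ p)))))) (size-bound (π₁ {𝕟} {𝕟}))
      bN : Bounded (𝕟 ⊗ 𝕟) (λ p → suc (proj₂ p))
      bN = k 1 ⊕ bounded-≤ {𝕟 ⊗ 𝕟} (λ p → ≤-trans (m≤n*m (proj₂ p) 2) (≤-trans (m≤m+n _ 1) (≤-reflexive (sym (sz-𝕟 (proj₂ p)))))) (size-bound (π₂ {𝕟} {𝕟}))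
      bA : Bounded (𝕟 ⊗ 𝕟) (λ p → 2 * proj₁ p + 8 * suc (proj₂ p) + 5)
      bA = k 2 ⊛ bF ⊕ k 8 ⊛ bN ⊕ k 5
      bU : Bounded (𝕟 ⊗ 𝕟) (λ p → Sizes.U (proj₁ p) (suc (proj₂ p)))
      bU = (2 + proj₁ bA) * proj₁ (size-bound uvₚ) , λ p → pow-pow _ _ (proj₁ (size-bound uvₚ)) (proj₁ bA) (proj₂ bA p)
      bH : Bounded (𝕟 ⊗ 𝕟) (λ p → Sizes.H (proj₁ p) (suc (proj₂ p)))
      bH = k 2 ⊛ (k 1 ⊕ bU)
      bB : Bounded (𝕟 ⊗ 𝕟) (λ p → Sizes.Bd (proj₁ p) (suc (proj₂ p)))
      bB = k 2 ⊕ (k 4 ⊛ bN ⊕ k 1) ⊕ (k 4 ⊛ (k 1 ⊕ bN ⊛ bH) ⊕ k 1) ⊕ (k 4 ⊛ (k 1 ⊕ bN ⊕ bN ⊛ bH) ⊕ k 1)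
      bG : Bounded (𝕟 ⊗ 𝕟) (λ p → Sizes.G (proj₁ p) (suc (proj₂ p)))
      bG = k 3 ⊕ (k 2 ⊛ bN ⊕ k 1) ⊕ (k 2 ⊛ bN ⊕ k 1) ⊕ (k 4 ⊛ bN ⊕ k 1) ⊕ (bN ⊛ (k 1 ⊕ bB) ⊕ k 1)

-- Randomness of Z

num den : List ⟦ Entry ⟧ᵗ → ℕ
den []                = 1
den ((w , P , Q) ∷ l) = val Q * den l
num []                = 0
num ((w , P , Q) ∷ l) = val P * den l + val Q * num l

frac-val : ∀ l → val (proj₁ (frac l)) ≡ num l × val (proj₂ (frac l)) ≡ den l
frac-val [] = refl , refl
frac-val ((w , P , Q) ∷ l) with frac-val l
... | eN , eD = trans (val-add (mul P (proj₂ (frac l))) (mul Q (proj₁ (frac l))))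
                  (cong₂ _+_ (trans (val-mul P (proj₂ (frac l))) (cong (val P *_) eD)) (trans (val-mul Q (proj₁ (frac l))) (cong (val Q *_) eN)))
              , trans (val-mul Q (proj₂ (frac l))) (cong (val Q *_) eD)

uv-pos : ∀ t xr w → 1 ≤ val (proj₁ (uv t xr w)) × 1 ≤ val (proj₂ (uv t xr w))
uv-pos t xr w = checked-pos (raw t xr w)
  where
  checked : List Bool × List Bool → List Bool × List Bool
  checked r = cond (leqB one (proj₁ r)) (cond (leqB one (proj₂ r)) r (one , one)) (one , one)
  checked-pos : ∀ r → 1 ≤ val (proj₁ (checked r)) × 1 ≤ val (proj₂ (checked r))
  checked-pos r with leqB one (proj₁ r) in e₁
  ... | false = ≤-refl , ≤-refl
  ... | true with leqB one (proj₂ r) in e₂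
  ...   | false = ≤-refl , ≤-refl
  ...   | true  = leqB-true one (proj₁ r) e₁ , leqB-true one (proj₂ r) e₂

uv-raw : ∀ t xr w → 1 ≤ val (proj₁ (raw t xr w)) → 1 ≤ val (proj₂ (raw t xr w)) → uv t xr w ≡ raw t xr w
uv-raw t xr w = go (raw t xr w)
  where
  go : ∀ r → 1 ≤ val (proj₁ r) → 1 ≤ val (proj₂ r) → cond (leqB one (proj₁ r)) (cond (leqB one (proj₂ r)) r (one , one)) (one , one) ≡ r
  go r p q with leqB one (proj₁ r) in e₁
  ... | false with () ← <⇒≱ (leqB-false one (proj₁ r) e₁) p
  ... | true with leqB one (proj₂ r) in e₂
  ...   | false with () ← <⇒≱ (leqB-false one (proj₂ r) e₂) q
  ...   | true = refl

module _ (t : ℕ) (xr : List Bool) where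

  weight : ⟦ Entry ⟧ᵗ → ℕ
  weight (w , _ , _) = val (proj₁ (uv t xr w)) + val (proj₂ (uv t xr w))

  -- The factor by which the common denominator grows in one stage, the same for both bits.
  weights : List ⟦ Entry ⟧ᵗ → ℕ
  weights []      = 1
  weights (e ∷ l) = weight e * weights l

  weights-pos : ∀ l → 1 ≤ weights l
  weights-pos []                = ≤-refl
  weights-pos ((w , P , Q) ∷ l) = *-mono-≤ (≤-trans (proj₁ (uv-pos t xr w)) (m≤m+n _ _)) (weights-pos l)

  cand-P : ∀ b w P → val (mul (false ∷ pick b (uv t xr w)) P) ≡ 2 * val (pick b (uv t xr w)) * val P
  cand-P b w P = val-mul (false ∷ pick b (uv t xr w)) P

  cand-Q : ∀ w Q → val (mul (add (proj₁ (uv t xr w)) (proj₂ (uv t xr w))) Q) ≡ weight (w , [] , []) * val Q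
  cand-Q w Q = trans (val-mul (add (proj₁ (uv t xr w)) (proj₂ (uv t xr w))) Q) (cong (_* val Q) (val-add (proj₁ (uv t xr w)) (proj₂ (uv t xr w))))

  cand-den : ∀ b l → den (map (cand b t xr) l) ≡ den l * weights l
  cand-den b []                = refl
  cand-den b ((w , P , Q) ∷ l) = trans (cong₂ _*_ (cand-Q w Q) (cand-den b l)) (eq (weight (w , P , Q)) (val Q) (den l) (weights l))
    where
    eq : ∀ x q d w → x * q * (d * w) ≡ q * d * (x * w)
    eq = solve-∀

  -- The two possible next totals average to the present one, over the common denominator.
  cand-num : ∀ l → num (map (cand false t xr) l) + num (map (cand true t xr) l) ≡ 2 * (num l * weights l)
  cand-num []                = refl
  cand-num ((w , P , Q) ∷ l) =
    trans (cong₂ _+_ (cong₂ _+_ (cong₂ _*_ (cand-P false w P) (cand-den false l)) (cong (_* num (map (cand false t xr) l)) (cand-Q w Q)))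
                     (cong₂ _+_ (cong₂ _*_ (cand-P true w P) (cand-den true l)) (cong (_* num (map (cand true t xr) l)) (cand-Q w Q))))
      (trans (eq₁ u v (val P) (den l * weights l) (val Q) (num (map (cand false t xr) l)) (num (map (cand true t xr) l)))
        (trans (cong (λ z → 2 * (u + v) * val P * (den l * weights l) + (u + v) * val Q * z) (cand-num l))
          (eq₂ (u + v) (val P) (den l) (weights l) (val Q) (num l))))
    where
    u = val (proj₁ (uv t xr w))
    v = val (proj₂ (uv t xr w))
    eq₁ : ∀ u v p d q n₀ n₁ → (2 * u * p * d + (u + v) * q * n₀) + (2 * v * p * d + (u + v) * q * n₁) ≡ 2 * (u + v) * p * d + (u + v) * q * (n₀ + n₁)
    eq₁ = solve-∀
    eq₂ : ∀ x p d w q n → 2 * x * p * (d * w) + x * q * (2 * (n * w)) ≡ 2 * ((p * d + q * n) * (x * w))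
    eq₂ = solve-∀

-- In fractions: a single capital is at most the total. Cross-multiplied, this holds even for zero
-- denominators.
∈-num : ∀ {e} l → e ∈ l → val (proj₁ (proj₂ e)) * den l ≤ num l * val (proj₂ (proj₂ e))
∈-num ((w , P , Q) ∷ l) (here refl) = m+k≡n⇒m≤n (val Q * num l * val Q) (eq (val P) (val Q) (den l) (num l))
  where
  eq : ∀ p q d n → p * (q * d) + q * n * q ≡ (p * d + q * n) * q
  eq = solve-∀
∈-num {w′ , P′ , Q′} ((w , P , Q) ∷ l) (there i) = ≤-trans (≤-reflexive (eq₁ (val P′) (val Q) (den l)))
    (≤-trans (*-monoʳ-≤ (val Q) (∈-num l i)) (m+k≡n⇒m≤n (val P * den l * val Q′) (eq₂ (val P) (val Q) (den l) (num l) (val Q′))))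
  where
  eq₁ : ∀ p q d → p * (q * d) ≡ q * (p * d)
  eq₁ = solve-∀
  eq₂ : ∀ p q d n q′ → q * (n * q′) + p * d * q′ ≡ (p * d + q * n) * q′
  eq₂ = solve-∀

1≤* : ∀ m n → 1 ≤ m * n → 1 ≤ m × 1 ≤ n
1≤* (suc m) (suc n) _  = s≤s z≤n , s≤s z≤n
1≤* (suc m) zero    le with () ← subst (1 ≤_) (*-zeroʳ m) le

∈-den : ∀ {e} l → e ∈ l → 1 ≤ den l → 1 ≤ val (proj₂ (proj₂ e))
∈-den ((w , P , Q) ∷ l) (here refl) le = proj₁ (1≤* (val Q) (den l) le)
∈-den ((w , P , Q) ∷ l) (there i)   le = ∈-den l i (proj₂ (1≤* (val Q) (den l) le))

-- Adding the polynomial X forces a nonzero higher coefficient, as `Polynomial` demands, and only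
-- increases the values.
addX : List ℕ → List ℕ
addX []           = 0 ∷ 1 ∷ []
addX (a ∷ [])     = a ∷ 1 ∷ []
addX (a ∷ b ∷ as) = a ∷ suc b ∷ as

addX-eval : ∀ as n → evalPoly (addX as) n ≡ n + evalPoly as n
addX-eval []           n = trans (cong (n *_) (cong suc (*-zeroʳ n))) (trans (*-identityʳ n) (sym (+-identityʳ n)))
addX-eval (a ∷ [])     n = trans (cong (λ z → a + n * suc z) (*-zeroʳ n)) (trans (eq a n) (cong (λ z → n + (a + z)) (sym (*-zeroʳ n))))
  where
  eq : ∀ a n → a + n * 1 ≡ n + (a + 0)
  eq = solve-∀
addX-eval (a ∷ b ∷ as) n = eq a b n (n * evalPoly as n)
  where
  eq : ∀ a b n m → a + n * (suc b + m) ≡ n + (a + n * (b + m))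
  eq = solve-∀

addX-nonConstant : ∀ as → NonConstant (addX as)
addX-nonConstant []           = here λ ()
addX-nonConstant (a ∷ [])     = here λ ()
addX-nonConstant (a ∷ b ∷ as) = here λ ()

-- Multiplication of a coefficient list by 2 + X; `c` is the previous coefficient, moved up one
-- place by X.
times2+X : ℕ → List ℕ → List ℕ
times2+X c []       = c ∷ []
times2+X c (a ∷ as) = (2 * a + c) ∷ times2+X a as

times2+X-eval : ∀ c as n → evalPoly (times2+X c as) n ≡ c + (2 + n) * evalPoly as n
times2+X-eval c []       n = cong (c +_) (trans (*-zeroʳ n) (sym (*-zeroʳ (2 + n))))
times2+X-eval c (a ∷ as) n = trans (cong (λ z → 2 * a + c + n * z) (times2+X-eval a as n)) (eq a c n (evalPoly as n))
  where
  eq : ∀ a c n e → 2 * a + c + n * (a + (2 + n) * e) ≡ c + (2 + n) * (a + n * e)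
  eq = solve-∀

powCoeffs : ℕ → List ℕ
powCoeffs zero    = 1 ∷ []
powCoeffs (suc c) = times2+X 0 (powCoeffs c)

powCoeffs-eval : ∀ c n → evalPoly (powCoeffs c) n ≡ (2 + n) ^ c
powCoeffs-eval zero    n = cong suc (*-zeroʳ n)
powCoeffs-eval (suc c) n = trans (times2+X-eval 0 (powCoeffs c) n) (cong ((2 + n) *_) (powCoeffs-eval c n))

opaque
  powPoly : ℕ → Polynomial
  powPoly c = poly (addX (powCoeffs c)) (addX-nonConstant (powCoeffs c))

  powPoly-bound : ∀ c n → (2 + n) ^ c ≤ powPoly c ⟦ n ⟧
  powPoly-bound c n = ≤-trans (m≤n+m _ n) (≤-reflexive (sym (trans (addX-eval (powCoeffs c) n) (cong (n +_) (powCoeffs-eval c n)))))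

numℕ denℕ : ℚ → ℕ
numℕ q = ℤ.∣ ℚ.numerator q ∣
denℕ q = ℚ.denominatorℕ q

pos-numerator : ∀ q → 0ℚ ℚ.< q → ℚ.numerator q ≡ ℤ.+ numℕ q × 1 ≤ numℕ q
pos-numerator (mkℚ (ℤ.+ zero)      d c) (ℚ.*<* (ℤ.+<+ ()))
pos-numerator (mkℚ ℤ.+[1+ n ]    d c) _ = refl , s≤s z≤n
pos-numerator (mkℚ (ℤ.-[1+ n ])  d c) (ℚ.*<* ())

average-ℕ : ∀ q r s → 0ℚ ℚ.< q → 0ℚ ℚ.< r → 0ℚ ℚ.< s → q ≡ ½ ℚ.* (r ℚ.+ s) →
  numℕ q * (2 * (denℕ r * denℕ s)) ≡ (numℕ r * denℕ s + numℕ s * denℕ r) * denℕ q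
average-ℕ q@(mkℚ (ℤ.+[1+ a ]) b _) r@(mkℚ (ℤ.+[1+ a₀ ]) b₀ _) s@(mkℚ (ℤ.+[1+ a₁ ]) b₁ _) _ _ _ e
  with ℚᵘ.≃-trans (ℚ.toℚᵘ-cong e) (ℚᵘ.≃-trans (ℚ.toℚᵘ-homo-* ½ (r ℚ.+ s)) (ℚᵘ.*-congˡ {ℚ.toℚᵘ ½} (ℚ.toℚᵘ-homo-+ r s)))
... | *≡* eq = trans (ℤ.+-injective eq) (cong (_* suc b) (+-identityʳ (suc a₀ * suc b₁ + suc a₁ * suc b₀)))
average-ℕ (mkℚ (ℤ.+ zero) _ _)     _ _ (ℚ.*<* (ℤ.+<+ ())) _ _ _
average-ℕ (mkℚ ℤ.-[1+ _ ] _ _)   _ _ (ℚ.*<* ()) _ _ _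
average-ℕ (mkℚ ℤ.+[1+ _ ] _ _) (mkℚ (ℤ.+ zero) _ _)   _ _ (ℚ.*<* (ℤ.+<+ ())) _ _
average-ℕ (mkℚ ℤ.+[1+ _ ] _ _) (mkℚ ℤ.-[1+ _ ] _ _) _ _ (ℚ.*<* ()) _ _
average-ℕ (mkℚ ℤ.+[1+ _ ] _ _) (mkℚ ℤ.+[1+ _ ] _ _) (mkℚ (ℤ.+ zero) _ _)   _ _ (ℚ.*<* (ℤ.+<+ ())) _
average-ℕ (mkℚ ℤ.+[1+ _ ] _ _) (mkℚ ℤ.+[1+ _ ] _ _) (mkℚ ℤ.-[1+ _ ] _ _) _ _ (ℚ.*<* ()) _

above-ℕ : ∀ k q → (ℤ.+ k ℚ./ 1) ℚ.< q → 0ℚ ℚ.< q → k * denℕ q < numℕ q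
above-ℕ k q@(mkℚ (ℤ.+[1+ a ]) b _) h _ with ℚᵘ.<-respˡ-≃ (ℚ.toℚᵘ-fromℚᵘ (mkℚᵘ (ℤ.+ k) 0)) (ℚ.toℚᵘ-mono-< h)
... | *<* lt = ℤ.drop‿+<+ (subst₂ ℤ._<_ (sym (ℤ.pos-* k (suc b))) (ℤ.*-identityʳ _) lt)
above-ℕ k (mkℚ (ℤ.+ zero) _ _)   _ (ℚ.*<* (ℤ.+<+ ()))
above-ℕ k (mkℚ ℤ.-[1+ _ ] _ _) _ (ℚ.*<* ())

module Randomness (S : ℕ → ℕ) (Sₚ : PT 𝕟 𝕟 S)
  (sparse : (p : Polynomial) → (m : ℕ) → Σ ℕ (λ n → (m ≤ n) × (p ⟦ S n ⟧ ≤ n))) where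

  open Construction S Sₚ

  lev-bump : ∀ n → bump n (lev n) ≡ true → lev (suc n) ≡ suc (lev n)
  lev-bump n h rewrite h = refl

  -- Given `k` of level at least `e`, sparseness for a polynomial above (2 + X) ^ (1 + lev k) yields
  -- a witness `n ≥ k`. Either the level has risen between `k` and `n`, or it is still `lev k` and
  -- then `n` itself is counted.
  level-reached : ∀ e → ∃ λ k → e ≤ lev k
  level-reached zero    = 0 , z≤n
  level-reached (suc e) with level-reached e
  ... | k , le with sparse (powPoly (suc (lev k))) k
  ... | n , k≤n , h with m≤n⇒m<n∨m≡n (lev-mono k≤n)
  ... | inj₁ lt = n , ≤-trans (s≤s le) lt
  ... | inj₂ eq = suc n , ≤-trans (s≤s (≤-trans le (≤-reflexive eq)))
      (≤-reflexive (sym (lev-bump n (bump-complete n (lev n) (≤-trans (≤-reflexive (cong (λ z → (2 + S n) ^ suc z) (sym eq))) (≤-trans (powPoly-bound (suc (lev k)) (S n)) h))))))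

  ents : ℕ → List ⟦ Entry ⟧ᵗ
  ents k = entries (σ full k)

  chosen : ℕ → List ⟦ Entry ⟧ᵗ
  chosen k = cond (choice (clk k) (σ full k)) (cands true (clk k) (σ full k)) (cands false (clk k) (σ full k))

  ents-suc : ∀ k → ents (suc k) ≡ (toBits k , one , pow2 (suc k)) ∷ chosen k
  ents-suc k = trans (cong entries (σ-step full k)) (cong (λ j → (toBits j , one , pow2 (suc j)) ∷ chosen k) (σ-position full k))

  Z-choice : ∀ k → Z k ≡ choice (clk k) (σ full k)
  Z-choice k = trans (cong (λ s → hdb (word s)) (σ-step full k)) (stage-head (clk k) (σ full k))
    where
    stage-head : ∀ t s → hdb (word (stage t s)) ≡ choice t s
    stage-head t s = refl

  wts : ℕ → ℕ
  wts k = weights (clk k) (word (σ full k)) (ents k)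

  chosen-den : ∀ k → den (chosen k) ≡ den (ents k) * wts k
  chosen-den k with choice (clk k) (σ full k)
  ... | true  = cand-den (clk k) (word (σ full k)) true (ents k)
  ... | false = cand-den (clk k) (word (σ full k)) false (ents k)

  -- Over the common denominator the two candidate totals average to the present total, so the
  -- smaller one does not exceed it.
  chosen-num : ∀ k → num (chosen k) ≤ num (ents k) * wts k
  chosen-num k = pick-min _ refl
    where
    s = σ full k
    E₀ = cands false (clk k) s
    E₁ = cands true (clk k) s
    both : num E₀ + num E₁ ≡ 2 * (num (ents k) * wts k)
    both = cand-num (clk k) (word s) (ents k)
    halve : ∀ {x y} → x ≤ y → x + y ≡ 2 * (num (ents k) * wts k) → x ≤ num (ents k) * wts k
    halve {x} le e = *-cancelˡ-≤ 2 (≤-trans (≤-reflexive (cong (λ z → x + z) (+-identityʳ x))) (≤-trans (+-monoʳ-≤ x le) (≤-reflexive e)))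
    pick-min : ∀ b → leqB (proj₁ (frac E₀)) (proj₁ (frac E₁)) ≡ b → num (cond (choice (clk k) s) E₁ E₀) ≤ num (ents k) * wts k
    pick-min true e rewrite e = halve (subst₂ _≤_ (proj₁ (frac-val E₀)) (proj₁ (frac-val E₁)) (leqB-true (proj₁ (frac E₀)) (proj₁ (frac E₁)) e)) both
    pick-min false e rewrite e = halve (subst₂ _≤_ (proj₁ (frac-val E₁)) (proj₁ (frac-val E₀)) (<⇒≤ (leqB-false (proj₁ (frac E₀)) (proj₁ (frac E₁)) e)))
      (trans (+-comm (num E₁) (num E₀)) both)

  -- The total capital is at most 2 - 2 ^ (- k).
  potential : ∀ k → 1 ≤ den (ents k) × num (ents k) * 2 ^ k + den (ents k) ≤ 2 * (den (ents k) * 2 ^ k)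
  potential zero    rewrite σ-zero full = ≤-refl , s≤s z≤n
  potential (suc k) with potential k
  ... | pos , le rewrite ents-suc k | val-pow2 (suc k) | chosen-den k =
      *-mono-≤ (m^n>0 2 (suc k)) (*-mono-≤ pos (weights-pos (clk k) (word (σ full k)) (ents k)))
    -- The newcomer brings 1 / (2t), which uses up half of the reserve 1 / t left by the previous
    -- stage.
    , ≤-trans (≤-reflexive (eq₁ (d * w) (num (chosen k)) t)) (≤-trans (*-monoʳ-≤ (4 * t) scaled) (≤-reflexive (eq₃ (d * w) t)))
    where
    t = 2 ^ k
    d = den (ents k)
    w = wts k
    eq₁ : ∀ c n t → (1 * c + 2 * t * n) * (2 * t) + 2 * t * c ≡ 4 * t * (n * t + c)
    eq₁ = solve-∀
    eq₂ : ∀ n w t d → n * w * t + d * w ≡ w * (n * t + d)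
    eq₂ = solve-∀
    eq₃ : ∀ c t → 4 * t * (2 * (c * t)) ≡ 2 * (2 * t * c * (2 * t))
    eq₃ = solve-∀
    eq₄ : ∀ w d t → w * (2 * (d * t)) ≡ 2 * (d * w * t)
    eq₄ = solve-∀
    scaled : num (chosen k) * t + d * w ≤ 2 * (d * w * t)
    scaled = ≤-trans (+-monoˡ-≤ (d * w) (*-monoˡ-≤ t (chosen-num k))) (≤-trans (≤-reflexive (eq₂ (num (ents k)) w t d)) (≤-trans (*-monoʳ-≤ w le) (≤-reflexive (eq₄ w d t))))

  capital-bound : ∀ k {e} → e ∈ ents k → val (proj₁ (proj₂ e)) ≤ 2 * val (proj₂ (proj₂ e))
  capital-bound k {w , P , Q} i = *-cancelʳ-≤ (val P) (2 * val Q) (den (ents k)) {{>-nonZero pos}}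
    (≤-trans (∈-num (ents k) i) (≤-trans (*-monoˡ-≤ (val Q) total) (≤-reflexive (eq (den (ents k)) (val Q)))))
    where
    pos = proj₁ (potential k)
    total : num (ents k) ≤ 2 * den (ents k)
    total = *-cancelʳ-≤ (num (ents k)) (2 * den (ents k)) (2 ^ k) {{m^n≢0 2 k}}
      (≤-trans (m≤m+n _ (den (ents k))) (≤-trans (proj₂ (potential k)) (≤-reflexive (sym (*-assoc 2 (den (ents k)) (2 ^ k))))))
    eq : ∀ d q → 2 * d * q ≡ 2 * q * d
    eq = solve-∀

  next-entry : ∀ k {e} → e ∈ ents k → cand (Z k) (clk k) (word (σ full k)) e ∈ ents (suc k)
  next-entry k {e} i = subst₂ (λ b l → cand b (clk k) (word (σ full k)) e ∈ l) (sym (Z-choice k)) (sym (ents-suc k)) (there (inside (choice (clk k) (σ full k))))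
    where
    inside : ∀ b → cand b (clk k) (word (σ full k)) e ∈ cond b (cands true (clk k) (σ full k)) (cands false (clk k) (σ full k))
    inside true  = ∈-map⁺ (cand true (clk k) (word (σ full k))) i
    inside false = ∈-map⁺ (cand false (clk k) (word (σ full k))) i

  -- An endowment never shrinks to zero, because both parts of a betting ratio are positive. A
  -- positive `P` at stage `k₀` makes the proportionality factor with the martingale meaningful.
  has-entry : ∀ i m → ∃₂ λ P Q → (toBits i , P , Q) ∈ ents (suc i + m) × 1 ≤ val P
  has-entry i zero = one , pow2 (suc i) , subst ((toBits i , one , pow2 (suc i)) ∈_) (trans (sym (ents-suc i)) (cong ents (sym (+-identityʳ (suc i))))) (here refl) , ≤-refl
  has-entry i (suc m) with has-entry i m
  ... | P , Q , e , pos = P′ , Q′ , subst (λ k → (toBits i , P′ , Q′) ∈ ents k) (sym (+-suc (suc i) m)) (next-entry (suc i + m) e) ,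
    ≤-trans (*-mono-≤ (≤-trans (s≤s z≤n) (*-monoʳ-≤ 2 (picked (Z (suc i + m))))) pos) (≤-reflexive (sym (cand-P t xr (Z (suc i + m)) (toBits i) P)))
    where
    t = clk (suc i + m)
    xr = word (σ full (suc i + m))
    P′ = mul (false ∷ pick (Z (suc i + m)) (uv t xr (toBits i))) P
    Q′ = mul (add (proj₁ (uv t xr (toBits i))) (proj₂ (uv t xr (toBits i)))) Q
    picked : ∀ b → 1 ≤ val (pick b (uv t xr (toBits i)))
    picked true  = proj₂ (uv-pos t xr (toBits i))
    picked false = proj₁ (uv-pos t xr (toBits i))

  module _ (d : Martingale) (T : TM) (p : Polynomial)
    (halts : ∀ x → HaltsWith T (map bitSym x) (p ⟦ length x ⟧) (encodeℚ (Martingale.M d x))) where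

    open Martingale d
    open Universal T

    a b : List Bool → ℕ
    a x = numℕ (M x)
    b x = denℕ (M x)

    a-pos : ∀ x → 1 ≤ a x
    a-pos x = proj₂ (pos-numerator (M x) (positive x))

    fairℕ : ∀ x → a x * (2 * (b (x ++ false ∷ []) * b (x ++ true ∷ []))) ≡
      (a (x ++ false ∷ []) * b (x ++ true ∷ []) + a (x ++ true ∷ []) * b (x ++ false ∷ [])) * b x
    fairℕ x = average-ℕ (M x) (M (x ++ false ∷ [])) (M (x ++ true ∷ [])) (positive x) (positive _) (positive _) (fair x)

    evaluate-M : ∀ x t → p ⟦ length x ⟧ ≤ t → evaluate (toBits index) t x ≡ (toBits (a x) , toBits (b x))
    evaluate-M x t le = trans (evaluate-index x (p ⟦ length x ⟧) t (halts x) le)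
      (trans (parse-fraction (binary (a x)) (binary (b x))) (cong₂ _,_ (unbinary (a x)) (unbinary (b x))))
      where
      unbinary : ∀ n → reverse (binary n) ≡ toBits n
      unbinary n = trans (cong reverse (binary-toBits n)) (reverse-involutive (toBits n))

    deg : ℕ
    deg = proj₁ (evalPoly-bound (Polynomial.coeffs p))

    -- From here on, the martingale is simulated to the end at every stage.
    k₀ : ℕ
    k₀ = suc index + proj₁ (level-reached (2 * deg))

    -- The machine is queried on words one bit longer than the prefix. The estimate 3 + k ≤ (2 + k)
    -- ^ 2 absorbs that bit by doubling the exponent, whence the level `2 * deg` in `k₀`.
    enough-time : ∀ k → k₀ ≤ k → p ⟦ suc k ⟧ ≤ clk k
    enough-time k le = ≤-trans (proj₂ (evalPoly-bound (Polynomial.coeffs p)) (suc k)) (≤-trans (^-monoˡ-≤ deg square)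
        (≤-trans (≤-reflexive (^-*-assoc (2 + k) 2 deg)) (^-monoʳ-≤ (2 + k) (≤-trans (proj₂ (level-reached (2 * deg)))
          (≤-trans (lev-mono (≤-trans (m≤n+m _ (suc index)) le)) (n≤1+n _))))))
      where
      square : 2 + suc k ≤ (2 + k) ^ 2
      square = m+k≡n⇒m≤n (k * k + 3 * k + 1) (eq k)
        where
        eq : ∀ k → 2 + suc k + (k * k + 3 * k + 1) ≡ (2 + k) * ((2 + k) * 1)
        eq = solve-∀

    x₀ x₁ : ℕ → List Bool
    x₀ k = (Z ↾ k) ++ false ∷ []
    x₁ k = (Z ↾ k) ++ true ∷ []

    next-word : ∀ k c → reverse (c ∷ word (σ full k)) ≡ (Z ↾ k) ++ c ∷ []
    next-word k c = trans (unfold-reverse c (word (σ full k))) (cong (_++ c ∷ []) (sym (word-Z k)))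

    length-next : ∀ k c → length ((Z ↾ k) ++ c ∷ []) ≡ suc k
    length-next k c = trans (length-++ (Z ↾ k)) (trans (+-comm _ 1) (cong suc (trans (length-map Z (upTo k)) (length-upTo k))))

    evaluate-next : ∀ k c → k₀ ≤ k → evaluate (toBits index) (clk k) (reverse (c ∷ word (σ full k))) ≡ (toBits (a ((Z ↾ k) ++ c ∷ [])) , toBits (b ((Z ↾ k) ++ c ∷ [])))
    evaluate-next k c le = trans (cong (evaluate (toBits index) (clk k)) (next-word k c))
      (evaluate-M _ (clk k) (≤-trans (≤-reflexive (cong (p ⟦_⟧) (length-next k c))) (enough-time k le)))

    val-raw : ∀ k → k₀ ≤ k → val (proj₁ (raw (clk k) (word (σ full k)) (toBits index))) ≡ a (x₀ k) * b (x₁ k)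
                           × val (proj₂ (raw (clk k) (word (σ full k)) (toBits index))) ≡ a (x₁ k) * b (x₀ k)
    val-raw k le = product (a (x₀ k)) (b (x₁ k)) (cong proj₁ (evaluate-next k false le)) (cong proj₂ (evaluate-next k true le))
                 , product (a (x₁ k)) (b (x₀ k)) (cong proj₁ (evaluate-next k true le)) (cong proj₂ (evaluate-next k false le))
      where
      product : ∀ m n {u v} → u ≡ toBits m → v ≡ toBits n → val (mul u v) ≡ m * n
      product m n refl refl = trans (val-mul (toBits m) (toBits n)) (cong₂ _*_ (val-toBits m) (val-toBits n))

    val-uv : ∀ k → k₀ ≤ k → val (proj₁ (uv (clk k) (word (σ full k)) (toBits index))) ≡ a (x₀ k) * b (x₁ k)
                          × val (proj₂ (uv (clk k) (word (σ full k)) (toBits index))) ≡ a (x₁ k) * b (x₀ k)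
    val-uv k le = trans (cong (val ∘ proj₁) same) (proj₁ (val-raw k le)) , trans (cong (val ∘ proj₂) same) (proj₂ (val-raw k le))
      where
      same = uv-raw (clk k) (word (σ full k)) (toBits index)
        (≤-trans (*-mono-≤ (a-pos (x₀ k)) (s≤s z≤n)) (≤-reflexive (sym (proj₁ (val-raw k le)))))
        (≤-trans (*-mono-≤ (a-pos (x₁ k)) (s≤s z≤n)) (≤-reflexive (sym (proj₂ (val-raw k le)))))

    -- The simulated capital stays proportional to the martingale; stated without division.
    step-ratio : ∀ c₁ c₂ A B A₀ B₀ A₁ B₁ P Q → 1 ≤ B → A * (2 * (B₀ * B₁)) ≡ (A₀ * B₁ + A₁ * B₀) * B → A * Q * c₁ ≡ B * P * c₂ →
      A₀ * ((A₀ * B₁ + A₁ * B₀) * Q) * c₁ ≡ B₀ * (2 * (A₀ * B₁) * P) * c₂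
    step-ratio c₁ c₂ A B A₀ B₀ A₁ B₁ P Q pos fair inv = *-cancelʳ-≡ _ _ B {{>-nonZero pos}}
      (trans (eq₁ A₀ (A₀ * B₁ + A₁ * B₀) Q c₁ B) (trans (cong (λ z → A₀ * Q * c₁ * z) (sym fair)) (trans (eq₂ A A₀ Q c₁ B₀ B₁)
        (trans (cong (λ z → 2 * (B₀ * (A₀ * B₁)) * z) inv) (eq₃ B₀ A₀ B₁ B P c₂)))))
      where
      eq₁ : ∀ A₀ w Q c B → A₀ * (w * Q) * c * B ≡ A₀ * Q * c * (w * B)
      eq₁ = solve-∀
      eq₂ : ∀ A A₀ Q c B₀ B₁ → A₀ * Q * c * (A * (2 * (B₀ * B₁))) ≡ 2 * (B₀ * (A₀ * B₁)) * (A * Q * c)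
      eq₂ = solve-∀
      eq₃ : ∀ B₀ A₀ B₁ B P c → 2 * (B₀ * (A₀ * B₁)) * (B * P * c) ≡ B₀ * (2 * (A₀ * B₁) * P) * c * B
      eq₃ = solve-∀

    -- From `k₀` on, each bit multiplies the martingale and the simulated capital by the same
    -- factor. The constants are arbitrary here; they will be the cross products of the two
    -- fractions at `k₀`.
    ratio : ∀ m → let k = k₀ + m in
      (c₁ c₂ : ℕ) → (∃₂ λ P Q → (toBits index , P , Q) ∈ ents k₀ × a (Z ↾ k₀) * val Q * c₁ ≡ b (Z ↾ k₀) * val P * c₂) →
      ∃₂ λ P Q → (toBits index , P , Q) ∈ ents k × a (Z ↾ k) * val Q * c₁ ≡ b (Z ↾ k) * val P * c₂
    ratio zero    c₁ c₂ h = subst (λ k → ∃₂ λ P Q → (toBits index , P , Q) ∈ ents k × a (Z ↾ k) * val Q * c₁ ≡ b (Z ↾ k) * val P * c₂) (sym (+-identityʳ k₀)) h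
    ratio (suc m) c₁ c₂ h with ratio m c₁ c₂ h
    ... | P , Q , e , inv = subst (λ k → ∃₂ λ P Q → (toBits index , P , Q) ∈ ents k × a (Z ↾ k) * val Q * c₁ ≡ b (Z ↾ k) * val P * c₂) (sym (+-suc k₀ m))
        (P′ , Q′ , next-entry k e , new-ratio (Z k) refl)
      where
      k = k₀ + m
      t = clk k
      xr = word (σ full k)
      k≥ : k₀ ≤ k
      k≥ = m≤m+n k₀ m
      P′ = mul (false ∷ pick (Z k) (uv t xr (toBits index))) P
      Q′ = mul (add (proj₁ (uv t xr (toBits index))) (proj₂ (uv t xr (toBits index)))) Q
      Z-snoc : Z ↾ suc k ≡ (Z ↾ k) ++ Z k ∷ []
      Z-snoc = trans (cong (map Z) (sym (upTo-∷ʳ k))) (map-++ Z (upTo k) (k ∷ []))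
      A = a (Z ↾ k)
      Bₖ = b (Z ↾ k)
      valQ : val Q′ ≡ (a (x₀ k) * b (x₁ k) + a (x₁ k) * b (x₀ k)) * val Q
      valQ = trans (cand-Q t xr (toBits index) Q) (cong (_* val Q) (cong₂ _+_ (proj₁ (val-uv k k≥)) (proj₂ (val-uv k k≥))))
      new-ratio : ∀ c → Z k ≡ c → a (Z ↾ suc k) * val Q′ * c₁ ≡ b (Z ↾ suc k) * val P′ * c₂
      new-ratio false eq = trans (cong₂ (λ x q → a x * q * c₁) at-next valQ)
          (trans (step-ratio c₁ c₂ A Bₖ (a (x₀ k)) (b (x₀ k)) (a (x₁ k)) (b (x₁ k)) (val P) (val Q) (s≤s z≤n) (fairℕ (Z ↾ k)) inv)
            (cong₂ (λ x q → b x * q * c₂) (sym at-next) (sym valP)))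
        where
        at-next : Z ↾ suc k ≡ x₀ k
        at-next = trans Z-snoc (cong (λ c → (Z ↾ k) ++ c ∷ []) eq)
        valP : val P′ ≡ 2 * (a (x₀ k) * b (x₁ k)) * val P
        valP = trans (cand-P t xr (Z k) (toBits index) P) (cong (λ z → 2 * z * val P) (trans (cong (λ c → val (pick c (uv t xr (toBits index)))) eq) (proj₁ (val-uv k k≥))))
      -- The same computation with the two successors interchanged, fairness being symmetric in
      -- them.
      new-ratio true eq = trans (cong₂ (λ x q → a x * q * c₁) at-next (trans valQ (cong (_* val Q) (+-comm (a (x₀ k) * b (x₁ k)) _))))
          (trans (step-ratio c₁ c₂ A Bₖ (a (x₁ k)) (b (x₁ k)) (a (x₀ k)) (b (x₀ k)) (val P) (val Q) (s≤s z≤n)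
              (trans (cong (λ z → A * (2 * z)) (*-comm (b (x₁ k)) (b (x₀ k)))) (trans (fairℕ (Z ↾ k)) (cong (_* Bₖ) (+-comm (a (x₀ k) * b (x₁ k)) _)))) inv)
            (cong₂ (λ x q → b x * q * c₂) (sym at-next) (sym valP)))
        where
        at-next : Z ↾ suc k ≡ x₁ k
        at-next = trans Z-snoc (cong (λ c → (Z ↾ k) ++ c ∷ []) eq)
        valP : val P′ ≡ 2 * (a (x₁ k) * b (x₀ k)) * val P
        valP = trans (cand-P t xr (Z k) (toBits index) P) (cong (λ z → 2 * z * val P) (trans (cong (λ c → val (pick c (uv t xr (toBits index)))) eq) (proj₂ (val-uv k k≥))))

    bounded-on-Z : ∃ λ c → ∀ k → k₀ ≤ k → a (Z ↾ k) ≤ c * b (Z ↾ k)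
    bounded-on-Z with has-entry index (proj₁ (level-reached (2 * deg)))
    ... | P₀ , Q₀ , e₀ , pos₀ = 2 * c₂ , bound
      where
      c₁ = b (Z ↾ k₀) * val P₀
      c₂ = a (Z ↾ k₀) * val Q₀
      bound : ∀ k → k₀ ≤ k → a (Z ↾ k) ≤ 2 * c₂ * b (Z ↾ k)
      bound k le with m≤n⇒∃[o]m+o≡n le
      ... | m , refl with ratio m c₁ c₂ (P₀ , Q₀ , e₀ , *-comm c₂ c₁)
      ... | P , Q , e , inv = ≤-trans (m≤m*n A c₁ {{>-nonZero c₁-pos}}) (*-cancelʳ-≤ (A * c₁) (2 * c₂ * Bₖ) (val Q) {{>-nonZero Q-pos}}
          (≤-trans (≤-reflexive (trans (eq₁ A c₁ (val Q)) inv)) (≤-trans (*-monoˡ-≤ c₂ (*-monoʳ-≤ Bₖ (capital-bound (k₀ + m) e))) (≤-reflexive (eq₂ Bₖ (val Q) c₂)))))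
        where
        A = a (Z ↾ (k₀ + m))
        Bₖ = b (Z ↾ (k₀ + m))
        c₁-pos : 1 ≤ c₁
        c₁-pos = *-mono-≤ {1} {b (Z ↾ k₀)} (s≤s z≤n) pos₀
        Q-pos : 1 ≤ val Q
        Q-pos = ∈-den (ents (k₀ + m)) e (proj₁ (potential (k₀ + m)))
        eq₁ : ∀ A c q → A * c * q ≡ A * q * c
        eq₁ = solve-∀
        eq₂ : ∀ B q c → B * (2 * q) * c ≡ 2 * c * B * q
        eq₂ = solve-∀

    not-succeeds : ¬ Succeeds d Z
    not-succeeds succ with bounded-on-Z
    ... | c , bound with succ c k₀
    ... | n , le , lt = <⇒≱ (above-ℕ c (M (Z ↾ n)) lt (positive (Z ↾ n))) (bound n le)

  Z-random : PolyTimeRandom Z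
  Z-random d (T , p , halts) = not-succeeds d T p halts

-- Input and output

-- The input starts at the edge of the recorded tape. The second move to the left makes the blank in
-- front of the layout explicit, and the three separators written after the input create the empty
-- stacks.
open-home prepare : Prog
open-home = moveL ⨾ write sep ⨾ moveL ⨾ moveR ⨾ moveR
prepare   = open-home ⨾ walkR nonblank ⨾ write sep ⨾ moveR ⨾ write sep ⨾ moveR ⨾ write sep ⨾ home

write-end : ∀ {b ls} m → write b ⊢ from ls (blanks m) ⇓ from ls (b ∷ blanks (m ∸ 1)) # 1
write-end zero    = stop refl
write-end (suc m) = stop refl

open-home-run : ∀ w → ∃ λ m → open-home ⊢ from [] (bits w) ⇓ from (sep ∷ blank ∷ []) (bits w ++ blanks m) # 5
open-home-run []      = 1 , (stop {t = 0} refl ⨟ stop {t = 0} refl ⨟ stop {t = 0} refl ⨟ stop {t = 0} refl ⨟ stop {t = 0} refl)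
open-home-run (b ∷ w) = 0 , subst (λ z → open-home ⊢ from [] (bits (b ∷ w)) ⇓ from (sep ∷ blank ∷ []) z # 5)
  (sym (++-identityʳ (bits (b ∷ w)))) (stop {t = 0} refl ⨟ stop {t = 0} refl ⨟ stop {t = 0} refl ⨟ stop {t = 0} refl ⨟ stop {t = 0} refl)

prepare-run : ∀ w → ∃ λ τ → Home (main w) τ × (prepare ⊢ from [] (bits w) ⇓ τ # 4 * length w + 22)
prepare-run w = _ , at-end , weaken (≤-reflexive time≡)
    (proj₂ (open-home-run w) ⨟ walkR-run (bits w) (bits-nonblank w) (cong nonblank (head-blanks _ m)) ⨟
     write-end m ⨟ moveR-run ⨟ write-end (m ∸ 1) ⨟ moveR-run ⨟ write-end (m ∸ 1 ∸ 1) ⨟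
     subst (λ l → home ⊢ from l (sep ∷ blanks m₃) ⇓ from (blank ∷ []) ((sep ∷ u) ++ sep ∷ blanks m₃) # 2 * length (sep ∷ u) + 5) (++-ʳ++ (bits w)) (home-run sep u nb))
  where
  m = proj₁ (open-home-run w)
  m₃ = m ∸ 1 ∸ 1 ∸ 1
  u : List Sym
  u = bits w ++ sep ∷ sep ∷ []
  nb : NonBlank (sep ∷ u)
  nb = refl ∷ ++⁺ (bits-nonblank w) (refl ∷ refl ∷ [])
  at-end : Home (main w) (from (blank ∷ []) ((sep ∷ u) ++ sep ∷ blanks m₃))
  at-end = subst (λ z → Home (main w) (from (blank ∷ []) (sep ∷ z))) (trans (++-assoc (bits w) _ (blanks m₃)) (sym (++-assoc (bits w) (sep ∷ sep ∷ []) (sep ∷ blanks m₃)))) (at-home m₃)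
  time≡ : 5 + (2 * length (bits w) + 1 + (1 + (1 + (1 + (1 + (1 + (2 * length (sep ∷ u) + 5))))))) ≡ 4 * length w + 22
  time≡ = trans (cong₂ (λ a b → 5 + (2 * a + 1 + (1 + (1 + (1 + (1 + (1 + (2 * suc b + 5)))))))) (length-map bitSym w) (trans (length-++ (bits w)) (cong (_+ 2) (length-map bitSym w)))) (eq (length w))
    where
    eq : ∀ n → 5 + (2 * n + 1 + (1 + (1 + (1 + (1 + (1 + (2 * suc (n + 2) + 5))))))) ≡ 4 * n + 22
    eq = solve-∀

toTree : SProg 4
toTree = loop 𝖠 (push 𝖡) ▷ push 𝖠 false ▷ loop 𝖡 (λ b → if b then push 𝖠 false ▷ push 𝖠 false ▷ push 𝖠 true ▷ push 𝖠 true else (push 𝖠 false ▷ push 𝖠 true))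

pour-run : ∀ w {β} → loop 𝖠 (push 𝖡) ⊩ stacks w β [] [] ⇓ stacks [] (w ʳ++ β) [] [] # 2 * length w + 1
pour-run []      = loop-end refl
pour-run (b ∷ w) = slack (≤-reflexive (cong (_+ 1) (sym (*-distribˡ-+ 2 1 (length w))))) (loop-bit refl run-push (pour-run w))

build-run : ∀ β l → loop 𝖡 (λ b → if b then push 𝖠 false ▷ push 𝖠 false ▷ push 𝖠 true ▷ push 𝖠 true else (push 𝖠 false ▷ push 𝖠 true))
  ⊩ stacks (code (enc Num l)) β [] [] ⇓ main (code (enc Num (β ʳ++ l))) # 5 * length β + 1
build-run []          l = loop-end refl
build-run (true ∷ β)  l = slack (≤-reflexive (cong (_+ 1) (sym (*-distribˡ-+ 5 1 (length β))))) (loop-bit refl (run-push ⟫ run-push ⟫ run-push ⟫ run-push) (build-run β (true ∷ l)))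
build-run (false ∷ β) l = slack (≤-trans (m≤n+m _ 2) (≤-reflexive (cong (_+ 1) (sym (*-distribˡ-+ 5 1 (length β)))))) (loop-bit refl (run-push ⟫ run-push) (build-run β (false ∷ l)))

toTree-run : ∀ w → toTree ⊩ main w ⇓ main (code (enc Num w) ++ []) # 7 * length w + 3
toTree-run w = subst₂ (λ v n → toTree ⊩ main w ⇓ main v # n) (trans (cong (λ l → code (enc Num l)) (trans (ʳ++-ʳ++ w) (++-identityʳ w))) (sym (++-identityʳ _)))
  (trans (cong (λ z → 2 * length w + 1 + (1 + (5 * z + 1))) (trans (length-ʳ++ w) (+-identityʳ _))) (eq (length w)))
  (pour-run w ⟫ run-push ⟫ build-run (w ʳ++ []) [])
  where
  eq : ∀ n → 2 * n + 1 + (1 + (5 * n + 1)) ≡ 7 * n + 3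
  eq = solve-∀

unbuild : Bool → SProg 4
unbuild _ = pop 𝖠 skip λ b → if b
  then (pop 𝖠 skip λ c → if c then pop 𝖠 skip (λ _ → pop 𝖠 skip (λ _ → push 𝖡 true ▷ push 𝖪 true)) else (push 𝖡 false ▷ push 𝖪 true))
  else skip

fromTree : SProg 4
fromTree = push 𝖪 true ▷ loop 𝖪 unbuild ▷ unloadB

unbuild-run : ∀ l {β} → loop 𝖪 unbuild ⊩ stacks (code (enc Num l) ++ []) β [] (true ∷ []) ⇓ stacks [] (l ʳ++ β) [] [] # 7 * length l + 4
unbuild-run []          = loop-bit refl (pop-bit refl run-skip) (loop-end refl)
unbuild-run (true ∷ l)  = slack (≤-reflexive (eq (length l)))
  (loop-bit refl (pop-bit refl (pop-bit refl (pop-bit refl (pop-bit refl (run-push ⟫ run-push))))) (unbuild-run l))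
  where
  eq : ∀ n → 7 + (7 * n + 4) ≡ 7 * suc n + 4
  eq = solve-∀
unbuild-run (false ∷ l) = slack (≤-trans (m≤n+m _ 2) (≤-reflexive (eq (length l))))
  (loop-bit refl (pop-bit refl (pop-bit refl (run-push ⟫ run-push))) (unbuild-run l))
  where
  eq : ∀ n → 2 + (5 + (7 * n + 4)) ≡ 7 * suc n + 4
  eq = solve-∀

fromTree-run : ∀ l → fromTree ⊩ main (code (enc Num l) ++ []) ⇓ main l # 9 * length l + 6
fromTree-run l = subst₂ (λ v n → fromTree ⊩ main (code (enc Num l) ++ []) ⇓ main v # n) (trans (ʳ++-ʳ++ l) (++-identityʳ l))
  (trans (cong (λ z → 1 + (7 * length l + 4 + (2 * z + 1))) (trans (length-ʳ++ l) (+-identityʳ _))) (eq (length l)))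
  (run-push ⟫ unbuild-run l ⟫ unloadB-run (l ʳ++ []))
  where
  eq : ∀ n → 1 + (7 * n + 4 + (2 * n + 1)) ≡ 9 * n + 6
  eq = solve-∀

-- Leaves the head at the start of the first stack and a blank after stack i.
finish : Fin 4 → Prog
finish i = goto i ⨾ walkR isBit ⨾ write blank ⨾ home ⨾ moveR

finish-run : ∀ (σ : Stacks 4) i u v {τ} → before σ i ≡ sep ∷ u → after σ i ≡ sep ∷ v → Home σ τ →
  ∃₂ λ ls rs → finish i ⊢ τ ⇓ from ls ((u ++ bits (lookup σ i)) ++ blank ∷ rs) # 6 * vol σ + 8
finish-run σ i u v eb ea (at-home m) = _ , _ , weaken (time≤ (length (before σ i)) (length (bits s)) (vol σ) (≤-trans (m≤m+n _ _) (≤-reflexive (sym split))))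
    (goto-run σ i ⨟ subst (λ z → walkR isBit ⊢ from ls₀ (bits s ++ after σ i ++ blanks m) ⇓ from (bits s ʳ++ ls₀) (z ++ blanks m) # 2 * length (bits s) + 1) ea
        (walkR-run (bits s) (bits-isBit s) (after-head σ i _ m)) ⨟
      write-run ⨟
      subst₂ (λ l n → home ⊢ from l (blank ∷ v ++ blanks m) ⇓ from (blank ∷ []) ((sep ∷ u ++ bits s) ++ blank ∷ v ++ blanks m) # 2 * n + 5)
        (trans (++-ʳ++ (sep ∷ u) {bits s}) (cong (λ z → bits s ʳ++ (z ʳ++ (blank ∷ []))) (sym eb)))
        (trans (length-++ (sep ∷ u)) (cong (λ z → length z + length (bits s)) (sym eb)))
        (home-run sep (u ++ bits s) (++⁺ (subst NonBlank eb (before-nonblank σ i)) (bits-nonblank s))) ⨟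
      moveR-run)
  where
  s = lookup σ i
  ls₀ = before σ i ʳ++ (blank ∷ [])
  split : vol σ ≡ length (before σ i) + length (bits s) + length (after σ i)
  split = trans (vol-split σ i) (trans (sym (+-assoc (length (before σ i)) (length s) _)) (cong (λ z → length (before σ i) + z + length (after σ i)) (sym (length-map bitSym s))))
  time≤ : ∀ a b n → a + b ≤ n → 2 * a + (2 * b + 1 + (1 + (2 * (a + b) + 5 + 1))) ≤ 6 * n + 8
  time≤ a b n le = ≤-trans (m+k≡n⇒m≤n (2 * (a + b)) (eq a b)) (+-monoˡ-≤ 8 (*-monoʳ-≤ 6 le))
    where
    eq : ∀ a b → 2 * a + (2 * b + 1 + (1 + (2 * (a + b) + 5 + 1))) + 2 * (a + b) ≡ 6 * (a + b) + 8
    eq = solve-∀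

readOut-bits : ∀ u {rs} → NonBlank u → readOut (u ++ blank ∷ rs) ≡ u
readOut-bits []        []       = refl
readOut-bits (s0 ∷ u)  (x ∷ xs) = cong (s0 ∷_) (readOut-bits u xs)
readOut-bits (s1 ∷ u)  (x ∷ xs) = cong (s1 ∷_) (readOut-bits u xs)
readOut-bits (sep ∷ u) (x ∷ xs) = cong (sep ∷_) (readOut-bits u xs)

-- The output consists of the stacks up to `i`, with the layout's own separators between them; `E`
-- can add a further stack. Thus a fraction with denominator 1 is printed by pushing one bit on 𝖡
-- and stopping there.
implement : SProg 4 → SProg 4 → Fin 4 → TM
implement P E i = machine (prepare ⨾ compile (toTree ▷ P ▷ fromTree ▷ E) ⨾ finish i)

opaque
  -- With X = 2 + n + T the whole run takes at most 1276 X² steps, and 1276 ≤ 2 ^ 15 ≤ X ^ 15. A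
  -- pure power is what `pow-pow` can compose.
  total-time : ℕ → ℕ → ℕ
  total-time n T = (2 + (n + T)) ^ 17

  total-time-bound : ∀ n T M t → t ≡ 7 * n + 3 + (T + (9 * T + 6 + 1)) → M ≡ 4 + n + t →
    suc (4 * n + 22 + (t * cost M + (6 * M + 8))) ≤ total-time n T
  total-time-bound n T M t et eM = ≤-trans (+-mono-≤ h₁ (+-mono-≤ (*-mono-≤ ht hc) h₂)) (≤-trans (≤-reflexive (eq₁ X))
      (≤-trans (+-monoʳ-≤ (1200 * (X * X)) (*-monoʳ-≤ 76 (m≤m*n X X))) (≤-trans (≤-reflexive (eq₂ X))
        (≤-trans (*-monoˡ-≤ (X * X) (≤-trans (≤ᵇ⇒≤ 1276 (2 ^ 15) tt) (^-monoˡ-≤ 15 (m≤m+n 2 (n + T)))))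
          (≤-reflexive (trans (cong (λ z → X ^ 15 * (X * z)) (sym (*-identityʳ X))) (sym (^-distribˡ-+-* X 15 2))))))))
    where
    X : ℕ
    X = 2 + (n + T)
    e₁ : ∀ n T → 7 * n + 3 + (T + (9 * T + 6 + 1)) + (3 * n + 10) ≡ 10 * (2 + (n + T))
    e₁ = solve-∀
    e₂ : ∀ n T → 4 + n + (7 * n + 3 + (T + (9 * T + 6 + 1))) + (2 * n + 6) ≡ 10 * (2 + (n + T))
    e₂ = solve-∀
    e₃ : ∀ n T → suc (4 * n + 22) + (8 * n + 12 * T + 1) ≡ 12 * (2 + (n + T))
    e₃ = solve-∀
    e₄ : ∀ x → 11 * (10 * x) + 10 * x ≡ 120 * x
    e₄ = solve-∀
    e₅ : ∀ x → 6 * (10 * x) + 4 * x ≡ 64 * x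
    e₅ = solve-∀
    eq₁ : ∀ x → 12 * x + (10 * x * (120 * x) + 64 * x) ≡ 1200 * (x * x) + 76 * x
    eq₁ = solve-∀
    eq₂ : ∀ x → 1200 * (x * x) + 76 * (x * x) ≡ 1276 * (x * x)
    eq₂ = solve-∀
    ht : t ≤ 10 * X
    ht = ≤-trans (≤-reflexive et) (m+k≡n⇒m≤n (3 * n + 10) (e₁ n T))
    hM : M ≤ 10 * X
    hM = ≤-trans (≤-reflexive (trans eM (cong (4 + n +_) et))) (m+k≡n⇒m≤n (2 * n + 6) (e₂ n T))
    h₁ : suc (4 * n + 22) ≤ 12 * X
    h₁ = m+k≡n⇒m≤n (8 * n + 12 * T + 1) (e₃ n T)
    hc : cost M ≤ 120 * X
    hc = ≤-trans (+-mono-≤ (*-monoʳ-≤ 11 hM) (*-monoʳ-≤ 10 (m≤m+n 2 (n + T)))) (≤-reflexive (e₄ X))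
    h₂ : 6 * M + 8 ≤ 64 * X
    h₂ = ≤-trans (+-mono-≤ (*-monoʳ-≤ 6 hM) (*-monoʳ-≤ 4 (m≤m+n 2 (n + T)))) (≤-reflexive (e₅ X))

  total-time-pos : ∀ n T → 1 ≤ total-time n T
  total-time-pos n T = m^n>0 (2 + (n + T)) 17

  total-time-pow : ∀ c d → ∃ λ e → ∀ y n T → n ≤ (2 + y) ^ c → T ≤ (2 + y) ^ d → total-time n T ≤ (2 + y) ^ e
  total-time-pow c d = (2 + suc (c + d)) * 17 , λ y n T hn hT → pow-pow y (n + T) 17 (suc (c + d)) (≤-trans (+-mono-≤ hn hT) (pow-+ y c d))

implement-halts : ∀ {P E T out} w (σ : Stacks 4) i u v → P ∶ enc Num w ↦ enc Num out # T → length out ≤ T →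
  E ⊩ main out ⇓ σ # 1 → before σ i ≡ sep ∷ u → after σ i ≡ sep ∷ v →
  ∀ {t′} → total-time (length w) T ≤ t′ → HaltsWith (implement P E i) (map bitSym w) t′ (u ++ bits (lookup σ i))
implement-halts {P} {E} {T} {out} w σ i u v comp len run-E eb ea {t′} le =
  subst (HaltsWith (implement P E i) (map bitSym w) t′) (readOut-bits (u ++ bits (lookup σ i)) nb) halting
  where
  n = length w
  t = 7 * n + 3 + (T + (9 * T + 6 + 1))
  M = 4 + n + t
  vol₀ : vol (main w) ≡ 4 + n
  vol₀ = cong suc (trans (length-++ (bits w)) (trans (cong (_+ 3) (length-map bitSym w)) (+-comm n 3)))
  core : toTree ▷ P ▷ fromTree ▷ E ⊩ main w ⇓ σ # t
  core = toTree-run w ⟫ comp [] ⟫ slack (+-monoˡ-≤ 6 (*-monoʳ-≤ 9 len)) (fromTree-run out) ⟫ run-E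
  start = prepare-run w
  mid = compile-run M core (≤-reflexive (cong (_+ t) vol₀)) (proj₁ (proj₂ start))
  end = finish-run σ i u v eb ea (proj₁ (proj₂ mid))
  vol≤ : vol σ ≤ M
  vol≤ = ≤-trans (vol-run core) (≤-reflexive (cong (_+ t) vol₀))
  nb : NonBlank (u ++ bits (lookup σ i))
  nb = ++⁺ (tail-nb (subst NonBlank eb (before-nonblank σ i))) (bits-nonblank (lookup σ i))
    where
    tail-nb : ∀ {u} → NonBlank (sep ∷ u) → NonBlank u
    tail-nb (_ ∷ xs) = xs
  whole : prepare ⨾ compile (toTree ▷ P ▷ fromTree ▷ E) ⨾ finish i ⊢ from [] (bits w) ⇓ from (proj₁ end) ((u ++ bits (lookup σ i)) ++ blank ∷ proj₁ (proj₂ end)) # pred t′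
  whole = weaken (pred-mono-≤ (≤-trans (s≤s (+-monoʳ-≤ (4 * n + 22) (+-monoʳ-≤ (t * cost M) (+-monoˡ-≤ 8 (*-monoʳ-≤ 6 vol≤)))))
      (≤-trans (total-time-bound n T M t refl refl) le)))
    (proj₂ (proj₂ start) ⨟ proj₂ (proj₂ mid) ⨟ proj₂ (proj₂ end))
  halting : HaltsWith (implement P E i) (map bitSym w) t′ (readOut ((u ++ bits (lookup σ i)) ++ blank ∷ proj₁ (proj₂ end)))
  halting = subst (λ z → HaltsWith (implement P E i) (map bitSym w) z (readOut ((u ++ bits (lookup σ i)) ++ blank ∷ proj₁ (proj₂ end)))) (suc-pred t′ {{>-nonZero (≤-trans (total-time-pos n T) le)}}) (machine-halts whole refl)

-- Betting on Z ∘ S, and exponential time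

4n+1≤ : ∀ n → 4 * n + 1 ≤ (2 + n) ^ 2
4n+1≤ n = m+k≡n⇒m≤n (n * n + 3) (eq n)
  where
  eq : ∀ n → 4 * n + 1 + (n * n + 3) ≡ (2 + n) * ((2 + n) * 1)
  eq = solve-∀

opaque
  integer-output : ∀ {f} → PT Num Num f → Σ TM λ M → Σ Polynomial λ p →
    ∀ x → HaltsWith M (map bitSym x) (p ⟦ length x ⟧) (map bitSym (f x) ++ sep ∷ s1 ∷ [])
  integer-output {f} pf = implement (prog pf) (push 𝖡 true) 𝖡 , powPoly D , λ x →
    subst (HaltsWith (implement (prog pf) (push 𝖡 true) 𝖡) (map bitSym x) (powPoly D ⟦ length x ⟧)) (++-assoc (map bitSym (f x)) (sep ∷ []) (s1 ∷ []))
      (implement-halts {T = T x} {f x} x (stacks (f x) (true ∷ []) [] []) 𝖡 (bits (f x) ++ sep ∷ []) (sep ∷ [])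
        (λ r → slack (m≤m+n (time pf x) (sz Num (f x))) (computes pf x r)) (≤-trans (length≤sz 𝔹 (f x)) (m≤n+m (sz Num (f x)) (time pf x))) run-push refl refl
        (≤-trans (proj₂ (total-time-pow 1 d) (length x) (length x) (T x) (≤-trans (m≤n+m (length x) 2) (≤-reflexive (sym (*-identityʳ (2 + length x))))) (T-bound x)) (powPoly-bound D (length x))))
    where
    T : List Bool → ℕ
    T x = time pf x + sz Num (f x)
    bT : Bounded Num T
    bT = bounded-+ {Num} (time-bound pf) (size-bound pf)
    c : ℕ
    c = proj₁ bT
    d : ℕ
    d = 4 * c
    D : ℕ
    D = proj₁ (total-time-pow 1 d)
    T-bound : ∀ x → T x ≤ (2 + length x) ^ d
    T-bound x = ≤-trans (proj₂ bT x) (≤-trans (^-monoˡ-≤ c (s≤s (s≤s (sz-Num x)))) (pow-pow (length x) (4 * length x + 1) c 2 (4n+1≤ (length x))))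

ℕ→ℚ : ℕ → ℚ
ℕ→ℚ m = mkℚ (ℤ.+ m) 0 (coprime-sym (1-coprimeTo m))

ℕ→ℚ-pos : ∀ {m} → 1 ≤ m → 0ℚ ℚ.< ℕ→ℚ m
ℕ→ℚ-pos (s≤s _) = ℚ.*<* (ℤ.+<+ (s≤s z≤n))

ℕ→ℚ-average : ∀ m m₀ m₁ → m₀ + m₁ ≡ 2 * m → ℕ→ℚ m ≡ ½ ℚ.* (ℕ→ℚ m₀ ℚ.+ ℕ→ℚ m₁)
ℕ→ℚ-average m m₀ m₁ e = ℚ.toℚᵘ-injective (ℚᵘ.≃-trans (*≡* eq)
  (ℚᵘ.≃-sym (ℚᵘ.≃-trans (ℚ.toℚᵘ-homo-* ½ (ℕ→ℚ m₀ ℚ.+ ℕ→ℚ m₁)) (ℚᵘ.*-congˡ {ℚ.toℚᵘ ½} (ℚ.toℚᵘ-homo-+ (ℕ→ℚ m₀) (ℕ→ℚ m₁))))))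
  where
  eq : (ℤ.+ m) ℤ.* (ℤ.+ 2) ≡ (ℤ.+ 1 ℤ.* ((ℤ.+ m₀) ℤ.* (ℤ.+ 1) ℤ.+ (ℤ.+ m₁) ℤ.* (ℤ.+ 1))) ℤ.* (ℤ.+ 1)
  eq = trans (sym (ℤ.pos-* m 2)) (trans (cong ℤ.+_ (trans (*-comm m 2) (sym e)))
    (sym (trans (ℤ.*-identityʳ _) (trans (ℤ.*-identityˡ _) (cong₂ ℤ._+_ (ℤ.*-identityʳ (ℤ.+ m₀)) (ℤ.*-identityʳ (ℤ.+ m₁)))))))

ℕ→ℚ-above : ∀ {k m} → k < m → (ℤ.+ k ℚ./ 1) ℚ.< ℕ→ℚ m
ℕ→ℚ-above {k} {m} lt = ℚ.toℚᵘ-cancel-< (ℚᵘ.<-respˡ-≃ (ℚᵘ.≃-sym (ℚ.toℚᵘ-fromℚᵘ (mkℚᵘ (ℤ.+ k) 0)))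
  (*<* (subst₂ ℤ._<_ (sym (ℤ.*-identityʳ (ℤ.+ k))) (sym (ℤ.*-identityʳ (ℤ.+ m))) (ℤ.+<+ lt))))

doubling : PT (𝕟 ⊗ 𝟙 ⊗ 𝕟) 𝕟 (λ p → proj₂ (proj₂ p) + proj₂ (proj₂ p))
doubling = (π₂ ⊚ π₂) +ₚ (π₂ ⊚ π₂)

iter-double : ∀ k m → iter k (λ v → v + v) m ≡ 2 ^ k * m
iter-double zero    m = sym (+-identityʳ m)
iter-double (suc k) m = trans (iter-double k (m + m)) (eq (2 ^ k) m)
  where
  eq : ∀ t m → t * (m + m) ≡ 2 * t * m
  eq = solve-∀

log : ∀ n → ∃ λ l → 2 + n ≤ 2 ^ l × 2 ^ l ≤ 2 * (2 + n)
log zero    = 1 , ≤-refl , s≤s (s≤s z≤n)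
log (suc n) with log n
... | l , p , q with ≤-<-connex (3 + n) (2 ^ l)
... | inj₁ le = l , le , ≤-trans q (*-monoʳ-≤ 2 (n≤1+n (2 + n)))
... | inj₂ lt = suc l , ≤-trans (m+k≡n⇒m≤n (suc n) (eq n)) (*-monoʳ-≤ 2 p) , *-monoʳ-≤ 2 (<⇒≤ lt)
  where
  eq : ∀ n → 3 + n + suc n ≡ 2 * (2 + n)
  eq = solve-∀

l[1+l]≤ : ∀ l → l * suc l ≤ 4 * 2 ^ l
l[1+l]≤ zero    = z≤n
l[1+l]≤ (suc l) = ≤-trans (≤-reflexive (eq₁ l)) (≤-trans (+-mono-≤ (l[1+l]≤ l) (*-monoʳ-≤ 2 (n≤2^n (suc l)))) (≤-reflexive (eq₂ (2 ^ l))))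
  where
  eq₁ : ∀ l → suc l * suc (suc l) ≡ l * suc l + 2 * suc l
  eq₁ = solve-∀
  eq₂ : ∀ t → 4 * t + 2 * (2 * t) ≡ 4 * (2 * t)
  eq₂ = solve-∀

-- The calculus of `Bounded` with the yardstick `F n` in place of the size of the input. As `F` may
-- be exponential in `n`, powers of it are bounds of the form 2 ^ O(n).
Growth : (ℕ → ℕ) → (ℕ → ℕ) → Set
Growth F g = ∃ λ c → ∀ n → g n ≤ (2 + F n) ^ c

opaque
  growth-≤ : ∀ {F g h} → (∀ n → g n ≤ h n) → Growth F h → Growth F g
  growth-≤ le (c , p) = c , λ n → ≤-trans (le n) (p n)

  growth-const : ∀ {F} k → Growth F (λ _ → k)
  growth-const {F} k = k , λ n → ≤-trans (n≤2^n k) (^-monoˡ-≤ k (m≤m+n 2 (F n)))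

  growth-self : ∀ {F g} → (∀ n → g n ≤ F n) → Growth F g
  growth-self {F} le = 1 , λ n → ≤-trans (le n) (≤-trans (m≤n+m (F n) 2) (≤-reflexive (sym (*-identityʳ (2 + F n)))))

  growth-+ : ∀ {F g h} → Growth F g → Growth F h → Growth F (λ n → g n + h n)
  growth-+ {F} (c , p) (d , q) = suc (c + d) , λ n → ≤-trans (+-mono-≤ (p n) (q n)) (pow-+ (F n) c d)

  growth-* : ∀ {F g h} → Growth F g → Growth F h → Growth F (λ n → g n * h n)
  growth-* {F} (c , p) (d , q) = c + d , λ n → ≤-trans (*-mono-≤ (p n) (q n)) (≤-reflexive (sym (^-distribˡ-+-* (2 + F n) c d)))

  growth-pow : ∀ {F g} c → Growth F g → Growth F (λ n → (2 + g n) ^ c)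
  growth-pow {F} {g} c (d , p) = (2 + d) * c , λ n → pow-pow (F n) (g n) c d (p n)

  growth-∘ : ∀ {F} {a : Ty} {τ : ⟦ a ⟧ᵗ → ℕ} {f : ℕ → ⟦ a ⟧ᵗ} → Bounded a τ → Growth F (λ n → sz a (f n)) → Growth F (λ n → τ (f n))
  growth-∘ {F} {f = f} (c , p) (d , q) = (2 + d) * c , λ n → ≤-trans (p (f n)) (pow-pow (F n) _ c d (q n))

  growth-total : ∀ {F g h} → Growth F g → Growth F h → Growth F (λ n → total-time (g n) (h n))
  growth-total {F} {g} {h} (c , p) (d , q) = proj₁ (total-time-pow c d) , λ n → proj₂ (total-time-pow c d) (F n) (g n) (h n) (p n) (q n)

-- With 2 + n ≤ 2 ^ l ≤ 2 (2 + n) and lev n ≤ l, the exponent of `clk n` to base 2 is at most l (1 +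
-- l) ≤ 4 * 2 ^ l ≤ 8 (2 + n).
pad : ℕ → ℕ
pad n = 8 * (2 + n)

module Theorem (S : ℕ → ℕ) (Sₚ : PT 𝕟 𝕟 S)
  (sparse : (p : Polynomial) → (m : ℕ) → Σ ℕ (λ n → (m ≤ n) × (p ⟦ S n ⟧ ≤ n))) where

  open Construction S Sₚ
  open Randomness S Sₚ sparse using (level-reached; lev-bump)

  -- A position `n` is counted only if (2 + S n) ^ (1 + lev n) ≤ n, and the base is at least 2; so
  -- the level is at most logarithmic.
  2^lev≤ : ∀ n → 2 ^ lev n ≤ suc n
  2^lev≤ zero    = ≤-refl
  2^lev≤ (suc n) with bump n (lev n) in e
  ... | true  = ≤-trans (^-monoˡ-≤ (suc (lev n)) (m≤m+n 2 (S n))) (≤-trans (bump-sound n (lev n) e) (m≤n+m n 2))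
  ... | false = m≤n⇒m≤1+n (2^lev≤ n)

  clk≤ : ∀ n → clk n ≤ 2 ^ pad n
  clk≤ n with log n
  ... | l , p , q = ≤-trans (^-monoˡ-≤ (suc (lev n)) p) (≤-trans (≤-reflexive (^-*-assoc 2 l (suc (lev n))))
      (^-monoʳ-≤ 2 (≤-trans (*-monoʳ-≤ l (s≤s lev≤l)) (≤-trans (l[1+l]≤ l) (≤-trans (*-monoʳ-≤ 4 q) (≤-reflexive (sym (*-assoc 4 2 (2 + n)))))))))
    where
    lev≤l : lev n ≤ l
    lev≤l with ≤-<-connex (lev n) l
    ... | inj₁ le = le
    ... | inj₂ lt = contradiction (≤-trans (^-monoʳ-≤ 2 (<⇒≤ lt)) (2^lev≤ n)) (<⇒≱ (≤-trans (n<1+n (suc n)) p))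

  -- Deciding Z in exponential time

  module Exp where

    open Fold {𝕟} {𝟙} {𝕟} doubling using (body; fold-loop; deg)

    Init : Ty
    Init = 𝕃 𝟙 ⊗ 𝕟 ⊗ 𝕟

    opaque
      initₚ : PT Num Init (λ w → replicate (pad (length w)) tt , length w , 1)
      initₚ = (unitsₚ ⊚ (constP 𝕟 8 *ₚ (constP 𝕟 2 +ₚ lengthₚ))) & lengthₚ & constP 𝕟 1

      postₚ : PT Init Num (λ p → Zcap (proj₂ (proj₂ p)) (proj₁ (proj₂ p)) ∷ [])
      postₚ = (Zcapₚ ⊚ ((π₂ ⊚ π₂) & (π₁ ⊚ π₂))) ∷ₚ []ₚ

    F : ℕ → ℕ
    F n = 2 ^ pad n

    pad≤F : ∀ n → pad n ≤ F n
    pad≤F n = n≤2^n (pad n)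

    n≤F : ∀ n → n ≤ F n
    n≤F n = ≤-trans (≤-trans (m≤n+m n 2) (m≤n*m (2 + n) 8)) (pad≤F n)

    V : ℕ → ℕ
    V n = sz 𝕟 (F n)

    fold-double : ∀ k → foldl (λ v e → v + v) 1 (replicate k tt) ≡ 2 ^ k
    fold-double k = trans (foldl-units (λ v → v + v) 1 k) (trans (iter-double k 1) (*-identityʳ _))

    sz-mono : ∀ {x y} → x ≤ y → sz 𝕟 x ≤ sz 𝕟 y
    sz-mono {x} {y} le = ≤-trans (≤-reflexive (sz-𝕟 x)) (≤-trans (+-monoˡ-≤ 1 (*-monoʳ-≤ 2 le)) (≤-reflexive (sym (sz-𝕟 y))))

    loop-time : ℕ → ℕ
    loop-time n = length (replicate (pad n) tt) * (6 + (2 + (2 + sz (𝕃 𝟙) (replicate (pad n) tt) + sz 𝕟 n + V n)) ^ deg) + 7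

    -- The unary number `2 ^ pad n` is written by repeated doubling. This loop is not polynomial in
    -- `n`, so its time is taken from `fold-loop` directly instead of from `foldₚ`.
    doubled : ∀ n → Loop (prog body) (enc Init (replicate (pad n) tt , n , 1)) (enc Init ([] , n , F n)) (loop-time n)
    doubled n = subst (λ z → Loop (prog body) (enc Init (replicate (pad n) tt , n , 1)) (enc Init ([] , n , z)) (loop-time n)) (fold-double (pad n))
      (fold-loop (V n) n 1 (replicate (pad n) tt) small)
      where
      small : ∀ ys zs → ys ++ zs ≡ replicate (pad n) tt → sz 𝕟 (foldl (λ v e → v + v) 1 ys) ≤ V n
      small ys zs eq with units-split ys zs (pad n) eq
      ... | p , q = sz-mono (≤-trans (≤-reflexive (trans (cong (foldl (λ v e → v + v) 1) p) (fold-double (length ys)))) (^-monoʳ-≤ 2 q))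

    zprog : SProg 4
    zprog = prog initₚ ▷ whileP (prog body) ▷ prog postₚ

    T : ℕ → ℕ
    T n = time initₚ (replicate n false) + (suc (loop-time n) + time postₚ ([] , n , F n))

    zprog-computes : ∀ n → zprog ∶ enc Num (replicate n false) ↦ enc Num (Z n ∷ []) # T n
    zprog-computes n = then-computes {x = enc Num (replicate n false)} {enc Init (replicate (pad n) tt , n , 1)} {enc Num (Z n ∷ [])}
      (subst (λ l → prog initₚ ∶ enc Num (replicate n false) ↦ enc Init (replicate (pad l) tt , l , 1) # time initₚ (replicate n false)) (length-replicate n) (computes initₚ (replicate n false)))
      (then-computes {x = enc Init (replicate (pad n) tt , n , 1)} {enc Init ([] , n , F n)} {enc Num (Z n ∷ [])} (while-computes (doubled n))
        (subst (λ b → prog postₚ ∶ enc Init ([] , n , F n) ↦ enc Num (b ∷ []) # time postₚ ([] , n , F n)) (Zcap≡Z (F n) n (clk≤ n)) (computes postₚ ([] , n , F n))))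

    g-sz : ∀ {f : ℕ → ℕ} → (∀ n → f n ≤ F n) → Growth F (λ n → sz 𝕟 (f n))
    g-sz {f} le = growth-≤ {F} (λ n → ≤-reflexive (sz-𝕟 (f n))) (growth-+ {F} (growth-* {F} (growth-const {F} 2) (growth-self {F} le)) (growth-const {F} 1))

    g-length : Growth F (λ n → length (replicate n false))
    g-length = growth-self {F} (λ n → ≤-trans (≤-reflexive (length-replicate n)) (n≤F n))

    g-input : Growth F (λ n → sz Num (replicate n false))
    g-input = growth-≤ {F} (λ n → sz-Num (replicate n false)) (growth-+ {F} (growth-* {F} (growth-const {F} 4) g-length) (growth-const {F} 1))

    g-pad : Growth F (λ n → sz (𝕃 𝟙) (replicate (pad n) tt))
    g-pad = growth-≤ {F} (λ n → ≤-reflexive (cong size (sym (enc-units (pad n))))) (g-sz {pad} pad≤F)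

    g-loop : Growth F loop-time
    g-loop = growth-+ {F} (growth-* {F} (growth-self {F} (λ n → ≤-trans (≤-reflexive (length-replicate (pad n))) (pad≤F n)))
      (growth-+ {F} (growth-const {F} 6) (growth-pow {F} deg (growth-+ {F} (growth-+ {F} (growth-+ {F} (growth-const {F} 2) g-pad) (g-sz {λ n → n} n≤F)) (g-sz {F} (λ n → ≤-refl)))))) (growth-const {F} 7)

    g-T : Growth F T
    g-T = growth-+ {F} (growth-∘ {F} {Num} {f = λ n → replicate n false} (time-bound initₚ) g-input)
      (growth-+ {F} (growth-+ {F} (growth-const {F} 1) g-loop)
        (growth-∘ {F} {Init} {f = λ n → [] , n , F n} (time-bound postₚ) (growth-+ {F} (growth-const {F} 3) (growth-+ {F} (g-sz {λ n → n} n≤F) (g-sz {F} (λ n → ≤-refl))))))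

    g-total : Growth F (λ n → total-time (length (replicate n false)) (T n))
    g-total = growth-total {F} g-length g-T

    D : ℕ
    D = proj₁ g-total

    -- From 2 + F n ≤ F n ^ 2 the time is at most 2 ^ (2 D * pad n), and 2 D * 8 (2 + n) = 16 D n +
    -- 32 D.
    final : ∀ n → total-time (length (replicate n false)) (T n) ≤ 2 ^ (32 * D * n + 32 * D)
    final n = ≤-trans (proj₂ g-total n)
      (≤-trans (^-monoˡ-≤ D 2+F≤) (≤-trans (≤-reflexive (trans (^-*-assoc (F n) 2 D) (^-*-assoc 2 (pad n) (2 * D)))) (^-monoʳ-≤ 2 (m+k≡n⇒m≤n (16 * D * n) (eq n D)))))
      where
      eq : ∀ n D → 8 * (2 + n) * (2 * D) + 16 * D * n ≡ 32 * D * n + 32 * D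
      eq = solve-∀
      2≤F : 2 ≤ F n
      2≤F = ≤-trans (≤-trans (m≤m+n 2 n) (m≤n*m (2 + n) 8)) (pad≤F n)
      2+F≤ : 2 + F n ≤ F n ^ 2
      2+F≤ = ≤-trans (+-monoˡ-≤ (F n) 2≤F) (≤-trans (≤-reflexive (cong (F n +_) (sym (+-identityʳ (F n))))) (≤-trans (*-monoˡ-≤ (F n) 2≤F) (≤-reflexive (cong (F n *_) (sym (*-identityʳ (F n)))))))

    Z-exp : ExpTimeSet Z
    Z-exp = implement zprog skip 𝖠 , 32 * D , λ n →
      subst (λ x → HaltsWith (implement zprog skip 𝖠) x (2 ^ (32 * D * n + 32 * D)) (bitSym (Z n) ∷ [])) (sym (unary-bits n))
        (implement-halts (replicate n false) (main (Z n ∷ [])) 𝖠 [] (sep ∷ sep ∷ []) (zprog-computes n)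
          (≤-trans (s≤s z≤n) (m≤n+m (suc (loop-time n) + time postₚ ([] , n , F n)) (time initₚ (replicate n false)))) run-skip refl refl (final n))

  -- A gambler who succeeds on Z ∘ S

  Bets : Ty
  Bets = 𝕟 ⊗ 𝕟 ⊗ 𝔹 ⊗ 𝕟

  agree : Bool → Bool → Bool
  agree b c = cond b c (not c)

  -- Capital is staked (one unit at a time) only while every prediction has been right.
  bet : Bool → Bool × ℕ → Bool × ℕ
  bet hit (alive , m) = cond alive (cond hit (true , suc m) (false , pred m)) (alive , m)

  -- At a counted position `clk (S j) ≤ j`, so the cap `j` already yields the true bit of `Z` at
  -- `S j`, in time polynomial in `j`. At other positions nothing is staked.
  advance : Bool → ⟦ Bets ⟧ᵗ → ⟦ Bets ⟧ᵗ
  advance b (j , e , r) = suc j , cond (bump j e) (suc e) e , cond (bump j e) (bet (agree b (Zcap j (S j))) r) r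

  betting : List Bool → ⟦ Bets ⟧ᵗ
  betting = foldl (λ s b → advance b s) (0 , 0 , true , 2)

  capital : List Bool → ℕ
  capital x = proj₂ (proj₂ (proj₂ (betting x)))

  -- A loss costs one unit and must leave a positive capital; hence at least 2 is required while
  -- bets are still placed.
  Solvent : ⟦ Bets ⟧ᵗ → Set
  Solvent (_ , _ , alive , m) = 1 ≤ m × (alive ≡ true → 2 ≤ m)

  advance-solvent : ∀ b s → Solvent s → Solvent (advance b s)
  advance-solvent b (j , e , alive , m) h with bump j e
  ... | false = h
  ... | true with alive | agree b (Zcap j (S j))
  ...   | false | _     = h
  ...   | true  | true  = s≤s z≤n , λ _ → m≤n⇒m≤1+n (proj₂ h refl)
  ...   | true  | false = ≤-pred (≤-trans (proj₂ h refl) (m≤n+pred m)) , λ ()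
    where
    m≤n+pred : ∀ m → m ≤ suc (pred m)
    m≤n+pred zero    = z≤n
    m≤n+pred (suc m) = ≤-refl

  betting-solvent : ∀ x s → Solvent s → Solvent (foldl (λ s b → advance b s) s x)
  betting-solvent []      s h = h
  betting-solvent (b ∷ x) s h = betting-solvent x (advance b s) (advance-solvent b s h)

  solvent : ∀ x → Solvent (betting x)
  solvent x = betting-solvent x _ (s≤s z≤n , λ _ → ≤-refl)

  betting-snoc : ∀ x b → betting (x ++ b ∷ []) ≡ advance b (betting x)
  betting-snoc x b = foldl-++ (λ s b → advance b s) (0 , 0 , true , 2) x (b ∷ [])

  win-lose : ∀ m → 1 ≤ m → suc m + pred m ≡ 2 * m
  win-lose (suc m) _ = trans (cong suc (sym (+-suc m m))) (cong (suc m +_) (sym (+-identityʳ (suc m))))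

  advance-fair : ∀ s → Solvent s → proj₂ (proj₂ (proj₂ (advance false s))) + proj₂ (proj₂ (proj₂ (advance true s))) ≡ 2 * proj₂ (proj₂ (proj₂ s))
  advance-fair (j , e , alive , m) h with bump j e
  ... | false = cong (m +_) (sym (+-identityʳ m))
  ... | true with alive | Zcap j (S j)
  ...   | false | _     = cong (m +_) (sym (+-identityʳ m))
  ...   | true  | true  = trans (+-comm (pred m) (suc m)) (win-lose m (proj₁ h))
  ...   | true  | false = win-lose m (proj₁ h)

  gambler : Martingale
  gambler = record
    { M        = λ x → ℕ→ℚ (capital x)
    ; positive = λ x → ℕ→ℚ-pos (proj₁ (solvent x))
    ; fair     = λ x → ℕ→ℚ-average (capital x) (capital (x ++ false ∷ [])) (capital (x ++ true ∷ [])) (trans (cong₂ _+_ (last-capital x false) (last-capital x true)) (advance-fair (betting x) (solvent x)))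
    }
    where
    last-capital : ∀ x b → capital (x ++ b ∷ []) ≡ proj₂ (proj₂ (proj₂ (advance b (betting x))))
    last-capital x b = cong (proj₂ ∘ proj₂ ∘ proj₂) (betting-snoc x b)

  opaque
    advanceₚ : PT (Num ⊗ 𝔹 ⊗ Bets) Bets (λ p → advance (proj₁ (proj₂ p)) (proj₂ (proj₂ p)))
    advanceₚ = sucₚ j & ifₚ bumped (sucₚ e) e & ifₚ bumped (betₚ ⊚ (ifₚ (π₁ ⊚ π₂) z (notₚ z) & (π₂ ⊚ π₂ ⊚ π₂ ⊚ π₂))) (π₂ ⊚ π₂ ⊚ π₂ ⊚ π₂)
      where
      j : PT (Num ⊗ 𝔹 ⊗ Bets) 𝕟 (λ p → proj₁ (proj₂ (proj₂ p)))
      j = π₁ ⊚ π₂ ⊚ π₂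
      e : PT (Num ⊗ 𝔹 ⊗ Bets) 𝕟 (λ p → proj₁ (proj₂ (proj₂ (proj₂ p))))
      e = π₁ ⊚ π₂ ⊚ π₂ ⊚ π₂
      bumped : PT (Num ⊗ 𝔹 ⊗ Bets) 𝔹 (λ p → bump (proj₁ (proj₂ (proj₂ p))) (proj₁ (proj₂ (proj₂ (proj₂ p)))))
      bumped = bumpₚ j e
      z : PT (Num ⊗ 𝔹 ⊗ Bets) 𝔹 (λ p → Zcap (proj₁ (proj₂ (proj₂ p))) (S (proj₁ (proj₂ (proj₂ p)))))
      z = Zcapₚ ⊚ (j & (Sₚ ⊚ j))
      betₚ : PT (𝔹 ⊗ 𝔹 ⊗ 𝕟) (𝔹 ⊗ 𝕟) (λ p → bet (proj₁ p) (proj₂ p))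
      betₚ = ifₚ (π₁ ⊚ π₂) (ifₚ π₁ (trueₚ & sucₚ (π₂ ⊚ π₂)) (falseₚ & (predₚ ⊚ π₂ ⊚ π₂))) π₂

    bet-growth : ∀ hit r → sz (𝔹 ⊗ 𝕟) (bet hit r) ≤ sz (𝔹 ⊗ 𝕟) r + 4
    bet-growth hit (alive , m) = cond-≤ (sz (𝔹 ⊗ 𝕟)) alive (cond-≤ (sz (𝔹 ⊗ 𝕟)) hit won lost) (m≤m+n _ 4)
      where
      eq : ∀ a m → suc (2 + a + (2 + m)) ≡ suc (a + m) + 4
      eq = solve-∀
      won : sz (𝔹 ⊗ 𝕟) (true , suc m) ≤ sz (𝔹 ⊗ 𝕟) (alive , m) + 4
      won = ≤-trans (s≤s (+-monoˡ-≤ (2 + sz 𝕟 m) (+-monoʳ-≤ 2 (1≤sz 𝔹 alive)))) (≤-reflexive (eq (sz 𝔹 alive) (sz 𝕟 m)))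
      lost : sz (𝔹 ⊗ 𝕟) (false , pred m) ≤ sz (𝔹 ⊗ 𝕟) (alive , m) + 4
      lost = ≤-trans (s≤s (+-mono-≤ (1≤sz 𝔹 alive) (sz-pred m))) (m≤m+n _ 4)

    advance-growth : ∀ b s → sz Bets (advance b s) ≤ sz Bets s + 8
    advance-growth b (j , e , r) = ≤-trans (s≤s (+-monoʳ-≤ (2 + sz 𝕟 j) (s≤s (+-mono-≤
        (cond-≤ (sz 𝕟) (bump j e) {suc e} {e} {2 + sz 𝕟 e} ≤-refl (m≤n+m _ 2))
        (cond-≤ (sz (𝔹 ⊗ 𝕟)) (bump j e) {bet (agree b (Zcap j (S j))) r} {r} {sz (𝔹 ⊗ 𝕟) r + 4} (bet-growth _ r) (m≤m+n _ 4))))))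
      (≤-reflexive (eq (sz 𝕟 j) (sz 𝕟 e) (sz (𝔹 ⊗ 𝕟) r)))
      where
      eq : ∀ j e r → suc (2 + j + suc (2 + e + (r + 4))) ≡ suc (j + suc (e + r)) + 8
      eq = solve-∀

    capitalₚ : PT Num Num (λ x → reverse (toBits (capital x)))
    capitalₚ = reverseₚ ⊚ toBitsₚ (π₂ ⊚ π₂ ⊚ π₂ ⊚ fold-add {Num} {𝔹} {Bets} advanceₚ (λ _ → 8) (bounded-const {Num ⊗ 𝔹} 8) (λ γ b s → advance-growth b s) var (constP Bets (0 , 0 , true , 2)))

  gambler-polyTime : PolyTimeMartingale gambler
  gambler-polyTime = proj₁ out , proj₁ (proj₂ out) , λ x →
    subst (HaltsWith (proj₁ out) (map bitSym x) (proj₁ (proj₂ out) ⟦ length x ⟧)) (cong (λ z → map bitSym z ++ sep ∷ s1 ∷ []) (sym (binary-toBits (capital x)))) (proj₂ (proj₂ out) x)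
    where
    out : Σ TM λ M → Σ Polynomial λ p → ∀ x → HaltsWith M (map bitSym x) (p ⟦ length x ⟧) (map bitSym (reverse (toBits (capital x))) ++ sep ∷ s1 ∷ [])
    out = integer-output capitalₚ

  -- The bound (2 + S n) ^ (1 + lev n) ≤ n also gives S n ≤ n, hence lev (S n) ≤ lev n; so it covers
  -- the clock at `S n`, whose exponent is the level there.
  predicted : ∀ n → bump n (lev n) ≡ true → Zcap n (S n) ≡ Z (S n)
  predicted n h = Zcap≡Z n (S n) (≤-trans (^-monoʳ-≤ (2 + S n) (s≤s (lev-mono S≤))) le)
    where
    le : (2 + S n) ^ suc (lev n) ≤ n
    le = bump-sound n (lev n) h
    S≤ : S n ≤ n
    S≤ = ≤-trans (m≤n+m (S n) 2) (≤-trans (≤-trans (≤-reflexive (sym (*-identityʳ (2 + S n)))) (*-monoʳ-≤ (2 + S n) (m^n>0 (2 + S n) (lev n)))) le)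

  agree-refl : ∀ b → agree b b ≡ true
  agree-refl true  = refl
  agree-refl false = refl

  -- Along `Z ∘ˢ S` every prediction is right, so betting never stops and each counted position adds
  -- one unit to the initial 2.
  winning : ∀ n → betting ((Z ∘ˢ S) ↾ n) ≡ (n , lev n , true , 2 + lev n)
  winning zero    = refl
  winning (suc n) = trans (cong betting (trans (cong (map (Z ∘ˢ S)) (sym (upTo-∷ʳ n))) (map-++ (Z ∘ˢ S) (upTo n) (n ∷ []))))
    (trans (betting-snoc ((Z ∘ˢ S) ↾ n) (Z (S n))) (trans (cong (advance (Z (S n))) (winning n)) (onward (bump n (lev n)) refl)))
    where
    onward : ∀ c → bump n (lev n) ≡ c → advance (Z (S n)) (n , lev n , true , 2 + lev n) ≡ (suc n , lev (suc n) , true , 2 + lev (suc n))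
    onward true  h rewrite h | predicted n h | agree-refl (Z (S n)) = refl
    onward false h rewrite h = refl

  gambler-succeeds : Succeeds gambler (Z ∘ˢ S)
  gambler-succeeds k m with level-reached k
  ... | n , le = n + m , m≤n+m m n , ℕ→ℚ-above (≤-trans (s≤s (≤-trans le (lev-mono (m≤m+n n m)))) (≤-trans (n≤1+n _) (≤-reflexive (cong (proj₂ ∘ proj₂ ∘ proj₂) (sym (winning (n + m)))))))

theorem2p2 : (S : ℕ → ℕ) → IsPermutation S → PolyTimeFunction S →
    ((p : Polynomial) → (m : ℕ) → Σ ℕ (λ n → (m ≤ n) × (p ⟦ S n ⟧ ≤ n))) →
    Σ (ℕ → Bool) (λ Z → PolyTimeRandom Z × ExpTimeSet Z × ¬ PolyTimeRandom (Z ∘ˢ S))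
theorem2p2 S _ polyTime sparse = Z , Z-random , Exp.Z-exp , λ random → random gambler gambler-polyTime gambler-succeeds
  where
  Sₚ = polyTimeFunctionₚ polyTime
  open Construction S Sₚ using (Z)
  open Randomness S Sₚ sparse using (Z-random)
  open Theorem S Sₚ sparse
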